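{- Let $d\ge1$ and let $g$ be a rigid Carmichael polynomial of order $d$ in $\mathbb{F}_q[t]$. Then $g$ is Carmichael in every finite separable extension $K$ of $\mathbb{F}_q(t)$ of degree $d$ whose discriminant is relatively prime to $g$.
   Context: $\mathbb{F}_q$ is the finite field with $q$ elements. A rigid Carmichael polynomial of order $d$ in $\mathbb{F}_q[t]$ is a reducible square-free polynomial $g$ such that $i\cdot\deg P$ divides $d\cdot\deg g$ for every irreducible polynomial $P$ dividing $g$ and every $i=1,\dots,d$. A finite ring $S$ is a Carmichael ring if $S$ is not a field and $a^{|S|}=a$ for every $a\in S$; an ideal $I$ of a ring $R$ is a Carmichael ideal if $R/I$ is a Carmichael ring. For a finite extension $K$ of $\mathbb{F}_q(t)$, $\mathcal{O}_K$ denotes the integral closure of $\mathbb{F}_q[t]$ in $K$, and an element $\alpha\in\mathcal{O}_K$ is Carmichael in $K$ if $\alpha\mathcal{O}_K$ is a Carmichael ideal of $\mathcal{O}_K$. The discriminant of $K$ is the discriminant ideal of $\mathcal{O}_K$ over $\mathbb{F}_q[t]$; "relatively prime to $g$" means no irreducible factor of $g$ divides it. -}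

module Defs where

open import Algebra.Bundles using (CommutativeRing; RawRing; Semiring)
open import Algebra.Core using (Op₁; Op₂)
open import Algebra.Definitions using (AlmostLeftCancellative)
open import Algebra.Morphism.Bundles using (RingHomomorphism)
open import Algebra.Morphism.Construct.Composition using (ringHomomorphism)
open import Algebra.Morphism.Structures using (IsRingHomomorphism; IsRingMonomorphism)
open import Algebra.Structures using (IsCommutativeRing)
import Algebra.Definitions.RawMagma as RawMagmaDefinitions
import Algebra.Definitions.RawSemiring as RawSemiringDefinitions
import Algebra.Morphism.RingMonomorphism as RingMonomorphism
import Algebra.Properties.Ring as RingProperties
import Algebra.Properties.Semiring.Sum as SemiringSum
import Algebra.Solver.Ring.NaturalCoefficients.Default as SemiringSolver
open import Data.Empty using (⊥-elim)
open import Data.Fin.Base using (Fin; zero; suc; toℕ; fromℕ<; punchIn; combine; remQuot)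
import Data.Fin.Properties as Fin
open import Data.List.Base using (List; []; _∷_; map)
open import Data.Nat.Base as ℕ using (ℕ; zero; suc; z≤n; s≤s)
import Data.Nat.Properties as ℕ
import Data.Nat.Divisibility as ℕ
open import Data.Product.Base using (∃; ∃-syntax; Σ-syntax; _×_; _,_; proj₁; proj₂)
open import Data.Sum.Base using (_⊎_; inj₁; inj₂)
open import Function.Bundles using (Inverse)
open import Level using (Level; _⊔_) renaming (suc to lsuc)
open import Relation.Binary.Core using (Rel)
open import Relation.Binary.Definitions using (Decidable)
import Relation.Binary.PropositionalEquality as ≡
open ≡ using (_≡_)
import Relation.Binary.Reasoning.Setoid as SetoidReasoning
open import Relation.Binary.Structures using (IsEquivalence)
open import Relation.Nullary.Decidable using (Dec; yes; no; map′)
open import Relation.Nullary.Negation using (¬_)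
open import Relation.Unary using (Pred)

private
  variable
    a b c c′ ℓ ℓ′ ℓ₁ ℓ₂ : Level

Hom : CommutativeRing a ℓ₁ → CommutativeRing b ℓ₂ → Set (a ⊔ b ⊔ ℓ₁ ⊔ ℓ₂)
Hom A B = RingHomomorphism (CommutativeRing.rawRing A) (CommutativeRing.rawRing B)

-- The library's notions for semirings (divisibility, coprimality,
-- irreducibility, powers, finite sums), at a commutative ring.
module RingNotions {c ℓ} (R : CommutativeRing c ℓ) =
  RawSemiringDefinitions (Semiring.rawSemiring (CommutativeRing.semiring R))

record IsField (R : CommutativeRing c ℓ) : Set (c ⊔ ℓ) where
  open CommutativeRing R
  field
    0≉1     : ¬ (0# ≈ 1#)
    inverse : ∀ x → ¬ (x ≈ 0#) → ∃[ y ] x * y ≈ 1#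

HasCardinality : CommutativeRing c ℓ → ℕ → Set (c ⊔ ℓ)
HasCardinality R n = Inverse (≡.setoid (Fin n)) (CommutativeRing.setoid R)

finite⇒decidable : (R : CommutativeRing c ℓ) {n : ℕ} → HasCardinality R n →
                   Decidable (CommutativeRing._≈_ R)
finite⇒decidable R card x y =
  map′ (λ eq → trans (sym (inverseˡ {x} ≡.refl)) (inverseˡ {y} eq)) from-cong
       (from x Fin.≟ from y)
  where
  open Inverse card
  open CommutativeRing R

private
  ringFromLaws : {A : Set a} {_≈_ : Rel A ℓ} {_+_ _*_ : Op₂ A} { -_ : Op₁ A} {0# 1# : A} →
    IsEquivalence _≈_ →
    (∀ {x x′ y y′} → x ≈ x′ → y ≈ y′ → (x + y) ≈ (x′ + y′)) →
    (∀ {x x′ y y′} → x ≈ x′ → y ≈ y′ → (x * y) ≈ (x′ * y′)) →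
    (∀ {x x′} → x ≈ x′ → (- x) ≈ (- x′)) →
    (∀ x y z → ((x + y) + z) ≈ (x + (y + z))) →
    (∀ x y → (x + y) ≈ (y + x)) →
    (∀ x → (0# + x) ≈ x) →
    (∀ x → ((- x) + x) ≈ 0#) →
    (∀ x y z → ((x * y) * z) ≈ (x * (y * z))) →
    (∀ x y → (x * y) ≈ (y * x)) →
    (∀ x → (1# * x) ≈ x) →
    (∀ x y z → ((y + z) * x) ≈ ((y * x) + (z * x))) →
    IsCommutativeRing _≈_ _+_ _*_ -_ 0# 1#
  ringFromLaws equiv +-cong *-cong -‿cong +-assoc +-comm +-idˡ -‿invˡ *-assoc *-comm *-idˡ distribʳ = record
    { isRing = record
      { +-isAbelianGroup = record
        { isGroup = record
          { isMonoid = record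
            { isSemigroup = record
              { isMagma = record { isEquivalence = equiv ; ∙-cong = +-cong }
              ; assoc = +-assoc
              }
            ; identity = +-idˡ , λ x → trans (+-comm _ _) (+-idˡ x)
            }
          ; inverse = -‿invˡ , λ x → trans (+-comm _ _) (-‿invˡ x)
          ; ⁻¹-cong = -‿cong
          }
        ; comm = +-comm
        }
      ; *-cong = *-cong
      ; *-assoc = *-assoc
      ; *-identity = *-idˡ , λ x → trans (*-comm _ _) (*-idˡ x)
      ; distrib = (λ x y z → trans (*-comm _ _) (trans (distribʳ x y z) (+-cong (*-comm _ _) (*-comm _ _))))
                , distribʳ
      }
    ; *-comm = *-comm
    }
    where open IsEquivalence equiv using (trans)

-- R[X]: a list holds the coefficients, constant term first.  Trailing zeros
-- are allowed, so equality is equality of all coefficients.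
module Polynomial {c ℓ} (R : CommutativeRing c ℓ) where

  open CommutativeRing R
  open RingProperties ring using (-0#≈0#)

  Poly : Set c
  Poly = List Carrier

  coeff : Poly → ℕ → Carrier
  coeff []      _       = 0#
  coeff (a ∷ p) zero    = a
  coeff (a ∷ p) (suc n) = coeff p n

  infix 4 _≋_
  record _≋_ (p q : Poly) : Set ℓ where
    constructor mk≋
    field at : ∀ n → coeff p n ≈ coeff q n
  open _≋_ public

  infixl 6 _⊕_
  infixl 7 _⊗_ _·_
  infix  8 ⊖_

  _⊕_ : Op₂ Poly
  []      ⊕ q       = q
  (a ∷ p) ⊕ []      = a ∷ p
  (a ∷ p) ⊕ (b ∷ q) = a + b ∷ p ⊕ q

  ⊖_ : Op₁ Poly
  ⊖_ = map (-_)

  _·_ : Carrier → Poly → Poly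
  a · p = map (a *_) p

  _⊗_ : Op₂ Poly
  []      ⊗ q = []
  (a ∷ p) ⊗ q = a · q ⊕ (0# ∷ p ⊗ q)

  const : Carrier → Poly
  const a = a ∷ []

  derivative : Poly → Poly
  derivative []      = []
  derivative (a ∷ p) = p ⊕ (0# ∷ derivative p)   -- (a + X p)′ = p + X p′

  HasDegree : Poly → ℕ → Set ℓ
  HasDegree p n = ¬ (coeff p n ≈ 0#) × (∀ k → n ℕ.< k → coeff p k ≈ 0#)

  MonicOfDegree : Poly → ℕ → Set ℓ
  MonicOfDegree p n = (coeff p n ≈ 1#) × (∀ k → n ℕ.< k → coeff p k ≈ 0#)

  private
    ≋-refl : ∀ {p} → p ≋ p
    ≋-refl = mk≋ λ _ → refl
    ≋-sym : ∀ {p q} → p ≋ q → q ≋ p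
    ≋-sym e = mk≋ λ n → sym (at e n)
    ≋-trans : ∀ {p q r} → p ≋ q → q ≋ r → p ≋ r
    ≋-trans e f = mk≋ λ n → trans (at e n) (at f n)

  ≋-isEquivalence : IsEquivalence _≋_
  ≋-isEquivalence = record { refl = ≋-refl ; sym = ≋-sym ; trans = ≋-trans }

  coeff-⊕ : ∀ p q n → coeff (p ⊕ q) n ≈ coeff p n + coeff q n
  coeff-⊕ []      q       n       = sym (+-identityˡ _)
  coeff-⊕ (a ∷ p) []      n       = sym (+-identityʳ _)
  coeff-⊕ (a ∷ p) (b ∷ q) zero    = refl
  coeff-⊕ (a ∷ p) (b ∷ q) (suc n) = coeff-⊕ p q n

  coeff-⊖ : ∀ p n → coeff (⊖ p) n ≈ - coeff p n
  coeff-⊖ []      n       = sym -0#≈0#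
  coeff-⊖ (a ∷ p) zero    = refl
  coeff-⊖ (a ∷ p) (suc n) = coeff-⊖ p n

  coeff-· : ∀ a p n → coeff (a · p) n ≈ a * coeff p n
  coeff-· a []      n       = sym (zeroʳ a)
  coeff-· a (b ∷ p) zero    = refl
  coeff-· a (b ∷ p) (suc n) = coeff-· a p n

  ∷-cong : ∀ {a b p q} → a ≈ b → p ≋ q → (a ∷ p) ≋ (b ∷ q)
  ∷-cong e f = mk≋ λ { zero → e ; (suc n) → at f n }

  ∷-tail : ∀ {a b p q} → (a ∷ p) ≋ (b ∷ q) → p ≋ q
  ∷-tail e = mk≋ λ n → at e (suc n)

  private
    ⊕-cong : ∀ {p p′ q q′} → p ≋ p′ → q ≋ q′ → p ⊕ q ≋ p′ ⊕ q′
    ⊕-cong {p} {p′} {q} {q′} e f = mk≋ λ n →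
      trans (coeff-⊕ p q n) (trans (+-cong (at e n) (at f n)) (sym (coeff-⊕ p′ q′ n)))

    ⊖-cong : ∀ {p p′} → p ≋ p′ → ⊖ p ≋ ⊖ p′
    ⊖-cong {p} {p′} e = mk≋ λ n →
      trans (coeff-⊖ p n) (trans (-‿cong (at e n)) (sym (coeff-⊖ p′ n)))

    ⊕-assoc : ∀ p q r → (p ⊕ q) ⊕ r ≋ p ⊕ (q ⊕ r)
    ⊕-assoc p q r = mk≋ λ n → begin
      coeff ((p ⊕ q) ⊕ r) n                  ≈⟨ coeff-⊕ (p ⊕ q) r n ⟩
      coeff (p ⊕ q) n + coeff r n            ≈⟨ +-congʳ (coeff-⊕ p q n) ⟩
      coeff p n + coeff q n + coeff r n      ≈⟨ +-assoc _ _ _ ⟩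
      coeff p n + (coeff q n + coeff r n)    ≈⟨ +-congˡ (sym (coeff-⊕ q r n)) ⟩
      coeff p n + coeff (q ⊕ r) n            ≈⟨ sym (coeff-⊕ p (q ⊕ r) n) ⟩
      coeff (p ⊕ (q ⊕ r)) n                  ∎
      where open SetoidReasoning setoid

    ⊕-comm : ∀ p q → p ⊕ q ≋ q ⊕ p
    ⊕-comm p q = mk≋ λ n → trans (coeff-⊕ p q n) (trans (+-comm _ _) (sym (coeff-⊕ q p n)))

    ⊕-identityʳ : ∀ p → p ⊕ [] ≋ p
    ⊕-identityʳ p = ⊕-comm p []

    ⊖-inverseˡ : ∀ p → ⊖ p ⊕ p ≋ []
    ⊖-inverseˡ p = mk≋ λ n →
      trans (coeff-⊕ (⊖ p) p n) (trans (+-congʳ (coeff-⊖ p n)) (-‿inverseˡ _))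

    middle : ∀ p q r s → (p ⊕ q) ⊕ (r ⊕ s) ≋ (p ⊕ r) ⊕ (q ⊕ s)
    middle p q r s =
      ≋-trans (⊕-assoc p q (r ⊕ s)) (≋-trans (⊕-cong (≋-refl {p}) inner) (≋-sym (⊕-assoc p r (q ⊕ s))))
      where
      inner : q ⊕ (r ⊕ s) ≋ r ⊕ (q ⊕ s)
      inner = ≋-trans (≋-sym (⊕-assoc q r s))
                (≋-trans (⊕-cong (⊕-comm q r) (≋-refl {s})) (⊕-assoc r q s))

    ·-cong : ∀ {a b p q} → a ≈ b → p ≋ q → a · p ≋ b · q
    ·-cong {a} {b} {p} {q} e f = mk≋ λ n →
      trans (coeff-· a p n) (trans (*-cong e (at f n)) (sym (coeff-· b q n)))

    0·-zero : ∀ {a} p → a ≈ 0# → a · p ≋ []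
    0·-zero {a} p e = mk≋ λ n → trans (coeff-· a p n) (trans (*-congʳ e) (zeroˡ _))

    1·-identity : ∀ p → 1# · p ≋ p
    1·-identity p = mk≋ λ n → trans (coeff-· 1# p n) (*-identityˡ _)

    ·-distribˡ : ∀ a p q → a · (p ⊕ q) ≋ a · p ⊕ a · q
    ·-distribˡ a p q = mk≋ λ n → begin
      coeff (a · (p ⊕ q)) n                ≈⟨ coeff-· a (p ⊕ q) n ⟩
      a * coeff (p ⊕ q) n                  ≈⟨ *-congˡ (coeff-⊕ p q n) ⟩
      a * (coeff p n + coeff q n)          ≈⟨ distribˡ _ _ _ ⟩
      a * coeff p n + a * coeff q n        ≈⟨ sym (+-cong (coeff-· a p n) (coeff-· a q n)) ⟩
      coeff (a · p) n + coeff (a · q) n    ≈⟨ sym (coeff-⊕ (a · p) (a · q) n) ⟩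
      coeff (a · p ⊕ a · q) n              ∎
      where open SetoidReasoning setoid

    ·-distribʳ : ∀ a b p → (a + b) · p ≋ a · p ⊕ b · p
    ·-distribʳ a b p = mk≋ λ n → begin
      coeff ((a + b) · p) n                ≈⟨ coeff-· (a + b) p n ⟩
      (a + b) * coeff p n                  ≈⟨ distribʳ _ _ _ ⟩
      a * coeff p n + b * coeff p n        ≈⟨ sym (+-cong (coeff-· a p n) (coeff-· b p n)) ⟩
      coeff (a · p) n + coeff (b · p) n    ≈⟨ sym (coeff-⊕ (a · p) (b · p) n) ⟩
      coeff (a · p ⊕ b · p) n              ∎
      where open SetoidReasoning setoid

    ·-assoc : ∀ a b p → (a * b) · p ≋ a · (b · p)
    ·-assoc a b p = mk≋ λ n → begin
      coeff ((a * b) · p) n    ≈⟨ coeff-· (a * b) p n ⟩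
      (a * b) * coeff p n      ≈⟨ *-assoc _ _ _ ⟩
      a * (b * coeff p n)      ≈⟨ *-congˡ (sym (coeff-· b p n)) ⟩
      a * coeff (b · p) n      ≈⟨ sym (coeff-· a (b · p) n) ⟩
      coeff (a · (b · p)) n    ∎
      where open SetoidReasoning setoid

    0∷[] : ∀ {a p} → a ≈ 0# → p ≋ [] → (a ∷ p) ≋ []
    0∷[] e f = mk≋ λ { zero → e ; (suc n) → at f n }

    ⊗-zeroˡ : ∀ p q → p ≋ [] → p ⊗ q ≋ []
    ⊗-zeroˡ []      q e = ≋-refl
    ⊗-zeroˡ (a ∷ p) q e =
      ⊕-cong (0·-zero q (at e 0)) (0∷[] refl (⊗-zeroˡ p q (mk≋ λ n → at e (suc n))))

    ⊗-congˡ : ∀ p {q q′} → q ≋ q′ → p ⊗ q ≋ p ⊗ q′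
    ⊗-congˡ []      e = ≋-refl
    ⊗-congˡ (a ∷ p) e = ⊕-cong (·-cong refl e) (∷-cong refl (⊗-congˡ p e))

    ⊗-congʳ : ∀ {p p′} q → p ≋ p′ → p ⊗ q ≋ p′ ⊗ q
    ⊗-congʳ {[]}    {p′}     q e = ≋-sym (⊗-zeroˡ p′ q (≋-sym e))
    ⊗-congʳ {a ∷ p} {[]}     q e = ⊗-zeroˡ (a ∷ p) q e
    ⊗-congʳ {a ∷ p} {b ∷ p′} q e =
      ⊕-cong (·-cong (at e 0) (≋-refl {q})) (∷-cong refl (⊗-congʳ q (∷-tail e)))

    ⊗-cong : ∀ {p p′ q q′} → p ≋ p′ → q ≋ q′ → p ⊗ q ≋ p′ ⊗ q′
    ⊗-cong {p} {p′} {q} {q′} e f = ≋-trans (⊗-congˡ p f) (⊗-congʳ q′ e)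

    0∷-⊕ : ∀ p q → (0# ∷ p ⊕ q) ≋ (0# ∷ p) ⊕ (0# ∷ q)
    0∷-⊕ p q = ∷-cong (sym (+-identityˡ 0#)) ≋-refl

    ⊗-distribʳ : ∀ r p q → (p ⊕ q) ⊗ r ≋ p ⊗ r ⊕ q ⊗ r
    ⊗-distribʳ r []      q       = ≋-refl
    ⊗-distribʳ r (a ∷ p) []      = ≋-sym (⊕-identityʳ _)
    ⊗-distribʳ r (a ∷ p) (b ∷ q) =
      ≋-trans (⊕-cong (·-distribʳ a b r) (≋-trans (∷-cong refl (⊗-distribʳ r p q)) (0∷-⊕ (p ⊗ r) (q ⊗ r))))
              (middle (a · r) (b · r) (0# ∷ p ⊗ r) (0# ∷ q ⊗ r))

    ·-⊗ : ∀ a p q → (a · p) ⊗ q ≋ a · (p ⊗ q)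
    ·-⊗ a []      q = ≋-refl
    ·-⊗ a (b ∷ p) q = ≋-trans
      (⊕-cong (·-assoc a b q) (∷-cong (sym (zeroʳ a)) (·-⊗ a p q)))
      (≋-sym (·-distribˡ a (b · q) (0# ∷ p ⊗ q)))

    0∷-⊗ : ∀ p q → (0# ∷ p) ⊗ q ≋ (0# ∷ p ⊗ q)
    0∷-⊗ p q = ⊕-cong (0·-zero q refl) ≋-refl

    ⊗-assoc : ∀ p q r → (p ⊗ q) ⊗ r ≋ p ⊗ (q ⊗ r)
    ⊗-assoc []      q r = ≋-refl
    ⊗-assoc (a ∷ p) q r = ≋-trans (⊗-distribʳ r (a · q) (0# ∷ p ⊗ q))
      (⊕-cong (·-⊗ a q r) (≋-trans (0∷-⊗ (p ⊗ q) r) (∷-cong refl (⊗-assoc p q r))))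

    ⊗-zeroʳ : ∀ p → p ⊗ [] ≋ []
    ⊗-zeroʳ []      = ≋-refl
    ⊗-zeroʳ (a ∷ p) = 0∷[] refl (⊗-zeroʳ p)

    ⊗-∷ : ∀ p b q → p ⊗ (b ∷ q) ≋ b · p ⊕ (0# ∷ p ⊗ q)
    ⊗-∷ []      b q = ≋-sym (0∷[] refl ≋-refl)
    ⊗-∷ (a ∷ p) b q = ∷-cong (+-congʳ (*-comm a b))
      (≋-trans (⊕-cong (≋-refl {a · q}) (⊗-∷ p b q))
        (≋-trans (≋-sym (⊕-assoc (a · q) (b · p) (0# ∷ p ⊗ q)))
          (≋-trans (⊕-cong (⊕-comm (a · q) (b · p)) ≋-refl)
                   (⊕-assoc (b · p) (a · q) (0# ∷ p ⊗ q)))))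

    ⊗-comm : ∀ p q → p ⊗ q ≋ q ⊗ p
    ⊗-comm []      q = ≋-sym (⊗-zeroʳ q)
    ⊗-comm (a ∷ p) q = ≋-trans
      (⊕-cong (≋-refl {a · q}) (∷-cong refl (⊗-comm p q))) (≋-sym (⊗-∷ q a p))

    ⊗-identityˡ : ∀ p → const 1# ⊗ p ≋ p
    ⊗-identityˡ p = ≋-trans (⊕-cong (1·-identity p) (0∷[] refl ≋-refl)) (⊕-identityʳ p)

  commutativeRing : CommutativeRing c ℓ
  commutativeRing = record
    { Carrier = Poly
    ; _≈_ = _≋_
    ; _+_ = _⊕_
    ; _*_ = _⊗_
    ; -_  = ⊖_
    ; 0#  = []
    ; 1#  = const 1#
    ; isCommutativeRing = ringFromLaws ≋-isEquivalence ⊕-cong ⊗-cong ⊖-cong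
        ⊕-assoc ⊕-comm (λ _ → ≋-refl) ⊖-inverseˡ ⊗-assoc ⊗-comm ⊗-identityˡ ⊗-distribʳ
    }

  constHom : Hom R commutativeRing
  constHom = record
    { ⟦_⟧ = const
    ; isRingHomomorphism = record
      { isSemiringHomomorphism = record
        { isNearSemiringHomomorphism = record
          { +-isMonoidHomomorphism = record
            { isMagmaHomomorphism = record
              { isRelHomomorphism = record { cong = λ e → ∷-cong e ≋-refl }
              ; homo = λ _ _ → ≋-refl
              }
            ; ε-homo = 0∷[] refl ≋-refl
            }
          ; *-homo = λ x y → ∷-cong (sym (+-identityʳ (x * y))) ≋-refl
          }
        ; 1#-homo = ≋-refl
        }
      ; -‿homo = λ _ → ≋-refl
      }
    }

  DegreeBelow : ℕ → Poly → Set ℓ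
  DegreeBelow n p = ∀ k → n ℕ.≤ k → coeff p k ≈ 0#

  private
    below-zero : ∀ {p} → DegreeBelow 0 p → p ≋ []
    below-zero d = mk≋ λ n → d n z≤n

  below-⊗ : ∀ m {n} p q → DegreeBelow m p → DegreeBelow (suc n) q → DegreeBelow (m ℕ.+ n) (p ⊗ q)
  below-⊗ zero        p       q dp dq k       _  = at (⊗-zeroˡ p q (below-zero dp)) k
  below-⊗ (suc m)     []      q dp dq k       _  = refl
  below-⊗ (suc m) {n} (a ∷ p) q dp dq (suc k) (s≤s le) = begin
    coeff (a · q ⊕ (0# ∷ p ⊗ q)) (suc k)         ≈⟨ coeff-⊕ (a · q) _ (suc k) ⟩
    coeff (a · q) (suc k) + coeff (p ⊗ q) k      ≈⟨ +-cong (coeff-· a q (suc k))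
                                                       (below-⊗ m p q (λ j l → dp (suc j) (s≤s l)) dq k le) ⟩
    a * coeff q (suc k) + 0#                     ≈⟨ +-identityʳ _ ⟩
    a * coeff q (suc k)                          ≈⟨ *-congˡ (dq (suc k) (s≤s (ℕ.≤-trans (ℕ.m≤n+m n m) le))) ⟩
    a * 0#                                       ≈⟨ zeroʳ a ⟩
    0#                                           ∎
    where open SetoidReasoning setoid

  coeff-⊗-top : ∀ m n p q → DegreeBelow (suc m) p → DegreeBelow (suc n) q →
                coeff (p ⊗ q) (m ℕ.+ n) ≈ coeff p m * coeff q n
  coeff-⊗-top m       n []      q dp dq = sym (zeroˡ _)
  coeff-⊗-top zero    n (a ∷ p) q dp dq = begin
    coeff (a · q ⊕ (0# ∷ p ⊗ q)) n            ≈⟨ coeff-⊕ (a · q) _ n ⟩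
    coeff (a · q) n + coeff (0# ∷ p ⊗ q) n    ≈⟨ +-cong (coeff-· a q n) (at tail≋[] n) ⟩
    a * coeff q n + 0#                        ≈⟨ +-identityʳ _ ⟩
    a * coeff q n                             ∎
    where
    open SetoidReasoning setoid
    tail≋[] : (0# ∷ p ⊗ q) ≋ []
    tail≋[] = 0∷[] refl (⊗-zeroˡ p q (mk≋ λ j → dp (suc j) (s≤s z≤n)))
  coeff-⊗-top (suc m) n (a ∷ p) q dp dq = begin
    coeff (a · q ⊕ (0# ∷ p ⊗ q)) (suc (m ℕ.+ n))              ≈⟨ coeff-⊕ (a · q) _ (suc (m ℕ.+ n)) ⟩
    coeff (a · q) (suc (m ℕ.+ n)) + coeff (p ⊗ q) (m ℕ.+ n)   ≈⟨ +-cong (coeff-· a q (suc (m ℕ.+ n)))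
                                                                   (coeff-⊗-top m n p q (λ j l → dp (suc j) (s≤s l)) dq) ⟩
    a * coeff q (suc (m ℕ.+ n)) + coeff p m * coeff q n       ≈⟨ +-congʳ (*-congˡ (dq _ (s≤s (ℕ.m≤n+m n m)))) ⟩
    a * 0# + coeff p m * coeff q n                            ≈⟨ +-congʳ (zeroʳ a) ⟩
    0# + coeff p m * coeff q n                                ≈⟨ +-identityˡ _ ⟩
    coeff p m * coeff q n                                     ∎
    where open SetoidReasoning setoid

  module Domain (isField : IsField R) (_≟_ : Decidable _≈_) where

    open IsField isField

    zeroOrDegree : ∀ p → p ≋ [] ⊎ ∃ (HasDegree p)
    zeroOrDegree []      = inj₁ ≋-refl
    zeroOrDegree (a ∷ p) with zeroOrDegree p
    ... | inj₂ (n , lead , above) = inj₂ (suc n , lead , λ { (suc k) (s≤s l) → above k l })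
    ... | inj₁ p≋[] with a ≟ 0#
    ...   | yes a≈0 = inj₁ (0∷[] a≈0 p≋[])
    ...   | no  a≉0 = inj₂ (0 , a≉0 , λ { (suc k) _ → at p≋[] k })

    private
      *-nonZero : ∀ {x y} → ¬ (x ≈ 0#) → ¬ (y ≈ 0#) → ¬ (x * y ≈ 0#)
      *-nonZero {x} {y} x≉0 y≉0 xy≈0 = y≉0 (begin
        y              ≈⟨ sym (*-identityˡ y) ⟩
        1# * y         ≈⟨ *-congʳ (sym (proj₂ inv)) ⟩
        x * x⁻¹ * y    ≈⟨ *-congʳ (*-comm x x⁻¹) ⟩
        x⁻¹ * x * y    ≈⟨ *-assoc x⁻¹ x y ⟩
        x⁻¹ * (x * y)  ≈⟨ *-congˡ xy≈0 ⟩
        x⁻¹ * 0#       ≈⟨ zeroʳ x⁻¹ ⟩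
        0#             ∎)
        where
        open SetoidReasoning setoid
        inv = inverse x x≉0
        x⁻¹ = proj₁ inv

    ⊗-nonZero : ∀ {p q} → ¬ (p ≋ []) → p ⊗ q ≋ [] → q ≋ []
    ⊗-nonZero {p} {q} p≉0 pq≋0 with zeroOrDegree p | zeroOrDegree q
    ... | inj₁ p≋0           | _                  = ⊥-elim (p≉0 p≋0)
    ... | _                  | inj₁ q≋0           = q≋0
    ... | inj₂ (m , pₘ , dp) | inj₂ (n , qₙ , dq) = ⊥-elim
      (*-nonZero pₘ qₙ (trans (sym (coeff-⊗-top m n p q dp dq)) (at pq≋0 (m ℕ.+ n))))

    1≉0 : ¬ (const 1# ≋ [])
    1≉0 e = 0≉1 (sym (at e 0))

    ⊗-cancelˡ-nonZero : AlmostLeftCancellative _≋_ [] _⊗_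
    ⊗-cancelˡ-nonZero p q r p≉0 pq≋pr = P.trans (P.sym (P.+-identityʳ q)) (P.trans
      (P.+-congˡ (P.sym (P.-‿inverseˡ r))) (P.trans (P.sym (P.+-assoc q (⊖ r) r))
      (P.trans (P.+-congʳ (⊗-nonZero p≉0 p[q-r]≋0)) (P.+-identityˡ r))))
      where
      module P = CommutativeRing commutativeRing
      p[q-r]≋0 : p ⊗ (q ⊕ ⊖ r) ≋ []
      p[q-r]≋0 = P.trans (RingProperties.x[y-z]≈xy-xz P.ring p q r)
                   (P.trans (P.+-congʳ pq≋pr) (P.-‿inverseʳ (p ⊗ r)))

module Evaluation {a b ℓ₁ ℓ₂} (A : CommutativeRing a ℓ₁) (B : CommutativeRing b ℓ₂) (φ : Hom A B) where

  private
    module A = CommutativeRing A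
    module φ = RingHomomorphism φ
  open CommutativeRing B
  open Polynomial A
  open SetoidReasoning setoid
  open SemiringSolver commutativeSemiring

  eval : Poly → Carrier → Carrier
  eval []      x = 0#
  eval (a ∷ p) x = φ.⟦ a ⟧ + x * eval p x

  eval-zero : ∀ p {x} → p ≋ [] → eval p x ≈ 0#
  eval-zero []      e = refl
  eval-zero (a ∷ p) {x} e = begin
    φ.⟦ a ⟧ + x * eval p x    ≈⟨ +-cong (trans (φ.⟦⟧-cong (at e 0)) φ.0#-homo)
                                        (*-congˡ (eval-zero p (mk≋ λ n → at e (suc n)))) ⟩
    0# + x * 0#               ≈⟨ trans (+-identityˡ _) (zeroʳ x) ⟩
    0#                        ∎

  eval-cong : ∀ p q {x} → p ≋ q → eval p x ≈ eval q x
  eval-cong []      q       e = sym (eval-zero q (IsEquivalence.sym ≋-isEquivalence e))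
  eval-cong (a ∷ p) []      e = eval-zero (a ∷ p) e
  eval-cong (a ∷ p) (b ∷ q) e = +-cong (φ.⟦⟧-cong (at e 0)) (*-congˡ (eval-cong p q (∷-tail e)))

  eval-congʳ : ∀ p {x y} → x ≈ y → eval p x ≈ eval p y
  eval-congʳ []      e = refl
  eval-congʳ (a ∷ p) e = +-congˡ (*-cong e (eval-congʳ p e))

  eval-⊕ : ∀ p q x → eval (p ⊕ q) x ≈ eval p x + eval q x
  eval-⊕ []      q       x = sym (+-identityˡ _)
  eval-⊕ (a ∷ p) []      x = sym (+-identityʳ _)
  eval-⊕ (a ∷ p) (b ∷ q) x = begin
    φ.⟦ a A.+ b ⟧ + x * eval (p ⊕ q) x                 ≈⟨ +-cong (φ.+-homo a b) (*-congˡ (eval-⊕ p q x)) ⟩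
    (φ.⟦ a ⟧ + φ.⟦ b ⟧) + x * (eval p x + eval q x)    ≈⟨ solve 5 (λ a b x p q →
                                                            (a :+ b) :+ x :* (p :+ q) := (a :+ x :* p) :+ (b :+ x :* q))
                                                            refl φ.⟦ a ⟧ φ.⟦ b ⟧ x (eval p x) (eval q x) ⟩
    (φ.⟦ a ⟧ + x * eval p x) + (φ.⟦ b ⟧ + x * eval q x)  ∎

  eval-· : ∀ a p x → eval (a · p) x ≈ φ.⟦ a ⟧ * eval p x
  eval-· a []      x = sym (zeroʳ _)
  eval-· a (b ∷ p) x = begin
    φ.⟦ a A.* b ⟧ + x * eval (a · p) x             ≈⟨ +-cong (φ.*-homo a b) (*-congˡ (eval-· a p x)) ⟩
    φ.⟦ a ⟧ * φ.⟦ b ⟧ + x * (φ.⟦ a ⟧ * eval p x)   ≈⟨ solve 4 (λ a b x p → a :* b :+ x :* (a :* p) := a :* (b :+ x :* p))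
                                                        refl φ.⟦ a ⟧ φ.⟦ b ⟧ x (eval p x) ⟩
    φ.⟦ a ⟧ * (φ.⟦ b ⟧ + x * eval p x)             ∎

  eval-⊗ : ∀ p q x → eval (p ⊗ q) x ≈ eval p x * eval q x
  eval-⊗ []      q x = sym (zeroˡ _)
  eval-⊗ (a ∷ p) q x = begin
    eval (a · q ⊕ (A.0# ∷ p ⊗ q)) x                         ≈⟨ eval-⊕ (a · q) _ x ⟩
    eval (a · q) x + (φ.⟦ A.0# ⟧ + x * eval (p ⊗ q) x)      ≈⟨ +-cong (eval-· a q x) (trans (+-congʳ φ.0#-homo)
                                                                  (trans (+-identityˡ _) (*-congˡ (eval-⊗ p q x)))) ⟩
    φ.⟦ a ⟧ * eval q x + x * (eval p x * eval q x)          ≈⟨ solve 4 (λ a q x p → a :* q :+ x :* (p :* q) := (a :+ x :* p) :* q)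
                                                                refl φ.⟦ a ⟧ (eval q x) x (eval p x) ⟩
    (φ.⟦ a ⟧ + x * eval p x) * eval q x                     ∎

  eval-⊖ : ∀ p x → eval (⊖ p) x ≈ - eval p x
  eval-⊖ p x = begin
    eval (⊖ p) x                               ≈⟨ sym (+-identityʳ _) ⟩
    eval (⊖ p) x + 0#                          ≈⟨ +-congˡ (sym (-‿inverseʳ _)) ⟩
    eval (⊖ p) x + (eval p x + - eval p x)     ≈⟨ sym (+-assoc _ _ _) ⟩
    eval (⊖ p) x + eval p x + - eval p x       ≈⟨ +-congʳ (sym (eval-⊕ (⊖ p) p x)) ⟩
    eval (⊖ p ⊕ p) x + - eval p x              ≈⟨ +-congʳ (eval-zero _ (CommutativeRing.-‿inverseˡ commutativeRing p)) ⟩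
    0# + - eval p x                            ≈⟨ +-identityˡ _ ⟩
    - eval p x                                 ∎

-- The hypothesis cancel says that A is an integral domain; in this form it gives
-- the transitivity of _≃_ directly.
module Fractions {c ℓ} (A : CommutativeRing c ℓ)
  (1≉0 : ¬ (CommutativeRing._≈_ A (CommutativeRing.1# A) (CommutativeRing.0# A)))
  (cancel : AlmostLeftCancellative (CommutativeRing._≈_ A) (CommutativeRing.0# A) (CommutativeRing._*_ A)) where

  open CommutativeRing A
  open RingProperties ring using (-‿distribˡ-*)
  open SetoidReasoning setoid
  open SemiringSolver commutativeSemiring

  infix 5 _/_[_]
  record Fraction : Set (c ⊔ ℓ) where
    constructor _/_[_]
    field
      num   : Carrier
      den   : Carrier
      den≉0 : ¬ (den ≈ 0#)
  open Fraction public

  infix 4 _≃_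
  record _≃_ (x y : Fraction) : Set ℓ where
    constructor mk≃
    field cross : num x * den y ≈ num y * den x
  open _≃_ public

  private
    *-nonZero : ∀ {x y} → ¬ (x ≈ 0#) → ¬ (y ≈ 0#) → ¬ (x * y ≈ 0#)
    *-nonZero {x} {y} x≉0 y≉0 e = y≉0 (cancel x y 0# x≉0 (trans e (sym (zeroʳ x))))

  _+ᶠ_ _*ᶠ_ : Op₂ Fraction
  x +ᶠ y = (num x * den y + num y * den x) / den x * den y [ *-nonZero (den≉0 x) (den≉0 y) ]
  x *ᶠ y = num x * num y / den x * den y [ *-nonZero (den≉0 x) (den≉0 y) ]

  -ᶠ_ : Op₁ Fraction
  -ᶠ x = - num x / den x [ den≉0 x ]

  fromBase : Carrier → Fraction
  fromBase a = a / 1# [ 1≉0 ]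

  private
    ≃-trans : ∀ {x y z} → x ≃ y → y ≃ z → x ≃ z
    ≃-trans {x} {y} {z} (mk≃ e) (mk≃ f) = mk≃ (cancel (den y) _ _ (den≉0 y) (begin
      den y * (num x * den z)    ≈⟨ solve 3 (λ b a c → b :* (a :* c) := (a :* b) :* c) refl (den y) (num x) (den z) ⟩
      (num x * den y) * den z    ≈⟨ *-congʳ e ⟩
      (num y * den x) * den z    ≈⟨ solve 3 (λ n a c → (n :* a) :* c := (n :* c) :* a) refl (num y) (den x) (den z) ⟩
      (num y * den z) * den x    ≈⟨ *-congʳ f ⟩
      (num z * den y) * den x    ≈⟨ solve 3 (λ n b a → (n :* b) :* a := b :* (n :* a)) refl (num z) (den y) (den x) ⟩
      den y * (num z * den x)    ∎))

    ≃-isEquivalence : IsEquivalence _≃_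
    ≃-isEquivalence = record
      { refl = mk≃ refl ; sym = λ e → mk≃ (sym (cross e)) ; trans = ≃-trans }

    +ᶠ-cong : ∀ {x x′ y y′} → x ≃ x′ → y ≃ y′ → x +ᶠ y ≃ x′ +ᶠ y′
    +ᶠ-cong {x} {x′} {y} {y′} (mk≃ e) (mk≃ f) = mk≃ (begin
      (num x * den y + num y * den x) * (den x′ * den y′)
        ≈⟨ solve 6 (λ n d m e d′ e′ → (n :* e :+ m :* d) :* (d′ :* e′) := (n :* d′) :* (e :* e′) :+ (m :* e′) :* (d :* d′))
             refl (num x) (den x) (num y) (den y) (den x′) (den y′) ⟩
      (num x * den x′) * (den y * den y′) + (num y * den y′) * (den x * den x′)
        ≈⟨ +-cong (*-congʳ e) (*-congʳ f) ⟩
      (num x′ * den x) * (den y * den y′) + (num y′ * den y) * (den x * den x′)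
        ≈⟨ solve 6 (λ n d m e d′ e′ → (n :* d) :* (e :* e′) :+ (m :* e) :* (d :* d′) := (n :* e′ :+ m :* d′) :* (d :* e))
             refl (num x′) (den x) (num y′) (den y) (den x′) (den y′) ⟩
      (num x′ * den y′ + num y′ * den x′) * (den x * den y) ∎)

    *ᶠ-cong : ∀ {x x′ y y′} → x ≃ x′ → y ≃ y′ → x *ᶠ y ≃ x′ *ᶠ y′
    *ᶠ-cong {x} {x′} {y} {y′} (mk≃ e) (mk≃ f) = mk≃ (begin
      (num x * num y) * (den x′ * den y′)    ≈⟨ solve 4 (λ a b c d → (a :* b) :* (c :* d) := (a :* c) :* (b :* d))
                                                   refl (num x) (num y) (den x′) (den y′) ⟩
      (num x * den x′) * (num y * den y′)    ≈⟨ *-cong e f ⟩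
      (num x′ * den x) * (num y′ * den y)    ≈⟨ solve 4 (λ a b c d → (a :* b) :* (c :* d) := (a :* c) :* (b :* d))
                                                   refl (num x′) (den x) (num y′) (den y) ⟩
      (num x′ * num y′) * (den x * den y)    ∎)

    -ᶠ-cong : ∀ {x x′} → x ≃ x′ → -ᶠ x ≃ -ᶠ x′
    -ᶠ-cong (mk≃ e) = mk≃ (trans (sym (-‿distribˡ-* _ _)) (trans (-‿cong e) (-‿distribˡ-* _ _)))

  commutativeRing : CommutativeRing (c ⊔ ℓ) ℓ
  commutativeRing = record
    { Carrier = Fraction
    ; _≈_ = _≃_
    ; _+_ = _+ᶠ_
    ; _*_ = _*ᶠ_
    ; -_  = -ᶠ_
    ; 0#  = fromBase 0#
    ; 1#  = fromBase 1#
    ; isCommutativeRing = ringFromLaws ≃-isEquivalence +ᶠ-cong *ᶠ-cong -ᶠ-cong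
        (λ x y z → mk≃ (solve 6 (λ a b c d e f →
          ((a :* d :+ c :* b) :* f :+ e :* (b :* d)) :* (b :* (d :* f)) :=
          (a :* (d :* f) :+ (c :* f :+ e :* d) :* b) :* ((b :* d) :* f))
          refl (num x) (den x) (num y) (den y) (num z) (den z)))
        (λ x y → mk≃ (solve 4 (λ a b c d → (a :* d :+ c :* b) :* (d :* b) := (c :* b :+ a :* d) :* (b :* d))
          refl (num x) (den x) (num y) (den y)))
        (λ x → mk≃ (solve 2 (λ a b → (con 0 :* b :+ a :* con 1) :* b := a :* (con 1 :* b))
          refl (num x) (den x)))
        (λ x → mk≃ (begin
          (- num x * den x + num x * den x) * 1#   ≈⟨ *-congʳ (sym (distribʳ _ _ _)) ⟩
          (- num x + num x) * den x * 1#           ≈⟨ *-congʳ (*-congʳ (-‿inverseˡ _)) ⟩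
          0# * den x * 1#                          ≈⟨ *-congʳ (zeroˡ _) ⟩
          0# * 1#                                  ≈⟨ zeroˡ _ ⟩
          0#                                       ≈⟨ sym (zeroˡ _) ⟩
          0# * (den x * den x)                     ∎))
        (λ x y z → mk≃ (solve 6 (λ a b c d e f →
          ((a :* c) :* e) :* (b :* (d :* f)) := (a :* (c :* e)) :* ((b :* d) :* f))
          refl (num x) (den x) (num y) (den y) (num z) (den z)))
        (λ x y → mk≃ (solve 4 (λ a b c d → (a :* c) :* (d :* b) := (c :* a) :* (b :* d))
          refl (num x) (den x) (num y) (den y)))
        (λ x → mk≃ (solve 2 (λ a b → (con 1 :* a) :* b := a :* (con 1 :* b)) refl (num x) (den x)))
        (λ x y z → mk≃ (solve 6 (λ a b c d e f →
          ((c :* f :+ e :* d) :* a) :* ((d :* b) :* (f :* b)) :=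
          ((c :* a) :* (f :* b) :+ (e :* a) :* (d :* b)) :* ((d :* f) :* b))
          refl (num x) (den x) (num y) (den y) (num z) (den z)))
    }

  isField : IsField commutativeRing
  isField = record
    { 0≉1 = λ e → 1≉0 (trans (sym (*-identityˡ 1#)) (trans (sym (cross e)) (zeroˡ 1#)))
    ; inverse = λ x x≉0 →
        den x / num x [ (λ n≈0 → x≉0 (mk≃ (trans (*-identityʳ _) (trans n≈0 (sym (zeroˡ _)))))) ]
      , mk≃ (solve 2 (λ n d → (n :* d) :* con 1 := con 1 :* (d :* n)) refl (num x) (den x))
    }

  fromBaseHom : Hom A commutativeRing
  fromBaseHom = record
    { ⟦_⟧ = fromBase
    ; isRingHomomorphism = record
      { isSemiringHomomorphism = record
        { isNearSemiringHomomorphism = record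
          { +-isMonoidHomomorphism = record
            { isMagmaHomomorphism = record
              { isRelHomomorphism = record { cong = λ e → mk≃ (*-congʳ e) }
              ; homo = λ x y → mk≃ (solve 2 (λ x y → (x :+ y) :* (con 1 :* con 1) :=
                                      (x :* con 1 :+ y :* con 1) :* con 1) refl x y)
              }
            ; ε-homo = mk≃ refl
            }
          ; *-homo = λ x y → mk≃ (solve 2 (λ x y → (x :* y) :* (con 1 :* con 1) := (x :* y) :* con 1) refl x y)
          }
        ; 1#-homo = mk≃ refl
        }
      ; -‿homo = λ _ → mk≃ refl
      }
    }

module IntegralClosure {a b ℓ₁ ℓ₂} (A : CommutativeRing a ℓ₁) (B : CommutativeRing b ℓ₂) (φ : Hom A B) where

  private
    module A = CommutativeRing A
    module φ = RingHomomorphism φ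
    module P = Polynomial A
  open P using (coeff; MonicOfDegree; DegreeBelow; _⊗_; _⊕_; ⊖_; const)
  open CommutativeRing B hiding (zero)
  open RingProperties ring using (-1*x≈-x; -‿distribʳ-*)
  open RingNotions B using (_^_)
  open SemiringSum semiring
  open Evaluation A B φ
  open SetoidReasoning setoid
  open SemiringSolver commutativeSemiring

  IsIntegral : Carrier → Set (a ⊔ ℓ₁ ⊔ ℓ₂)
  IsIntegral x = ∃[ p ] ∃[ n ] MonicOfDegree p n × eval p x ≈ 0#

  -- The sum and product of integral elements are integral: x is integral if and
  -- only if x v_i ∈ ∑ A v_j for some v_1, …, v_n ∈ B with 1 ∈ ∑ A v_j.
  private
    data Span {n} (v : Fin n → Carrier) : Carrier → Set (a ⊔ b ⊔ ℓ₂) where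
      gen  : ∀ i → Span v (v i)
      zer  : Span v 0#
      add  : ∀ {x y} → Span v x → Span v y → Span v (x + y)
      scl  : ∀ a {x} → Span v x → Span v (φ.⟦ a ⟧ * x)
      resp : ∀ {x y} → x ≈ y → Span v x → Span v y

    record Stable (x : Carrier) : Set (a ⊔ b ⊔ ℓ₂) where
      field
        {n}    : ℕ
        v      : Fin n → Carrier
        1∈     : Span v 1#
        x·     : ∀ i → Span v (x * v i)

    φ-1 : φ.⟦ A.- A.1# ⟧ ≈ - 1#
    φ-1 = trans (φ.-‿homo A.1#) (-‿cong φ.1#-homo)

    neg : ∀ {n} {v : Fin n → Carrier} {x} → Span v x → Span v (- x)
    neg s = resp (trans (*-congʳ φ-1) (-1*x≈-x _)) (scl (A.- A.1#) s)

    monic-⊗ : ∀ {m n p q} → MonicOfDegree p m → MonicOfDegree q n → MonicOfDegree (p ⊗ q) (m ℕ.+ n)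
    monic-⊗ {m} {n} {p} {q} (lp , dp) (lq , dq) =
        A.trans (P.coeff-⊗-top m n p q dp dq) (A.trans (A.*-cong lp lq) (A.*-identityˡ A.1#))
      , P.below-⊗ (suc m) p q dp dq

    module Poly = CommutativeRing P.commutativeRing

    below-suc : ∀ {m p} → DegreeBelow m p → DegreeBelow (suc m) p
    below-suc d k l = d k (ℕ.<⇒≤ l)

    below-⊕⊖ : ∀ {m p q} → DegreeBelow m p → DegreeBelow m q → DegreeBelow m (p ⊕ ⊖ q)
    below-⊕⊖ {m} {p} {q} dp dq k l = A.trans (P.coeff-⊕ p (⊖ q) k) (A.trans (A.+-cong (dp k l)
      (A.trans (P.coeff-⊖ q k) (A.trans (A.-‿cong (dq k l)) (RingProperties.-0#≈0# A.ring)))) (A.+-identityˡ A.0#))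

    Killed : ∀ {n} → (Fin n → Carrier) → Carrier → Set (a ⊔ ℓ₁ ⊔ ℓ₂)
    Killed v x = ∃[ p ] ∃[ k ] MonicOfDegree p k × (∀ i → eval p x * v i ≈ 0#)

    -- From (N(x)) v = 0 with monic diagonal dominating in degree, eliminating v_0
    -- leaves a system of the same shape.
    module Step {n} m (N : Fin (suc n) → Fin (suc n) → P.Poly) (v : Fin (suc n) → Carrier) x
      (diag : ∀ i → MonicOfDegree (N i i) m)
      (off  : ∀ i j → ¬ (i ≡ j) → DegreeBelow m (N i j))
      (rel  : ∀ i → sum (λ j → eval (N i j) x * v j) ≈ 0#) where

      N₀₀ = N zero zero
      N′ : Fin n → Fin n → P.Poly
      N′ i j = N₀₀ ⊗ N (suc i) (suc j) ⊕ ⊖ (N (suc i) zero ⊗ N zero (suc j))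

      cross : ∀ i j → DegreeBelow (m ℕ.+ m) (N (suc i) zero ⊗ N zero (suc j))
      cross i j = P.below-⊗ m (N (suc i) zero) (N zero (suc j)) (off (suc i) zero λ ()) (below-suc {p = N zero (suc j)} (off zero (suc j) λ ()))

      diag′ : ∀ i → MonicOfDegree (N′ i i) (m ℕ.+ m)
      diag′ i with monic-⊗ {p = N₀₀} {q = N (suc i) (suc i)} (diag zero) (diag (suc i))
      ... | lead , above =
          A.trans (P.coeff-⊕ (N₀₀ ⊗ N (suc i) (suc i)) _ (m ℕ.+ m)) (A.trans (A.+-cong lead
            (A.trans (P.coeff-⊖ (N (suc i) zero ⊗ N zero (suc i)) _) (A.trans
              (A.-‿cong (cross i i _ ℕ.≤-refl)) (RingProperties.-0#≈0# A.ring)))) (A.+-identityʳ A.1#))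
        , below-⊕⊖ {p = N₀₀ ⊗ N (suc i) (suc i)} {q = N (suc i) zero ⊗ N zero (suc i)} above
            (below-suc {p = N (suc i) zero ⊗ N zero (suc i)} (cross i i))

      off′ : ∀ i j → ¬ (i ≡ j) → DegreeBelow (m ℕ.+ m) (N′ i j)
      off′ i j i≢j = below-⊕⊖ {p = N₀₀ ⊗ N (suc i) (suc j)} {q = N (suc i) zero ⊗ N zero (suc j)}
        (λ k l → A.trans (P.at (Poly.*-comm N₀₀ (N (suc i) (suc j))) k)
          (P.below-⊗ m (N (suc i) (suc j)) N₀₀ (off _ _ (λ e → i≢j (Fin.suc-injective e))) (proj₂ (diag zero)) k l))
        (cross i j)

      rel′ : ∀ i → sum (λ j → eval (N′ i j) x * v (suc j)) ≈ 0#
      rel′ i = begin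
        sum (λ j → eval (N′ i j) x * v (suc j))    ≈⟨ sum-cong-≋ expand ⟩
        sum (λ j → e₀₀ * (eᵢ j * v (suc j)) + - eᵢ₀ * (e₀ j * v (suc j)))
          ≈⟨ ∑-distrib-+ (λ j → e₀₀ * (eᵢ j * v (suc j))) (λ j → - eᵢ₀ * (e₀ j * v (suc j))) ⟩
        sum (λ j → e₀₀ * (eᵢ j * v (suc j))) + sum (λ j → - eᵢ₀ * (e₀ j * v (suc j)))
          ≈⟨ +-cong (sym (*-distribˡ-sum e₀₀ (λ j → eᵢ j * v (suc j)))) (sym (*-distribˡ-sum (- eᵢ₀) (λ j → e₀ j * v (suc j)))) ⟩
        e₀₀ * sum (λ j → eᵢ j * v (suc j)) + - eᵢ₀ * sum (λ j → e₀ j * v (suc j))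
          ≈⟨ sym (trans (+-congˡ (trans (*-congʳ (-‿inverseʳ _)) (zeroˡ _))) (+-identityʳ _)) ⟩
        (e₀₀ * sᵢ + - eᵢ₀ * s₀) + (eᵢ₀ + - eᵢ₀) * (e₀₀ * v zero)
          ≈⟨ solve 6 (λ a s b t c w → (a :* s :+ b :* t) :+ (c :+ b) :* (a :* w)
                                   := a :* (c :* w :+ s) :+ b :* (a :* w :+ t))
               refl e₀₀ sᵢ (- eᵢ₀) s₀ eᵢ₀ (v zero) ⟩
        e₀₀ * (eᵢ₀ * v zero + sᵢ) + - eᵢ₀ * (e₀₀ * v zero + s₀)
          ≈⟨ +-cong (trans (*-congˡ (rel (suc i))) (zeroʳ _)) (trans (*-congˡ (rel zero)) (zeroʳ _)) ⟩
        0# + 0#  ≈⟨ +-identityˡ 0# ⟩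
        0#       ∎
        where
        e₀₀ = eval N₀₀ x
        eᵢ₀ = eval (N (suc i) zero) x
        e₀ eᵢ : Fin n → Carrier
        e₀ j = eval (N zero (suc j)) x
        eᵢ j = eval (N (suc i) (suc j)) x
        s₀ = sum (λ j → e₀ j * v (suc j))
        sᵢ = sum (λ j → eᵢ j * v (suc j))
        expand : ∀ j → eval (N′ i j) x * v (suc j) ≈ e₀₀ * (eᵢ j * v (suc j)) + - eᵢ₀ * (e₀ j * v (suc j))
        expand j = begin
          eval (N′ i j) x * v (suc j)                              ≈⟨ *-congʳ (eval-⊕ (N₀₀ ⊗ N (suc i) (suc j)) _ x) ⟩
          (eval (N₀₀ ⊗ N (suc i) (suc j)) x
            + eval (⊖ (N (suc i) zero ⊗ N zero (suc j))) x) * v (suc j)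
            ≈⟨ *-congʳ (+-cong (eval-⊗ N₀₀ (N (suc i) (suc j)) x) (trans (eval-⊖ (N (suc i) zero ⊗ N zero (suc j)) x)
                 (trans (-‿cong (eval-⊗ (N (suc i) zero) (N zero (suc j)) x)) (RingProperties.-‿distribˡ-* ring _ _)))) ⟩
          (e₀₀ * eᵢ j + - eᵢ₀ * e₀ j) * v (suc j)
            ≈⟨ solve 5 (λ a b c d w → (a :* b :+ c :* d) :* w := a :* (b :* w) :+ c :* (d :* w))
                 refl e₀₀ (eᵢ j) (- eᵢ₀) (e₀ j) (v (suc j)) ⟩
          e₀₀ * (eᵢ j * v (suc j)) + - eᵢ₀ * (e₀ j * v (suc j))    ∎
      extend : Killed (λ i → v (suc i)) x → Killed v x
      extend (p , k , monic , kills) = p ⊗ N₀₀ , k ℕ.+ m , monic-⊗ {p = p} monic (diag zero) , kills′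
        where
        e₀ : Fin (suc n) → Carrier
        e₀ j = eval (N zero j) x
        ep = eval p x
        kills′ : ∀ i → eval (p ⊗ N zero zero) x * v i ≈ 0#
        kills′ (suc i) = begin
          eval (p ⊗ N zero zero) x * v (suc i)    ≈⟨ *-congʳ (eval-⊗ p (N zero zero) x) ⟩
          (ep * e₀ zero) * v (suc i)              ≈⟨ solve 3 (λ p e w → (p :* e) :* w := e :* (p :* w)) refl ep (e₀ zero) (v (suc i)) ⟩
          e₀ zero * (ep * v (suc i))              ≈⟨ trans (*-congˡ (kills i)) (zeroʳ _) ⟩
          0#                                      ∎
        kills′ zero = begin
          eval (p ⊗ N zero zero) x * v zero                    ≈⟨ *-congʳ (eval-⊗ p (N zero zero) x) ⟩
          (ep * e₀ zero) * v zero                              ≈⟨ *-assoc _ _ _ ⟩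
          ep * (e₀ zero * v zero)                              ≈⟨ sym (+-identityʳ _) ⟩
          ep * (e₀ zero * v zero) + 0#                         ≈⟨ +-congˡ (sym rest) ⟩
          ep * (e₀ zero * v zero) + ep * sum (λ j → e₀ (suc j) * v (suc j))    ≈⟨ sym (distribˡ _ _ _) ⟩
          ep * sum (λ j → e₀ j * v j)                          ≈⟨ trans (*-congˡ (rel zero)) (zeroʳ _) ⟩
          0#                                                   ∎
          where
          rest : ep * sum (λ j → e₀ (suc j) * v (suc j)) ≈ 0#
          rest = begin
            ep * sum (λ j → e₀ (suc j) * v (suc j))      ≈⟨ *-distribˡ-sum ep (λ j → e₀ (suc j) * v (suc j)) ⟩
            sum (λ j → ep * (e₀ (suc j) * v (suc j)))    ≈⟨ sum-cong-≋ (λ j → trans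
                                                            (solve 3 (λ p e w → p :* (e :* w) := e :* (p :* w)) refl ep (e₀ (suc j)) (v (suc j)))
                                                            (trans (*-congˡ (kills j)) (zeroʳ _))) ⟩
            sum {n} (λ _ → 0#)                           ≈⟨ sum-replicate-zero n ⟩
            0#                                           ∎

    annihilate : ∀ n m (N : Fin n → Fin n → P.Poly) (v : Fin n → Carrier) x →
                 (∀ i → MonicOfDegree (N i i) m) →
                 (∀ i j → ¬ (i ≡ j) → DegreeBelow m (N i j)) →
                 (∀ i → sum (λ j → eval (N i j) x * v j) ≈ 0#) →
                 Killed v x
    annihilate zero    m N v x diag off rel =
      const A.1# , 0 , (A.refl , λ { (suc k) _ → A.refl }) , λ ()
    annihilate (suc n) m N v x diag off rel =
      extend (annihilate n (m ℕ.+ m) N′ (λ i → v (suc i)) x diag′ off′ rel′)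
      where open Step m N v x diag off rel

    δ : ∀ {n} → Fin n → Fin n → A.Carrier
    δ zero    zero    = A.1#
    δ zero    (suc j) = A.0#
    δ (suc i) zero    = A.0#
    δ (suc i) (suc j) = δ i j

    δ-diag : ∀ {n} (i : Fin n) → δ i i ≡ A.1#
    δ-diag zero    = ≡.refl
    δ-diag (suc i) = δ-diag i

    δ-off : ∀ {n} (i j : Fin n) → ¬ (i ≡ j) → δ i j ≡ A.0#
    δ-off zero    zero    i≢j = ⊥-elim (i≢j ≡.refl)
    δ-off zero    (suc j) i≢j = ≡.refl
    δ-off (suc i) zero    i≢j = ≡.refl
    δ-off (suc i) (suc j) i≢j = δ-off i j (λ e → i≢j (≡.cong suc e))

    sum-zero : ∀ {n} (f : Fin n → Carrier) → (∀ i → f i ≈ 0#) → sum f ≈ 0#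
    sum-zero {n} f e = trans (sum-cong-≋ e) (sum-replicate-zero n)

    φ0* : ∀ y → φ.⟦ A.0# ⟧ * y ≈ 0#
    φ0* y = trans (*-congʳ φ.0#-homo) (zeroˡ y)

    φ1* : ∀ y → φ.⟦ A.1# ⟧ * y ≈ y
    φ1* y = trans (*-congʳ φ.1#-homo) (*-identityˡ y)

    sum-δ : ∀ {n} (i : Fin n) (v : Fin n → Carrier) → sum (λ j → φ.⟦ δ i j ⟧ * v j) ≈ v i
    sum-δ zero    v = trans (+-cong (φ1* _) (sum-zero _ (λ j → φ0* (v (suc j))))) (+-identityʳ _)
    sum-δ (suc i) v = trans (+-cong (φ0* _) (sum-δ i (λ j → v (suc j)))) (+-identityˡ _)

    coefficients : ∀ {n} {v : Fin n → Carrier} {y} → Span v y →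
                   ∃[ c ] y ≈ sum (λ j → φ.⟦ c j ⟧ * v j)
    coefficients {v = v} (gen i) = δ i , sym (sum-δ i v)
    coefficients {v = v} zer     = (λ _ → A.0#) , sym (sum-zero _ (λ j → φ0* (v j)))
    coefficients {v = v} (add s t) with coefficients s | coefficients t
    ... | c , e | d , f = (λ j → c j A.+ d j) , trans (+-cong e f) (trans (sym (∑-distrib-+ (λ j → φ.⟦ c j ⟧ * v j) (λ j → φ.⟦ d j ⟧ * v j)))
                            (sum-cong-≋ (λ j → sym (trans (*-congʳ (φ.+-homo (c j) (d j))) (distribʳ _ _ _)))))
    coefficients {v = v} (scl a s) with coefficients s
    ... | c , e = (λ j → a A.* c j) , trans (*-congˡ e) (trans (*-distribˡ-sum _ (λ j → φ.⟦ c j ⟧ * v j))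
                    (sum-cong-≋ (λ j → sym (trans (*-congʳ (φ.*-homo a (c j))) (*-assoc _ _ _)))))
    coefficients (resp eq s) with coefficients s
    ... | c , e = c , trans (sym eq) e

    span-kill : ∀ {n} {v : Fin n → Carrier} {y} z → Span v y → (∀ i → z * v i ≈ 0#) → z * y ≈ 0#
    span-kill z (gen i)    k = k i
    span-kill z zer        k = zeroʳ z
    span-kill z (add s t)  k = trans (distribˡ _ _ _) (trans (+-cong (span-kill z s k) (span-kill z t k)) (+-identityˡ _))
    span-kill z (scl a {x} s) k = trans (solve 3 (λ z a x → z :* (a :* x) := a :* (z :* x)) refl z φ.⟦ a ⟧ x)
                                    (trans (*-congˡ (span-kill z s k)) (zeroʳ _))
    span-kill z (resp e s) k = trans (*-congˡ (sym e)) (span-kill z s k)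

    stable⇒integral : ∀ {x} → Stable x → IsIntegral x
    stable⇒integral {x} st =
      p , k , monic , trans (sym (*-identityʳ _)) (span-kill (eval p x) 1∈ kills)
      where
      open Stable st
      coef : Fin n → Fin n → A.Carrier
      coef i = proj₁ (coefficients (x· i))
      N : Fin n → Fin n → P.Poly
      N i j = A.- coef i j ∷ δ i j ∷ []
      rel : ∀ i → sum (λ j → eval (N i j) x * v j) ≈ 0#
      rel i = begin
        sum (λ j → eval (N i j) x * v j)
          ≈⟨ sum-cong-≋ (λ j → trans (*-congʳ (+-cong (φ.-‿homo (coef i j))
               (*-congˡ (trans (+-congˡ (zeroʳ x)) (+-identityʳ _)))))
               (trans (solve 4 (λ n x d w → (n :+ x :* d) :* w := n :* w :+ x :* (d :* w))
                 refl (- φ.⟦ coef i j ⟧) x φ.⟦ δ i j ⟧ (v j))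
               (+-congʳ (trans (sym (RingProperties.-‿distribˡ-* ring _ _)) (sym (-1*x≈-x _)))))) ⟩
        sum (λ j → - 1# * (φ.⟦ coef i j ⟧ * v j) + x * (φ.⟦ δ i j ⟧ * v j))
          ≈⟨ ∑-distrib-+ (λ j → - 1# * (φ.⟦ coef i j ⟧ * v j)) (λ j → x * (φ.⟦ δ i j ⟧ * v j)) ⟩
        sum (λ j → - 1# * (φ.⟦ coef i j ⟧ * v j)) + sum (λ j → x * (φ.⟦ δ i j ⟧ * v j))
          ≈⟨ sym (+-cong (*-distribˡ-sum (- 1#) (λ j → φ.⟦ coef i j ⟧ * v j)) (*-distribˡ-sum x (λ j → φ.⟦ δ i j ⟧ * v j))) ⟩
        - 1# * sum (λ j → φ.⟦ coef i j ⟧ * v j) + x * sum (λ j → φ.⟦ δ i j ⟧ * v j)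
          ≈⟨ +-cong (trans (*-congˡ (sym (proj₂ (coefficients (x· i))))) (-1*x≈-x _)) (*-congˡ (sum-δ i v)) ⟩
        - (x * v i) + x * v i    ≈⟨ -‿inverseˡ _ ⟩
        0#                       ∎
      ann = annihilate n 1 N v x
        (λ i → A.reflexive (δ-diag i) , λ { (suc (suc _)) _ → A.refl ; (suc zero) (s≤s ()) })
        (λ i j i≢j → λ { (suc zero) _ → A.reflexive (δ-off i j i≢j) ; (suc (suc _)) _ → A.refl })
        rel
      p = proj₁ ann
      k = proj₁ (proj₂ ann)
      monic = proj₁ (proj₂ (proj₂ ann))
      kills = proj₂ (proj₂ (proj₂ ann))

    partial : P.Poly → Carrier → ℕ → Carrier
    partial p x zero    = 0#
    partial p x (suc n) = partial p x n + φ.⟦ coeff p n ⟧ * x ^ n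

    partial-[] : ∀ x n → partial [] x n ≈ 0#
    partial-[] x zero    = refl
    partial-[] x (suc n) = trans (+-cong (partial-[] x n) (φ0* _)) (+-identityˡ _)

    partial-∷ : ∀ a p x n → partial (a ∷ p) x (suc n) ≈ φ.⟦ a ⟧ + x * partial p x n
    partial-∷ a p x zero    = trans (+-identityˡ _) (trans (*-identityʳ _)
      (sym (trans (+-congˡ (zeroʳ x)) (+-identityʳ _))))
    partial-∷ a p x (suc n) = trans (+-congʳ (partial-∷ a p x n))
      (solve 5 (λ a x t c y → (a :+ x :* t) :+ c :* (x :* y) := a :+ x :* (t :+ c :* y))
        refl φ.⟦ a ⟧ x (partial p x n) φ.⟦ coeff p n ⟧ (x ^ n))

    eval-partial : ∀ n p x → DegreeBelow n p → eval p x ≈ partial p x n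
    eval-partial zero    p       x d = eval-zero p (P.mk≋ λ k → d k z≤n)
    eval-partial (suc n) []      x d = sym (partial-[] x (suc n))
    eval-partial (suc n) (a ∷ p) x d = trans
      (+-congˡ (*-congˡ (eval-partial n p x (λ k l → d (suc k) (s≤s l)))))
      (sym (partial-∷ a p x n))

    integral⇒stable : ∀ {x} → IsIntegral x → Stable x
    integral⇒stable {x} (p , m , (lead , above) , root) = record
      { v  = powers
      ; 1∈ = power 0 z≤n
      ; x· = λ i → power (suc (toℕ i)) (Fin.toℕ<n i)
      }
      where
      powers : Fin m → Carrier
      powers i = x ^ toℕ i
      low : ∀ k → k ℕ.< m → Span powers (x ^ k)
      low k l = ≡.subst (λ j → Span powers (x ^ j)) (Fin.toℕ-fromℕ< l) (gen (fromℕ< l))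
      span-partial : ∀ k → k ℕ.≤ m → Span powers (partial p x k)
      span-partial zero    _ = zer
      span-partial (suc k) l = add (span-partial k (ℕ.<⇒≤ l)) (scl _ (low k l))
      top : Span powers (x ^ m)
      top = resp (begin
        - partial p x m                                    ≈⟨ sym (+-identityʳ _) ⟩
        - partial p x m + 0#                               ≈⟨ +-congˡ (sym (trans (sym (eval-partial (suc m) p x above)) root)) ⟩
        - partial p x m + (partial p x m + φ.⟦ coeff p m ⟧ * x ^ m)    ≈⟨ sym (+-assoc _ _ _) ⟩
        - partial p x m + partial p x m + φ.⟦ coeff p m ⟧ * x ^ m      ≈⟨ +-cong (-‿inverseˡ _) (*-congʳ (φ.⟦⟧-cong lead)) ⟩
        0# + φ.⟦ A.1# ⟧ * x ^ m                            ≈⟨ trans (+-identityˡ _) (φ1* _) ⟩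
        x ^ m                                              ∎) (neg (span-partial m ℕ.≤-refl))
      power : ∀ k → k ℕ.≤ m → Span powers (x ^ k)
      power k l with ℕ.m≤n⇒m<n∨m≡n l
      ... | inj₁ k<m    = low k k<m
      ... | inj₂ ≡.refl = top

    products : ∀ {m n} → (Fin m → Carrier) → (Fin n → Carrier) → Fin (m ℕ.* n) → Carrier
    products {m} {n} v w k = v (proj₁ (remQuot {m} n k)) * w (proj₂ (remQuot {m} n k))

    module Products {m n} (v : Fin m → Carrier) (w : Fin n → Carrier) where

      span-gen* : ∀ i {t} → Span w t → Span (products v w) (v i * t)
      span-gen* i (gen j)    = ≡.subst (λ ij → Span (products v w) (v (proj₁ ij) * w (proj₂ ij)))
                                 (Fin.remQuot-combine {m} {n} i j) (gen (combine i j))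
      span-gen* i zer        = resp (sym (zeroʳ _)) zer
      span-gen* i (add s t)  = resp (sym (distribˡ _ _ _)) (add (span-gen* i s) (span-gen* i t))
      span-gen* i (scl a {x} s) = resp (solve 3 (λ a v x → a :* (v :* x) := v :* (a :* x)) refl φ.⟦ a ⟧ (v i) x)
                                    (scl a (span-gen* i s))
      span-gen* i (resp e s) = resp (*-congˡ e) (span-gen* i s)

      span* : ∀ {s t} → Span v s → Span w t → Span (products v w) (s * t)
      span* (gen i)    t = span-gen* i t
      span* zer        t = resp (sym (zeroˡ _)) zer
      span* (add r s)  t = resp (sym (distribʳ _ _ _)) (add (span* r t) (span* s t))
      span* (scl a s)  t = resp (sym (*-assoc _ _ _)) (scl a (span* s t))
      span* (resp e s) t = resp (*-congʳ e) (span* s t)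

    module _ {x y} (sx : Stable x) (sy : Stable y) where
      private
        module X = Stable sx
        module Y = Stable sy
        open Products X.v Y.v
        1∈ : Span (products X.v Y.v) 1#
        1∈ = resp (*-identityˡ 1#) (span* X.1∈ Y.1∈)

      stable-+ : Stable (x + y)
      stable-+ = record { v = products X.v Y.v ; 1∈ = 1∈ ; x· = λ k →
        let i = proj₁ (remQuot {X.n} Y.n k) ; j = proj₂ (remQuot {X.n} Y.n k) in
        resp (solve 4 (λ x y v w → (x :* v) :* w :+ v :* (y :* w) := (x :+ y) :* (v :* w)) refl x y (X.v i) (Y.v j))
          (add (span* (X.x· i) (gen j)) (span* (gen i) (Y.x· j))) }

      stable-* : Stable (x * y)
      stable-* = record { v = products X.v Y.v ; 1∈ = 1∈ ; x· = λ k →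
        let i = proj₁ (remQuot {X.n} Y.n k) ; j = proj₂ (remQuot {X.n} Y.n k) in
        resp (solve 4 (λ x y v w → (x :* v) :* (y :* w) := (x :* y) :* (v :* w)) refl x y (X.v i) (Y.v j))
          (span* (X.x· i) (Y.x· j)) }

    stable-neg : ∀ {x} → Stable x → Stable (- x)
    stable-neg sx = record { v = v ; 1∈ = 1∈ ; x· = λ i →
      resp (RingProperties.-‿distribˡ-* ring _ _) (neg (x· i)) }
      where open Stable sx

  integral-+ : ∀ {x y} → IsIntegral x → IsIntegral y → IsIntegral (x + y)
  integral-+ ix iy = stable⇒integral (stable-+ (integral⇒stable ix) (integral⇒stable iy))

  integral-* : ∀ {x y} → IsIntegral x → IsIntegral y → IsIntegral (x * y)
  integral-* ix iy = stable⇒integral (stable-* (integral⇒stable ix) (integral⇒stable iy))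

  integral-neg : ∀ {x} → IsIntegral x → IsIntegral (- x)
  integral-neg ix = stable⇒integral (stable-neg (integral⇒stable ix))

  integral-base : ∀ a → IsIntegral φ.⟦ a ⟧
  integral-base a = A.- a ∷ A.1# ∷ [] , 1 , (A.refl , λ { (suc (suc _)) _ → A.refl ; (suc zero) (s≤s ()) }) , (begin
    φ.⟦ A.- a ⟧ + φ.⟦ a ⟧ * (φ.⟦ A.1# ⟧ + φ.⟦ a ⟧ * 0#)    ≈⟨ +-cong (φ.-‿homo a) (*-congˡ (trans (+-cong φ.1#-homo (zeroʳ _)) (+-identityʳ _))) ⟩
    - φ.⟦ a ⟧ + φ.⟦ a ⟧ * 1#                               ≈⟨ +-congˡ (*-identityʳ _) ⟩
    - φ.⟦ a ⟧ + φ.⟦ a ⟧                                    ≈⟨ -‿inverseˡ _ ⟩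
    0#                                                     ∎)

  integral-resp : ∀ {x y} → x ≈ y → IsIntegral x → IsIntegral y
  integral-resp e (p , n , monic , root) = p , n , monic , trans (eval-congʳ p (sym e)) root

  -- An element of the closure carries an integral equation, which equality ignores.
  record Integer : Set (a ⊔ b ⊔ ℓ₁ ⊔ ℓ₂) where
    constructor _,_
    field
      value    : Carrier
      integral : IsIntegral value
  open Integer public

  record _≈ᵢ_ (x y : Integer) : Set ℓ₂ where
    constructor mk≈
    field value≈ : value x ≈ value y
  open _≈ᵢ_ public

  private
    rawIntegers : RawRing (a ⊔ b ⊔ ℓ₁ ⊔ ℓ₂) ℓ₂
    rawIntegers = record
      { Carrier = Integer
      ; _≈_ = _≈ᵢ_
      ; _+_ = λ x y → value x + value y , integral-+ (integral x) (integral y)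
      ; _*_ = λ x y → value x * value y , integral-* (integral x) (integral y)
      ; -_  = λ x → - value x , integral-neg (integral x)
      ; 0#  = 0# , integral-resp φ.0#-homo (integral-base A.0#)
      ; 1#  = 1# , integral-resp φ.1#-homo (integral-base A.1#)
      }

    value-isRingHomomorphism : IsRingHomomorphism rawIntegers (CommutativeRing.rawRing B) value
    value-isRingHomomorphism = record
      { isSemiringHomomorphism = record
        { isNearSemiringHomomorphism = record
          { +-isMonoidHomomorphism = record
            { isMagmaHomomorphism = record
              { isRelHomomorphism = record { cong = value≈ }
              ; homo = λ _ _ → refl
              }
            ; ε-homo = refl
            }
          ; *-homo = λ _ _ → refl
          }
        ; 1#-homo = refl
        }
      ; -‿homo = λ _ → refl
      }

    value-isRingMonomorphism : IsRingMonomorphism rawIntegers (CommutativeRing.rawRing B) value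
    value-isRingMonomorphism = record
      { isRingHomomorphism = value-isRingHomomorphism ; injective = mk≈ }

  commutativeRing : CommutativeRing (a ⊔ b ⊔ ℓ₁ ⊔ ℓ₂) ℓ₂
  commutativeRing = record
    { RawRing rawIntegers
    ; isCommutativeRing = RingMonomorphism.isCommutativeRing value-isRingMonomorphism isCommutativeRing
    }

  fromBase : A.Carrier → Integer
  fromBase a = φ.⟦ a ⟧ , integral-base a

record Ideal {c ℓ} (R : CommutativeRing c ℓ) p : Set (c ⊔ ℓ ⊔ lsuc p) where
  open CommutativeRing R
  infix 4 _∈I
  field
    _∈I      : Pred Carrier p
    ∈-resp-≈ : ∀ {x y} → x ≈ y → x ∈I → y ∈I
    0∈       : 0# ∈I
    +-closed : ∀ {x y} → x ∈I → y ∈I → (x + y) ∈I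
    *-closed : ∀ r {x} → x ∈I → (r * x) ∈I

module _ {c ℓ} (R : CommutativeRing c ℓ) where

  open CommutativeRing R
  open RingNotions R using (_∣_)
  open RawMagmaDefinitions using (_,_)
  open RingProperties ring using (-1*x≈-x)

  principal : Carrier → Ideal R (c ⊔ ℓ)
  principal α = record
    { _∈I      = α ∣_
    ; ∈-resp-≈ = λ { e (q , f) → q , trans f e }
    ; 0∈       = 0# , zeroˡ α
    ; +-closed = λ { (q , e) (r , f) → q + r , trans (distribʳ _ _ _) (+-cong e f) }
    ; *-closed = λ { r (q , e) → r * q , trans (*-assoc _ _ _) (*-congˡ e) }
    }

  data Generated {p} (X : Pred Carrier p) : Pred Carrier (c ⊔ ℓ ⊔ p) where
    generator : ∀ {x} → X x → Generated X x
    resp      : ∀ {x y} → x ≈ y → Generated X x → Generated X y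
    nil       : Generated X 0#
    add       : ∀ {x y} → Generated X x → Generated X y → Generated X (x + y)
    scale     : ∀ r {x} → Generated X x → Generated X (r * x)

  generatedBy : ∀ {p} → Pred Carrier p → Ideal R (c ⊔ ℓ ⊔ p)
  generatedBy X = record
    { _∈I = Generated X ; ∈-resp-≈ = resp ; 0∈ = nil ; +-closed = add ; *-closed = scale }

  module _ {p} (I : Ideal R p) where

    open Ideal I

    infix 4 _∼_
    record _∼_ (x y : Carrier) : Set p where
      constructor mk∼
      field difference : (x - y) ∈I

    private
      open SemiringSolver commutativeSemiring

      neg-closed : ∀ {x} → x ∈I → (- x) ∈I
      neg-closed {x} x∈ = ∈-resp-≈ (-1*x≈-x x) (*-closed (- 1#) x∈)

      -- an equation d ≈ x - y, checked in the form d + y ≈ x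
      via : ∀ {d x y} → d + y ≈ x → d ∈I → x ∼ y
      via {d} {x} {y} e d∈ = mk∼ (∈-resp-≈
        (trans (sym (+-identityʳ d)) (trans (+-congˡ (sym (-‿inverseʳ y)))
          (trans (sym (+-assoc d y (- y))) (+-congʳ e)))) d∈)

      back : ∀ x y → (x - y) + y ≈ x
      back x y = trans (+-assoc x (- y) y) (trans (+-congˡ (-‿inverseˡ y)) (+-identityʳ x))

      ≈⇒∼ : ∀ {x y} → x ≈ y → x ∼ y
      ≈⇒∼ e = via (trans (+-identityˡ _) (sym e)) 0∈

      ∼-sym : ∀ {x y} → x ∼ y → y ∼ x
      ∼-sym {x} {y} (mk∼ i) = via
        (trans (+-congˡ (sym (back x y))) (trans (sym (+-assoc _ _ y))
          (trans (+-congʳ (-‿inverseˡ (x - y))) (+-identityˡ y)))) (neg-closed i)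

      ∼-trans : ∀ {x y z} → x ∼ y → y ∼ z → x ∼ z
      ∼-trans {x} {y} {z} (mk∼ i) (mk∼ j) = via
        (trans (+-assoc _ _ z) (trans (+-congˡ (back y z)) (back x y))) (+-closed i j)

      +-cong-∼ : ∀ {x x′ y y′} → x ∼ x′ → y ∼ y′ → (x + y) ∼ (x′ + y′)
      +-cong-∼ {x} {x′} {y} {y′} (mk∼ i) (mk∼ j) = via
        (trans (solve 4 (λ d e x y → (d :+ e) :+ (x :+ y) := (d :+ x) :+ (e :+ y)) refl (x - x′) (y - y′) x′ y′)
          (+-cong (back x x′) (back y y′))) (+-closed i j)

      *-cong-∼ : ∀ {x x′ y y′} → x ∼ x′ → y ∼ y′ → (x * y) ∼ (x′ * y′)
      *-cong-∼ {x} {x′} {y} {y′} (mk∼ i) (mk∼ j) = via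
        (trans (+-congʳ (+-congʳ (*-congʳ (sym (back y y′)))))
          (trans (solve 4 (λ d e x′ y′ → ((e :+ y′) :* d :+ x′ :* e) :+ x′ :* y′ := (d :+ x′) :* (e :+ y′))
                   refl (x - x′) (y - y′) x′ y′)
            (*-cong (back x x′) (back y y′))))
        (+-closed (*-closed y i) (*-closed x′ j))

      -‿cong-∼ : ∀ {x x′} → x ∼ x′ → (- x) ∼ (- x′)
      -‿cong-∼ {x} {x′} (mk∼ i) = via
        (trans (+-congˡ (sym (-1*x≈-x x′))) (trans (+-congʳ (sym (-1*x≈-x (x - x′))))
          (trans (sym (distribˡ (- 1#) _ _)) (trans (*-congˡ (back x x′)) (-1*x≈-x x))))) (neg-closed i)

    quotient : CommutativeRing c p
    quotient = record
      { Carrier = Carrier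
      ; _≈_ = _∼_
      ; _+_ = _+_
      ; _*_ = _*_
      ; -_  = -_
      ; 0#  = 0#
      ; 1#  = 1#
      ; isCommutativeRing = ringFromLaws
          (record { refl = ≈⇒∼ refl ; sym = ∼-sym ; trans = ∼-trans })
          +-cong-∼ *-cong-∼ -‿cong-∼
          (λ x y z → ≈⇒∼ (+-assoc x y z)) (λ x y → ≈⇒∼ (+-comm x y))
          (λ x → ≈⇒∼ (+-identityˡ x)) (λ x → ≈⇒∼ (-‿inverseˡ x))
          (λ x y z → ≈⇒∼ (*-assoc x y z)) (λ x y → ≈⇒∼ (*-comm x y))
          (λ x → ≈⇒∼ (*-identityˡ x)) (λ x y z → ≈⇒∼ (distribʳ x y z))
      }

record IsCarmichaelRing (S : CommutativeRing c ℓ) : Set (c ⊔ ℓ) where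
  open CommutativeRing S using (_≈_)
  open RingNotions S using (_^_)
  field
    order          : ℕ
    hasCardinality : HasCardinality S order
    notField       : ¬ IsField S
    power          : ∀ a → a ^ order ≈ a

IsCarmichaelIdeal : (R : CommutativeRing c ℓ) → ∀ {p} → Ideal R p → Set (c ⊔ p)
IsCarmichaelIdeal R I = IsCarmichaelRing (quotient R I)

module Determinant {c ℓ} (R : CommutativeRing c ℓ) where

  open CommutativeRing R using (Carrier; -_; _*_; 1#)
  open RingNotions R using (sum; _^_)

  det : ∀ {n} → (Fin n → Fin n → Carrier) → Carrier
  det {zero}  M = 1#
  det {suc n} M = sum λ j → (- 1#) ^ toℕ j * (M zero j * det λ i k → M (suc i) (punchIn j k))

-- That [K : k] = d is expressed by a k-basis of K with d elements.
record FiniteExtension (k : CommutativeRing c ℓ) (d : ℕ) (c′ ℓ′ : Level) :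
                       Set (c ⊔ ℓ ⊔ lsuc c′ ⊔ lsuc ℓ′) where
  private module k = CommutativeRing k
  field
    K       : CommutativeRing c′ ℓ′
    isField : IsField K
    ι       : Hom k K
  open CommutativeRing K public
  open RingHomomorphism ι public using (⟦_⟧)
  open RingNotions K using (sum)
  field
    basis       : Fin d → Carrier
    coordinate  : Carrier → Fin d → k.Carrier
    expansion   : ∀ x → x ≈ sum (λ i → ⟦ coordinate x i ⟧ * basis i)
    independent : ∀ (a : Fin d → k.Carrier) → sum (λ i → ⟦ a i ⟧ * basis i) ≈ 0# → ∀ i → a i k.≈ k.0#

  -- The trace of the k-linear map y ↦ x y, read off its matrix in the basis; it
  -- does not depend on the basis.
  trace : Carrier → k.Carrier
  trace x = RingNotions.sum k (λ i → coordinate (x * basis i) i)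

  disc : (Fin d → Carrier) → k.Carrier
  disc x = Determinant.det k (λ i j → trace (x i * x j))

module _ {k : CommutativeRing c ℓ} {d : ℕ} (E : FiniteExtension k d c′ ℓ′) where

  open FiniteExtension E using (K; ι; Carrier; _≈_; 0#)
  open Evaluation k K ι using (eval)
  private module k[X] = Polynomial k
  open RingNotions k[X].commutativeRing using (_∣_; Coprime)

  record IsMinimalPolynomial (x : Carrier) (m : k[X].Poly) : Set (c ⊔ ℓ ⊔ ℓ′) where
    field
      degree     : ℕ
      monic      : k[X].MonicOfDegree m degree
      root       : eval m x ≈ 0#
      divides    : ∀ f → eval f x ≈ 0# → m ∣ f

  -- A polynomial over k has no repeated roots if and only if it is prime to its
  -- derivative.
  IsSeparable : Set (c ⊔ ℓ ⊔ c′ ⊔ ℓ′)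
  IsSeparable = ∀ x → ∃[ m ] IsMinimalPolynomial x m × Coprime m (k[X].derivative m)

record FiniteField (c ℓ : Level) : Set (lsuc (c ⊔ ℓ)) where
  field
    ring           : CommutativeRing c ℓ
    isField        : IsField ring
    q              : ℕ
    hasCardinality : HasCardinality ring q

module FunctionField {c ℓ} (𝔽 : FiniteField c ℓ) where

  private module 𝔽 = FiniteField 𝔽

  module 𝔽X   = Polynomial 𝔽.ring
  module Dom  = 𝔽X.Domain 𝔽.isField (finite⇒decidable 𝔽.ring 𝔽.hasCardinality)
  module Frac = Fractions 𝔽X.commutativeRing Dom.1≉0 Dom.⊗-cancelˡ-nonZero

  𝔽[t] : CommutativeRing c ℓ
  𝔽[t] = 𝔽X.commutativeRing

  𝔽⟨t⟩ : CommutativeRing (c ⊔ ℓ) ℓ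
  𝔽⟨t⟩ = Frac.commutativeRing

  fraction : Hom 𝔽[t] 𝔽⟨t⟩
  fraction = Frac.fromBaseHom

  open CommutativeRing 𝔽[t] using () renaming (Carrier to Pol)
  open RingNotions 𝔽[t] using (_∣_; _∤_; Irreducible)

  IsReducible : Pol → Set (c ⊔ ℓ)
  IsReducible g = ∃[ x ] ∃[ y ] (g ≈ x * y) × x ∤ 1# × y ∤ 1#
    where open CommutativeRing 𝔽[t]

  IsSquareFree : Pol → Set (c ⊔ ℓ)
  IsSquareFree g = ∀ h → (h * h) ∣ g → h ∣ 1#
    where open CommutativeRing 𝔽[t]

  record IsRigidCarmichael (d : ℕ) (g : Pol) : Set (c ⊔ ℓ) where
    field
      reducible  : IsReducible g
      squareFree : IsSquareFree g
      rigid      : ∀ P → Irreducible P → P ∣ g →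
                   ∀ {m n} → 𝔽X.HasDegree P m → 𝔽X.HasDegree g n →
                   ∀ i → 1 ℕ.≤ i → i ℕ.≤ d → i ℕ.* m ℕ.∣ d ℕ.* n

  module _ {d : ℕ} {c′ ℓ′ : Level} (E : FiniteExtension 𝔽⟨t⟩ d c′ ℓ′) where

    open FiniteExtension E using (K; ι; disc)

    𝔽[t]→K : Hom 𝔽[t] K
    𝔽[t]→K = ringHomomorphism {M₁ = CommutativeRing.ring 𝔽[t]} {M₂ = CommutativeRing.ring 𝔽⟨t⟩}
                              {M₃ = CommutativeRing.ring K} fraction ι

    module 𝒪 = IntegralClosure 𝔽[t] K 𝔽[t]→K

    𝒪K : CommutativeRing (c ⊔ ℓ ⊔ c′ ⊔ ℓ′) ℓ′
    𝒪K = 𝒪.commutativeRing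

    -- disc x is defined in 𝔽_q(t); for x in 𝒪_K it lies in 𝔽_q[t], as traces of
    -- integral elements do, so every tuple x contributes a generator below.
    IsDiscriminantOfIntegers : Pol → Set (c ⊔ ℓ ⊔ c′ ⊔ ℓ′)
    IsDiscriminantOfIntegers D =
      Σ[ x ∈ (Fin d → 𝒪.Integer) ] RingHomomorphism.⟦_⟧ fraction D ≈ disc (λ i → 𝒪.value (x i))
      where open CommutativeRing 𝔽⟨t⟩ using (_≈_)

    discriminantIdeal : Ideal 𝔽[t] (c ⊔ ℓ ⊔ c′ ⊔ ℓ′)
    discriminantIdeal = generatedBy 𝔽[t] IsDiscriminantOfIntegers

    -- A polynomial divides an ideal when it divides all of its elements.
    DiscriminantPrimeTo : Pol → Set (c ⊔ ℓ ⊔ c′ ⊔ ℓ′)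
    DiscriminantPrimeTo g =
      ∀ P → Irreducible P → P ∣ g → ¬ (∀ D → D ∈I → P ∣ D)
      where open Ideal discriminantIdeal

    IsCarmichaelElement : 𝒪.Integer → Set (c ⊔ ℓ ⊔ c′ ⊔ ℓ′)
    IsCarmichaelElement α = IsCarmichaelIdeal 𝒪K (principal 𝒪K α)

    IsCarmichaelIn : Pol → Set (c ⊔ ℓ ⊔ c′ ⊔ ℓ′)
    IsCarmichaelIn g = IsCarmichaelElement (𝒪.fromBase g)

{-# OPTIONS --safe #-}

-- Write A = F_q[t], k = F_q(t) and O = O_K. If the trace form of K/k were degenerate,
-- all discriminants would vanish, so it is nondegenerate; as traces of integers lie
-- in A (an integer acts by a matrix over A on a basis of a lattice that it
-- stabilizes), this bounds the denominators of the coordinates of integers, and O is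
-- free over A of rank d. Hence |O/g| = q^(dn) with n = deg g, and O/g is not a field
-- because a factorization of g over A remains one over O.
--
-- Let P be a prime factor of g, m = deg P and F = A/P, a field with Q = q^m elements.
-- An element of O/P with square zero is orthogonal to everything for the trace form,
-- so O/P is reduced, as P does not divide the discriminant. Each a in O/P satisfies a
-- relation of degree at most d over F, which has the d + 1 roots a^(Q^j), 0 ≤ j ≤ d.
-- Therefore the product of the differences a^(Q^j) - a^(Q^i) vanishes, as in the
-- Vandermonde determinant. Rigidity makes each of them divide a power of
-- a^(q^(dn)) - a, which is thus nilpotent, hence zero. Since g is square-free, the
-- congruences modulo all P combine to a^|O/g| = a modulo g.
--
-- To obtain a basis of O constructively, membership in O is decided by whether the
-- minimal polynomial has coefficients in A (Gauss's lemma), and a decidable lattice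
-- in A^d acquires a triangular basis whose pivots are gcds over finitely many
-- residues.

module Submission where

open import Defs
open import Algebra.Bundles using (CommutativeRing; RawRing)
open import Algebra.Definitions using (AlmostLeftCancellative)
import Algebra.Definitions.RawMagma as RawMagmaDefinitions
open import Algebra.Morphism.Bundles using (RingHomomorphism)
open import Algebra.Morphism.Construct.Composition using (ringHomomorphism)
import Algebra.Properties.AbelianGroup as AbelianGroupProperties
import Algebra.Properties.CommutativeMonoid.Sum as MonoidSum
import Algebra.Properties.CommutativeSemigroup.Divisibility as CommutativeDivisibility
import Algebra.Properties.CommutativeSemiring.Binomial as Binomial
import Algebra.Properties.CommutativeSemiring.Exp as CommutativeExp
import Algebra.Properties.Ring as RingProperties
import Algebra.Properties.Semiring.Divisibility as SemiringDivisibility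
import Algebra.Properties.Semiring.Exp as Exp
import Algebra.Properties.Semiring.Mult as Multiple
import Algebra.Properties.Semiring.Mult.TCOptimised as Mult
import Algebra.Properties.Semiring.Sum as SemiringSum
import Algebra.Solver.Ring
open import Algebra.Solver.Ring.AlmostCommutativeRing using (_-Raw-AlmostCommutative⟶_; fromCommutativeRing)
import Algebra.Solver.Ring.NaturalCoefficients.Default as SemiringSolver
open import Data.Empty using (⊥; ⊥-elim)
open import Data.Fin.Base as Fin using (Fin; zero; suc; toℕ; fromℕ; inject₁; punchIn; punchOut)
import Data.Fin.Induction as Fin
import Data.Fin.Permutation as Permutation
import Data.Fin.Properties as Fin
open import Data.Fin.Relation.Unary.Top using (view; ‵fromℕ; ‵inject₁)
open import Data.List.Base using ([]; _∷_; List; map)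
open import Data.List.Relation.Unary.All as All using (All; []; _∷_)
import Data.List.Relation.Unary.All.Properties as All
open import Data.Maybe.Base using (Maybe; just; nothing)
open import Data.Nat.Base as ℕ using (ℕ; zero; suc; _≤_; z≤n; s≤s)
open import Data.Nat.Combinatorics using (_C_; nCn≡1)
import Data.Nat.Divisibility as ℕ
import Data.Nat.Properties as ℕ
open import Data.Product.Base using (_×_; _,_; proj₁; proj₂; ∃; ∃-syntax; Σ-syntax)
open import Data.Sum.Base using (_⊎_; inj₁; inj₂)
open import Data.Vec.Functional using (insertAt) renaming (_∷_ to _◂_)
import Data.Vec.Functional.Properties as Vector
open import Function.Bundles using (Inverse)
open import Level using (Level; 0ℓ)
open import Relation.Binary.Definitions using (Decidable; tri<; tri≈; tri>)
import Relation.Binary.PropositionalEquality as ≡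
import Relation.Binary.Reasoning.Setoid as SetoidReasoning
open import Relation.Nullary.Decidable using (yes; no; Dec; ¬?; decidable-stable)
open import Relation.Nullary.Negation using (¬_)
open ≡ using (_≡_; _≢_)

-- Classically O/P is a product of fields with Q^f elements, f ≤ d, and f m | d n makes the power
-- q^(dn) the identity on each of them. Here no prime ideal of O is ever produced. The unknown
-- residue degrees f are replaced by the gaps j - i between two exponents of Frobenius, which range
-- over the same numbers 1, ..., d, so rigidity is applied to every one of them. The differences of
-- the candidate roots need not be units in O/P; the usual count of roots is therefore carried out
-- after inverting t = a^(q^(dn)) - a, and it fails only where t is nilpotent. The other obstacle is
-- decidability. The lattice stabilized by an integer is cut out by one condition for each power of
-- that integer, so its basis is obtained under a double negation, which is discharged because it is
-- decidable whether an element of k lies in A. A basis of O has to be found outright, since the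
-- cardinality of O/g is data; the minimal polynomials supplied by separability decide integrality.

private
  variable
    c ℓ c₁ ℓ₁ c₂ ℓ₂ c₃ ℓ₃ c₄ ℓ₄ c′ ℓ′ p : Level

-- Ring solver with integer coefficients and general ring lemmas

-- A coefficient (m , n) stands for the integer m - n.
module IntegerSolver {c ℓ} (R : CommutativeRing c ℓ) where

  open CommutativeRing R
  private
    open Mult semiring using () renaming (_×_ to _×ₙ_; ×-homo-+ to ×ₙ-homo-+; ×1-homo-* to ×ₙ1-homo-*)
    open SetoidReasoning setoid
    module S = SemiringSolver commutativeSemiring
    open S using (_:=_; _:+_; _:*_)
    open AbelianGroupProperties +-abelianGroup using (⁻¹-∙-comm; ⁻¹-anti-homo‿-)
    open RingProperties ring using (-0#≈0#)

    differences : RawRing 0ℓ 0ℓ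
    differences = record
      { Carrier = ℕ × ℕ
      ; _≈_ = _≡_
      ; _+_ = λ { (a , b) (c , d) → a ℕ.+ c , b ℕ.+ d }
      ; _*_ = λ { (a , b) (c , d) → a ℕ.* c ℕ.+ b ℕ.* d , a ℕ.* d ℕ.+ b ℕ.* c }
      ; -_ = λ { (a , b) → b , a }
      ; 0# = 0 , 0
      ; 1# = 1 , 0
      }

    ν : ℕ → Carrier
    ν n = n ×ₙ 1#

    -- The separate clause for a second component zero makes `:0` and `:1` evaluate to `0#` and `1#`
    -- definitionally. A plain difference would leave a summand `- 0#` in every goal handed to
    -- `solve`.
    ⟦_⟧ : ℕ × ℕ → Carrier
    ⟦ a , zero ⟧  = ν a
    ⟦ a , suc b ⟧ = ν a - ν (suc b)

    unfold : ∀ x → ⟦ x ⟧ ≈ ν (proj₁ x) - ν (proj₂ x)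
    unfold (a , zero)  = sym (trans (+-congˡ -0#≈0#) (+-identityʳ _))
    unfold (a , suc b) = refl

    diff-≈ : ∀ {a b c d} → a + d ≈ c + b → a - b ≈ c - d
    diff-≈ {a} {b} {c} {d} e = begin
      a - b                    ≈⟨ sym (trans (+-congˡ (-‿inverseʳ d)) (+-identityʳ _)) ⟩
      (a - b) + (d - d)
        ≈⟨ S.solve 4 (λ a b d e → (a :+ b) :+ (d :+ e) := (a :+ d) :+ (b :+ e)) refl a (- b) d (- d) ⟩
      (a + d) + (- b + - d)    ≈⟨ +-congʳ e ⟩
      (c + b) + (- b + - d)
        ≈⟨ S.solve 4 (λ a b d e → (a :+ b) :+ (d :+ e) := (a :+ e) :+ (b :+ d)) refl c b (- b) (- d) ⟩
      (c - d) + (b - b)        ≈⟨ trans (+-congˡ (-‿inverseʳ b)) (+-identityʳ _) ⟩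
      c - d                    ∎

    back : ∀ a b → (a - b) + b ≈ a
    back a b = trans (+-assoc a (- b) b) (trans (+-congˡ (-‿inverseˡ b)) (+-identityʳ a))

    shifted : ∀ {x a b} → x + b ≈ a → x ≈ a - b
    shifted {x} {a} {b} e = begin
      x              ≈⟨ sym (trans (+-congˡ (-‿inverseʳ b)) (+-identityʳ x)) ⟩
      x + (b - b)    ≈⟨ sym (+-assoc _ _ _) ⟩
      x + b - b      ≈⟨ +-congʳ e ⟩
      a - b          ∎

    *-homo′ : ∀ a b c d → (a * c + b * d) - (a * d + b * c) ≈ (a - b) * (c - d)
    *-homo′ a b c d = sym (shifted (begin
      u * v + (a * d + b * c)
        ≈⟨ +-congˡ (+-cong (*-congʳ (sym (back a b))) (*-congˡ (sym (back c d)))) ⟩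
      u * v + ((u + b) * d + b * (v + d))
        ≈⟨ S.solve 4 (λ u v b d → u :* v :+ ((u :+ b) :* d :+ b :* (v :+ d)) := (u :+ b) :* (v :+ d) :+ b :* d) refl u v b d ⟩
      (u + b) * (v + d) + b * d                      ≈⟨ +-congʳ (*-cong (back a b) (back c d)) ⟩
      a * c + b * d                                  ∎))
      where
      u = a - b
      v = c - d

    homomorphism : differences -Raw-AlmostCommutative⟶ fromCommutativeRing R
    homomorphism = record
      { ⟦_⟧ = ⟦_⟧
      ; +-homo = λ { (a , b) (c , d) → begin
          ⟦ a ℕ.+ c , b ℕ.+ d ⟧               ≈⟨ unfold (a ℕ.+ c , b ℕ.+ d) ⟩
          ν (a ℕ.+ c) - ν (b ℕ.+ d)           ≈⟨ +-cong (×ₙ-homo-+ 1# a c) (-‿cong (×ₙ-homo-+ 1# b d)) ⟩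
          (ν a + ν c) - (ν b + ν d)           ≈⟨ +-congˡ (sym (⁻¹-∙-comm _ _)) ⟩
          (ν a + ν c) + (- ν b + - ν d)
            ≈⟨ S.solve 4 (λ a b d e → (a :+ b) :+ (d :+ e) := (a :+ d) :+ (b :+ e)) refl (ν a) (ν c) (- ν b) (- ν d) ⟩
          (ν a - ν b) + (ν c - ν d)           ≈⟨ sym (+-cong (unfold (a , b)) (unfold (c , d))) ⟩
          ⟦ a , b ⟧ + ⟦ c , d ⟧               ∎ }
      ; *-homo = λ { (a , b) (c , d) → begin
          ⟦ a ℕ.* c ℕ.+ b ℕ.* d , a ℕ.* d ℕ.+ b ℕ.* c ⟧
            ≈⟨ unfold (a ℕ.* c ℕ.+ b ℕ.* d , a ℕ.* d ℕ.+ b ℕ.* c) ⟩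
          ν (a ℕ.* c ℕ.+ b ℕ.* d) - ν (a ℕ.* d ℕ.+ b ℕ.* c)
            ≈⟨ +-cong (trans (×ₙ-homo-+ 1# (a ℕ.* c) _) (+-cong (×ₙ1-homo-* a c) (×ₙ1-homo-* b d)))
                      (-‿cong (trans (×ₙ-homo-+ 1# (a ℕ.* d) _) (+-cong (×ₙ1-homo-* a d) (×ₙ1-homo-* b c)))) ⟩
          (ν a * ν c + ν b * ν d) - (ν a * ν d + ν b * ν c)
            ≈⟨ *-homo′ _ _ _ _ ⟩
          (ν a - ν b) * (ν c - ν d)           ≈⟨ sym (*-cong (unfold (a , b)) (unfold (c , d))) ⟩
          ⟦ a , b ⟧ * ⟦ c , d ⟧               ∎ }
      ; -‿homo = λ { (a , b) → trans (unfold (b , a)) (trans (sym (⁻¹-anti-homo‿- _ _)) (-‿cong (sym (unfold (a , b))))) }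
      ; 0-homo = refl
      ; 1-homo = refl
      }

    -- Pairs are compared as integers. In positive characteristic further pairs have equal values,
    -- hence a `Maybe` and not a decision.
    equal? : ∀ x y → Maybe (⟦ x ⟧ ≈ ⟦ y ⟧)
    equal? (a , b) (c , d) with a ℕ.+ d ℕ.≟ c ℕ.+ b
    ... | no  _ = nothing
    ... | yes e = just (trans (unfold (a , b)) (trans (diff-≈ (begin
            ν a + ν d      ≈⟨ sym (×ₙ-homo-+ 1# a d) ⟩
            ν (a ℕ.+ d)    ≡⟨ ≡.cong ν e ⟩
            ν (c ℕ.+ b)    ≈⟨ ×ₙ-homo-+ 1# c b ⟩
            ν c + ν b      ∎)) (sym (unfold (c , d)))))

  open Algebra.Solver.Ring differences (fromCommutativeRing R) homomorphism equal? public
    using (solve; _:=_; _:+_; _:*_; _:-_; :-_; con; Polynomial)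

  :0 :1 : ∀ {n} → Polynomial n
  :0 = con (0 , 0)
  :1 = con (1 , 0)

module Ring (R : CommutativeRing c ℓ) where

  open CommutativeRing R public hiding (zero)
  open RingProperties ring public
    using (-0#≈0#; -1*x≈-x; -‿distribˡ-*; x[y-z]≈xy-xz; [y-z]x≈yx-zx; x∙y⁻¹≈ε⇒x≈y; x≈y⇒x∙y⁻¹≈ε)
  open RingNotions R public using (sum; _^_; _∣_; _∤_; Irreducible; mkIrred)
  open SemiringSum semiring public
    using (sum-remove; sum-replicate-zero; ∑-distrib-+; ∑-comm; *-distribˡ-sum; *-distribʳ-sum)
  open Exp semiring public using (^-congˡ; ^-homo-*; ^-assocʳ)
  open CommutativeExp commutativeSemiring public using (^-distrib-*)
  open RawMagmaDefinitions public using (_,_)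
  open SemiringDivisibility semiring public
    using (_∣0; ∣ʳ-respʳ-≈; ∣ʳ-respˡ-≈; ∣ʳ-trans; ∣ʳ-refl; x∣ʳy⇒x∣ʳzy)
  open CommutativeDivisibility *-commutativeSemigroup public using (x∣xy; ∙-cong-∣)
  open SetoidReasoning setoid public

  Unit : Carrier → Set _
  Unit x = ∃[ y ] x * y ≈ 1#

  x≈0⇒xy≈0 : ∀ {x} y → x ≈ 0# → x * y ≈ 0#
  x≈0⇒xy≈0 y e = trans (*-congʳ e) (zeroˡ y)

  y≈0⇒xy≈0 : ∀ x {y} → y ≈ 0# → x * y ≈ 0#
  y≈0⇒xy≈0 x e = trans (*-congˡ e) (zeroʳ x)

  sum-cong : ∀ {n} {f g : Fin n → Carrier} → (∀ i → f i ≈ g i) → sum f ≈ sum g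
  sum-cong = SemiringSum.sum-cong-≋ semiring

  sum-zero : ∀ {n} {f : Fin n → Carrier} → (∀ i → f i ≈ 0#) → sum f ≈ 0#
  sum-zero {n} e = trans (sum-cong e) (sum-replicate-zero n)

  sum-single : ∀ {n} (i : Fin n) {f : Fin n → Carrier} → (∀ j → j ≢ i → f j ≈ 0#) → sum f ≈ f i
  sum-single {suc n} i {f} e = trans (sum-remove {n} {i} f)
    (trans (+-congˡ (sum-zero (λ j → e (punchIn i j) (Fin.punchInᵢ≢i i j)))) (+-identityʳ _))

  ∣-+ : ∀ {x y z} → x ∣ y → x ∣ z → x ∣ y + z
  ∣-+ (p , e) (q , f) = p + q , trans (distribʳ _ _ _) (+-cong e f)

  ∣-neg : ∀ {x y} → x ∣ y → x ∣ - y
  ∣-neg (p , e) = - p , trans (sym (-‿distribˡ-* _ _)) (-‿cong e)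

  ∣-sum : ∀ {n x} {f : Fin n → Carrier} → (∀ i → x ∣ f i) → x ∣ sum f
  ∣-sum {zero}  e = _ ∣0
  ∣-sum {suc n} e = ∣-+ (e zero) (∣-sum (λ i → e (suc i)))

  1^n≈1 : ∀ n → 1# ^ n ≈ 1#
  1^n≈1 zero    = refl
  1^n≈1 (suc n) = trans (*-identityˡ _) (1^n≈1 n)

  0^n≈0 : ∀ n → 1 ℕ.≤ n → 0# ^ n ≈ 0#
  0^n≈0 (suc n) _ = zeroˡ _

module RingHom (A : CommutativeRing c ℓ) (B : CommutativeRing c′ ℓ′) (φ : Hom A B) where

  private
    module A = Ring A
    module B = Ring B
  open RingHomomorphism φ public

  sum-homo : ∀ {n} (f : Fin n → A.Carrier) → ⟦ A.sum f ⟧ B.≈ B.sum (λ i → ⟦ f i ⟧)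
  sum-homo {zero}  f = 0#-homo
  sum-homo {suc n} f = B.trans (+-homo _ _) (B.+-congˡ (sum-homo (λ i → f (suc i))))

  ^-homo : ∀ x n → ⟦ x A.^ n ⟧ B.≈ ⟦ x ⟧ B.^ n
  ^-homo x zero    = 1#-homo
  ^-homo x (suc n) = B.trans (*-homo _ _) (B.*-congˡ (^-homo x n))

  ∣-homo : ∀ {x y} → x A.∣ y → ⟦ x ⟧ B.∣ ⟦ y ⟧
  ∣-homo (q A., e) = ⟦ q ⟧ B., B.trans (B.sym (*-homo _ _)) (⟦⟧-cong e)

  det-homo : ∀ {n} (M : Fin n → Fin n → A.Carrier) →
             ⟦ Determinant.det A M ⟧ B.≈ Determinant.det B (λ i j → ⟦ M i j ⟧)
  det-homo {zero}  M = 1#-homo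
  det-homo {suc n} M = B.trans (sum-homo term) (B.sum-cong λ j →
    B.trans (*-homo _ _) (B.*-cong (B.trans (^-homo (A.- A.1#) (toℕ j))
        (B.^-congˡ (toℕ j) (B.trans (-‿homo _) (B.-‿cong 1#-homo))))
      (B.trans (*-homo (M zero j) _) (B.*-congˡ {⟦ M zero j ⟧} (det-homo (λ i k → M (suc i) (punchIn j k)))))))
    where
    term : Fin (suc n) → A.Carrier
    term j = (A.- A.1#) A.^ toℕ j A.* (M zero j A.* Determinant.det A (λ i k → M (suc i) (punchIn j k)))

-- Determinants: linearity, alternation, Cramer's rule

module DeterminantProperties (R : CommutativeRing c ℓ) where

  open Ring R
  open IntegerSolver R
  open Determinant R

  Matrix : ℕ → Set c
  Matrix n = Fin n → Fin n → Carrier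

  private
    minor : ∀ {n} → Matrix (suc n) → Fin (suc n) → Matrix n
    minor M j i k = M (suc i) (punchIn j k)

    sign : ∀ {n} → Fin n → Carrier
    sign j = (- 1#) ^ toℕ j

  det-cong : ∀ {n} {M N : Matrix n} → (∀ i j → M i j ≈ N i j) → det M ≈ det N
  det-cong {zero}  e = refl
  det-cong {suc n} e = sum-cong λ j → *-congˡ {sign j} (*-cong (e zero j) (det-cong λ i k → e (suc i) (punchIn j k)))

  -- Induction along the first row: in the term of column `j` the entry splits and the minors agree,
  -- in any other term the minor is linear in the renumbered column `j′`. The scalar on `M₁` alone
  -- lets one statement cover additivity and homogeneity.
  det-linear : ∀ {n} (j : Fin n) t {M M₁ M₂ : Matrix n} →
               (∀ i → M i j ≈ t * M₁ i j + M₂ i j) →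
               (∀ i l → l ≢ j → M₁ i l ≈ M i l) → (∀ i l → l ≢ j → M₂ i l ≈ M i l) →
               det M ≈ t * det M₁ + det M₂
  det-linear {suc n} j t {M} {M₁} {M₂} col off₁ off₂ = begin
    sum (term M)                                   ≈⟨ sum-cong step ⟩
    sum (λ l → t * term M₁ l + term M₂ l)          ≈⟨ ∑-distrib-+ (λ l → t * term M₁ l) (term M₂) ⟩
    sum (λ l → t * term M₁ l) + sum (term M₂)      ≈⟨ +-congʳ (sym (*-distribˡ-sum t (term M₁))) ⟩
    t * sum (term M₁) + sum (term M₂)              ∎
    where
    term : Matrix (suc n) → Fin (suc n) → Carrier
    term M l = sign l * (M zero l * det (minor M l))
    step : ∀ l → term M l ≈ t * term M₁ l + term M₂ l
    step l with l Fin.≟ j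
    ... | yes ≡.refl = begin
      sign j * (M zero j * det (minor M j))
        ≈⟨ *-congˡ (*-congʳ (col zero)) ⟩
      sign j * ((t * M₁ zero j + M₂ zero j) * det (minor M j))
        ≈⟨ solve 5 (λ s t a b m → s :* ((t :* a :+ b) :* m) := t :* (s :* (a :* m)) :+ s :* (b :* m)) refl
             (sign j) t (M₁ zero j) (M₂ zero j) (det (minor M j)) ⟩
      t * (sign j * (M₁ zero j * det (minor M j))) + sign j * (M₂ zero j * det (minor M j))
        ≈⟨ sym (+-cong (*-congˡ {t} (*-congˡ {sign j} (*-congˡ {M₁ zero j} (det-cong λ i k → off₁ _ _ (Fin.punchInᵢ≢i j k)))))
                  (*-congˡ {sign j} (*-congˡ {M₂ zero j} (det-cong λ i k → off₂ _ _ (Fin.punchInᵢ≢i j k))))) ⟩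
      t * term M₁ j + term M₂ j ∎
    ... | no l≢j = begin
      sign l * (M zero l * det (minor M l))
        ≈⟨ *-congˡ {sign l} (*-congˡ {M zero l} (det-linear j′ t {minor M l} {minor M₁ l} {minor M₂ l}
             (λ i → ≡.subst (λ p → M (suc i) p ≈ t * M₁ (suc i) p + M₂ (suc i) p) (≡.sym j′-eq) (col (suc i)))
             (λ i k k≢ → off₁ (suc i) _ (away k k≢)) (λ i k k≢ → off₂ (suc i) _ (away k k≢)))) ⟩
      sign l * (M zero l * (t * det (minor M₁ l) + det (minor M₂ l)))
        ≈⟨ solve 5 (λ s t a b m → s :* (m :* (t :* a :+ b)) := t :* (s :* (m :* a)) :+ s :* (m :* b)) refl
             (sign l) t (det (minor M₁ l)) (det (minor M₂ l)) (M zero l) ⟩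
      t * (sign l * (M zero l * det (minor M₁ l))) + sign l * (M zero l * det (minor M₂ l))
        ≈⟨ sym (+-cong (*-congˡ {t} (*-congˡ {sign l} (*-congʳ (off₁ zero l l≢j))))
            (*-congˡ {sign l} (*-congʳ (off₂ zero l l≢j)))) ⟩
      t * term M₁ l + term M₂ l ∎
      where
      j′ = punchOut l≢j
      j′-eq : punchIn l j′ ≡ j
      j′-eq = Fin.punchIn-punchOut l≢j
      away : ∀ k → k ≢ j′ → punchIn l k ≢ j
      away k k≢ e = k≢ (Fin.punchIn-injective l k j′ (≡.trans e (≡.sym j′-eq)))

  private
    sum-pair : ∀ {n} (j : Fin n) (f : Fin (suc n) → Carrier) → f (inject₁ j) + f (suc j) ≈ 0# →
               (∀ l → l ≢ inject₁ j → l ≢ suc j → f l ≈ 0#) → sum f ≈ 0#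
    sum-pair zero    f e z = trans (sym (+-assoc _ _ _)) (trans (+-cong e
      (sum-zero (λ l → z (suc (suc l)) (λ ()) (λ ())))) (+-identityʳ _))
    sum-pair (suc j) f e z = trans (+-cong (z zero (λ ()) (λ ()))
      (sum-pair j (λ l → f (suc l)) e (λ l p q → z (suc l) (λ r → p (Fin.suc-injective r)) (λ r → q (Fin.suc-injective r)))))
      (+-identityʳ _)

    -- Deleting one of two neighbouring columns or the other gives enumerations that differ in a
    -- single position, where each shows the neighbour that it kept.
    punchIn-adjacent : ∀ {n} (j : Fin n) k → punchIn (inject₁ j) k ≢ punchIn (suc j) k →
                       punchIn (inject₁ j) k ≡ suc j × punchIn (suc j) k ≡ inject₁ j
    punchIn-adjacent zero    zero    ne = ≡.refl , ≡.refl
    punchIn-adjacent zero    (suc k) ne = ⊥-elim (ne ≡.refl)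
    punchIn-adjacent (suc j) zero    ne = ⊥-elim (ne ≡.refl)
    punchIn-adjacent (suc j) (suc k) ne with punchIn-adjacent j k (λ e → ne (≡.cong suc e))
    ... | e , f = ≡.cong suc e , ≡.cong suc f

    adjacent-preimage : ∀ {n} (l : Fin (suc (suc n))) (j : Fin (suc n)) → l ≢ inject₁ j → l ≢ suc j →
                        ∃[ i ] punchIn l (inject₁ i) ≡ inject₁ j × punchIn l (suc i) ≡ suc j
    adjacent-preimage zero          zero    p q = ⊥-elim (p ≡.refl)
    adjacent-preimage zero          (suc j) p q = j , ≡.refl , ≡.refl
    adjacent-preimage (suc zero)    zero    p q = ⊥-elim (q ≡.refl)
    adjacent-preimage {suc n} (suc (suc l)) zero p q = zero , ≡.refl , ≡.refl
    adjacent-preimage {suc n} (suc l) (suc j) p q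
      with adjacent-preimage l j (λ e → p (≡.cong suc e)) (λ e → q (≡.cong suc e))
    ... | i , e , f = suc i , ≡.cong suc e , ≡.cong suc f

  -- In the first-row expansion the two equal columns have equal minors and opposite signs. Every
  -- other minor still contains the two columns side by side, so it vanishes by induction.
  det-adjacent : ∀ {n} (M : Matrix (suc n)) (j : Fin n) → (∀ i → M i (inject₁ j) ≈ M i (suc j)) → det M ≈ 0#
  det-adjacent {suc n} M j eq = sum-pair j (λ l → sign l * (M zero l * det (minor M l))) cancel others
    where
    minors : det (minor M (inject₁ j)) ≈ det (minor M (suc j))
    minors = det-cong λ i k → same i k
      where
      same : ∀ i k → M (suc i) (punchIn (inject₁ j) k) ≈ M (suc i) (punchIn (suc j) k)
      same i k with punchIn (inject₁ j) k Fin.≟ punchIn (suc j) k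
      ... | yes e = reflexive (≡.cong (M (suc i)) e)
      ... | no ne with punchIn-adjacent j k ne
      ... | e , f = trans (reflexive (≡.cong (M (suc i)) e)) (trans (sym (eq (suc i))) (reflexive (≡.cong (M (suc i)) (≡.sym f))))
    cancel : sign (inject₁ j) * (M zero (inject₁ j) * det (minor M (inject₁ j))) + sign (suc j) *
        (M zero (suc j) * det (minor M (suc j))) ≈ 0#
    cancel = begin
      sign (inject₁ j) * (M zero (inject₁ j) * det (minor M (inject₁ j))) + sign (suc j) *
          (M zero (suc j) * det (minor M (suc j)))
        ≈⟨ +-cong (*-cong (reflexive (≡.cong ((- 1#) ^_) (Fin.toℕ-inject₁ j))) (*-cong (eq zero) minors)) refl ⟩
      s * y + (- 1# * s) * y  ≈⟨ solve 2 (λ s y → s :* y :+ (:- :1 :* s) :* y := :0) refl s y ⟩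
      0# ∎
      where
      s = sign j
      y = M zero (suc j) * det (minor M (suc j))
    others : ∀ l → l ≢ inject₁ j → l ≢ suc j → sign l * (M zero l * det (minor M l)) ≈ 0#
    others l p q = trans (*-congˡ {sign l} (*-congˡ {M zero l} vanish)) (trans (*-congˡ {sign l} (zeroʳ _)) (zeroʳ _))
      where
      vanish : det (minor M l) ≈ 0#
      vanish with adjacent-preimage l j p q
      ... | i , e , f = det-adjacent (minor M l) i λ r → trans (reflexive (≡.cong (M (suc r)) e))
            (trans (eq (suc r)) (reflexive (≡.cong (M (suc r)) (≡.sym f))))

  setColumn : ∀ {n} → Matrix n → Fin n → (Fin n → Carrier) → Matrix n
  setColumn M j u i l with l Fin.≟ j
  ... | yes _ = u i
  ... | no  _ = M i l

  setColumn-at : ∀ {n} (M : Matrix n) j u i → setColumn M j u i j ≡ u i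
  setColumn-at M j u i with j Fin.≟ j
  ... | yes _ = ≡.refl
  ... | no  n = ⊥-elim (n ≡.refl)

  setColumn-off : ∀ {n} (M : Matrix n) j u i l → l ≢ j → setColumn M j u i l ≡ M i l
  setColumn-off M j u i l ne with l Fin.≟ j
  ... | yes e = ⊥-elim (ne e)
  ... | no  _ = ≡.refl

  setColumn-linear : ∀ {n} (M : Matrix n) j t u v →
    det (setColumn M j (λ i → t * u i + v i)) ≈ t * det (setColumn M j u) + det (setColumn M j v)
  setColumn-linear M j t u v = det-linear j t
    (λ i → reflexive (≡.trans (setColumn-at M j _ i)
      (≡.sym (≡.cong₂ (λ a b → t * a + b) (setColumn-at M j u i) (setColumn-at M j v i)))))
    (λ i l ne → reflexive (≡.trans (setColumn-off M j u i l ne) (≡.sym (setColumn-off M j _ i l ne))))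
    (λ i l ne → reflexive (≡.trans (setColumn-off M j v i l ne) (≡.sym (setColumn-off M j _ i l ne))))

  private
    Alternates : ∀ {n} → Fin n → Set _
    Alternates {n} q = ∀ p → p Fin.< q → (M : Matrix n) → (∀ i → M i p ≈ M i q) → det M ≈ 0#

    -- With x in column p and y, x in columns q, q + 1: columns x + y, x + y in
    -- the last two places give 0, and three of the four terms vanish.
    alternates-suc : ∀ {n} (q : Fin n) → Alternates (inject₁ q) → Alternates (suc q)
    alternates-suc q alt p p<q M eq with p Fin.≟ inject₁ q
    ... | yes ≡.refl = det-adjacent M q eq
    ... | no p≢ = begin
      det M                          ≈⟨ sym (det-T y x λ i l → M≈ i l) ⟩
      det (T y x)                    ≈⟨ sym (trans (+-congˡ (+-identityˡ _)) (+-identityˡ _)) ⟩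
      0# + (0# + det (T y x))
        ≈⟨ sym (+-cong (alt p p<q′ (T x x) (λ i → trans (T-off x x i p p≢ p≢suc) (trans (eq i) (sym (T-q x x i)))))
                                               (+-congʳ (det-adjacent (T y y) q (λ i → trans (T-q y y i) (sym (T-suc y y i)))))) ⟩
      det (T x x) + (det (T y y) + det (T y x))
        ≈⟨ +-cong (sym (trans (linear₁ x x x y (λ _ → refl)) (trans (+-congˡ xy≈0) (+-identityʳ _)))) (+-comm _ _) ⟩
      det (T x x+y) + (det (T y x) + det (T y y))
        ≈⟨ +-congˡ (sym (linear₁ y x x y (λ _ → refl))) ⟩
      det (T x x+y) + det (T y x+y)
        ≈⟨ sym linear₂ ⟩
      det (T x+y x+y)
        ≈⟨ det-adjacent (T x+y x+y) q (λ i → trans (T-q x+y x+y i) (sym (T-suc x+y x+y i))) ⟩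
      0#                             ∎
      where
      x y x+y : Fin _ → Carrier
      x i = M i (suc q)
      y i = M i (inject₁ q)
      x+y i = 1# * x i + y i
      T : (Fin _ → Carrier) → (Fin _ → Carrier) → Matrix _
      T a b = setColumn (setColumn M (inject₁ q) a) (suc q) b
      ne : inject₁ q ≢ suc q
      ne e = ℕ.1+n≢n (≡.sym (≡.trans (≡.sym (Fin.toℕ-inject₁ q)) (≡.cong toℕ e)))
      T-suc : ∀ a b i → T a b i (suc q) ≈ b i
      T-suc a b i = reflexive (setColumn-at _ (suc q) b i)
      T-q : ∀ a b i → T a b i (inject₁ q) ≈ a i
      T-q a b i = reflexive (≡.trans (setColumn-off _ (suc q) b i _ ne) (setColumn-at M (inject₁ q) a i))
      T-off : ∀ a b i l → l ≢ inject₁ q → l ≢ suc q → T a b i l ≈ M i l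
      T-off a b i l p r = reflexive (≡.trans (setColumn-off _ (suc q) b i _ r) (setColumn-off M _ a i l p))
      det-T : ∀ a b → (∀ i l → T a b i l ≈ M i l) → det (T a b) ≈ det M
      det-T a b e = det-cong e
      M≈ : ∀ i l → T y x i l ≈ M i l
      M≈ i l = split (l Fin.≟ inject₁ q) (l Fin.≟ suc q)
        where
        split : Dec (l ≡ inject₁ q) → Dec (l ≡ suc q) → T y x i l ≈ M i l
        split (yes ≡.refl) _            = T-q y x i
        split (no _)       (yes ≡.refl) = T-suc y x i
        split (no r)       (no s)       = T-off y x i l r s
      p≢suc : p ≢ suc q
      p≢suc ≡.refl = ℕ.<-irrefl ≡.refl p<q
      p<q′ : p Fin.< inject₁ q
      p<q′ = ℕ.≤∧≢⇒< (≡.subst (toℕ p ℕ.≤_) (≡.sym (Fin.toℕ-inject₁ q)) (ℕ.≤-pred p<q)) (λ e → p≢ (Fin.toℕ-injective e))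
      linear₁ : ∀ a b b′ c → (∀ i → b i ≈ b′ i) → det (T a (λ i → 1# * b i + c i)) ≈ det (T a b′) + det (T a c)
      linear₁ a b b′ c e = trans (setColumn-linear _ (suc q) 1# b c) (+-congʳ (trans (*-identityˡ _) (det-cong same)))
        where
        same : ∀ i l → T a b i l ≈ T a b′ i l
        same i l with l Fin.≟ suc q
        ... | yes _ = e i
        ... | no _  = refl
      xy≈0 : det (T x y) ≈ 0#
      xy≈0 = alt p p<q′ (T x y) (λ i → trans (T-off x y i p p≢ p≢suc) (trans (eq i) (sym (T-q x y i))))
      linear₂ : det (T x+y x+y) ≈ det (T x x+y) + det (T y x+y)
      linear₂ = trans (det-linear (inject₁ q) 1# {T x+y x+y} {T x x+y} {T y x+y}
        (λ i → trans (T-q x+y x+y i) (sym (+-cong (*-congˡ (T-q x x+y i)) (T-q y x+y i))))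
        (λ i l r → others x i l r) (λ i l r → others y i l r)) (+-congʳ (*-identityˡ _))
        where
        others : ∀ a i l → l ≢ inject₁ q → T a x+y i l ≈ T x+y x+y i l
        others a i l r with l Fin.≟ suc q
        ... | yes _ = refl
        ... | no _  = reflexive (≡.trans (setColumn-off M _ a i l r) (≡.sym (setColumn-off M _ x+y i l r)))

    alternates : ∀ {n} (q : Fin (suc n)) → Alternates q
    alternates = Fin.<-weakInduction Alternates (λ p ()) alternates-suc

  det-equalColumns : ∀ {n} (M : Matrix n) p q → p ≢ q → (∀ i → M i p ≈ M i q) → det M ≈ 0#
  det-equalColumns {suc n} M p q p≢q eq with Fin.<-cmp p q
  ... | tri< p<q _ _ = alternates q p p<q M eq
  ... | tri≈ _ p≡q _ = ⊥-elim (p≢q p≡q)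
  ... | tri> _ _ q<p = alternates p q q<p M (λ i → sym (eq i))

  -- Cramer's rule: replacing column `j` by the combination of all columns with coefficients `v`
  -- multiplies the determinant by `v j`, and this combination is zero. Over a ring nothing can be
  -- cancelled, so the factor `v j` stays.
  kernel⇒det≈0 : ∀ {n} (M : Matrix n) (v : Fin n → Carrier) → (∀ i → sum (λ l → v l * M i l) ≈ 0#) →
                 ∀ j → v j * det M ≈ 0#
  kernel⇒det≈0 {n} M v ker j = begin
    v j * det M                                        ≈⟨ *-congˡ (det-cong λ i l → sym (column-j i l)) ⟩
    v j * det (setColumn M j (column j))
      ≈⟨ sym (sum-single j λ l l≢j → trans (*-congˡ {v l}
           (det-equalColumns _ l j l≢j λ i → reflexive (≡.trans
           (setColumn-off M j (column l) i l l≢j) (≡.sym (setColumn-at M j (column l) i)))))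
           (zeroʳ _)) ⟩
    sum (λ l → v l * det (setColumn M j (column l)))   ≈⟨ sym (linear-sum n v column) ⟩
    det (setColumn M j (λ i → sum (λ l → v l * M i l))) ≈⟨ zero-column (λ i → ker i) ⟩
    0#                                                 ∎
    where
    column : Fin n → Fin n → Carrier
    column l i = M i l
    column-j : ∀ i l → setColumn M j (column j) i l ≈ M i l
    column-j i l with l Fin.≟ j
    ... | yes ≡.refl = refl
    ... | no _ = refl
    zero-column : ∀ {u} → (∀ i → u i ≈ 0#) → det (setColumn M j u) ≈ 0#
    -- A zero column equals minus itself plus itself, so linearity with factor - 1 and three equal
    -- matrices yields - det + det.
    zero-column {u} e = trans (det-linear j (- 1#) {setColumn M j u} {setColumn M j u} {setColumn M j u}
        (λ i → let z = trans (reflexive (setColumn-at M j u i)) (e i) in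
          trans z (sym (trans (+-cong (*-congˡ z) z) (trans (+-identityʳ _) (zeroʳ _)))))
        (λ _ _ _ → refl) (λ _ _ _ → refl))
      (trans (+-congʳ (-1*x≈-x _)) (-‿inverseˡ _))
    linear-sum : ∀ m (t : Fin m → Carrier) (u : Fin m → Fin n → Carrier) →
      det (setColumn M j (λ i → sum (λ l → t l * u l i))) ≈ sum (λ l → t l * det (setColumn M j (u l)))
    linear-sum zero    t u = zero-column (λ _ → refl)
    linear-sum (suc m) t u = trans (setColumn-linear M j (t zero) (u zero) _)
      (+-congˡ (linear-sum m (λ l → t (suc l)) (λ l → u (suc l))))

-- Linear algebra over a field with decidable equality

module FieldLinearAlgebra (F : CommutativeRing c ℓ) (isField : IsField F)
                          (_≟_ : Decidable (CommutativeRing._≈_ F)) where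

  open Ring F
  open IntegerSolver F
  open IsField isField

  *-nonZero : ∀ {x y} → ¬ x ≈ 0# → x * y ≈ 0# → y ≈ 0#
  *-nonZero {x} {y} x≉0 e with inverse x x≉0
  ... | r , xr≈1 = begin
    y              ≈⟨ sym (trans (*-congʳ xr≈1) (*-identityˡ y)) ⟩
    x * r * y      ≈⟨ solve 3 (λ x r y → x :* r :* y := r :* (x :* y)) refl x r y ⟩
    r * (x * y)    ≈⟨ trans (*-congˡ e) (zeroʳ r) ⟩
    0#             ∎

  Dependent : ∀ {m n} → (Fin m → Fin n → Carrier) → Set _
  Dependent {m} u = Σ[ v ∈ (Fin m → Carrier) ] (∃[ j ] ¬ v j ≈ 0#) × (∀ i → sum (λ j → v j * u j i) ≈ 0#)

  private
    -- Gaussian elimination: multiples of the pivot vector `u p` clear coordinate zero of the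
    -- others. A relation `w` among the results lifts to `u` once `u p` receives all the multiples
    -- used, weighted by `w`.
    eliminate : ∀ {n} (u : Fin (suc (suc n)) → Fin (suc n) → Carrier) p r → u p zero * r ≈ 1# →
                Dependent {suc n} {n} (λ k i → u (punchIn p k) (suc i) + - (u (punchIn p k) zero * r) * u p (suc i)) →
                Dependent u
    eliminate {n} u p r inv (w , (j , w≉0) , rel′) =
      v , (punchIn p j , λ e → w≉0 (trans (sym (v-in j)) e)) , rel
      where
      s : Fin (suc n) → Carrier
      s k = - (u (punchIn p k) zero * r)
      v : Fin (suc (suc n)) → Carrier
      v = insertAt w p (sum (λ k → w k * s k))
      v-at : v p ≈ sum (λ k → w k * s k)
      v-at = reflexive (Vector.insertAt-lookup w p _)
      v-in : ∀ k → v (punchIn p k) ≈ w k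
      v-in k = reflexive (Vector.insertAt-punchIn w p _ k)
      collect : ∀ w s a b → w * s * a + w * b ≈ w * (b + s * a)
      collect = solve 4 (λ w s a b → w :* s :* a :+ w :* b := w :* (b :+ s :* a)) refl
      cancel : ∀ w a r p → w * (a + - (a * r) * p) ≈ w * (a * (1# - p * r))
      cancel = solve 4 (λ w a r p → w :* (a :+ (:- (a :* r)) :* p) := w :* (a :* (:1 :- p :* r))) refl
      combine : ∀ i → sum (λ j → v j * u j i) ≈ sum (λ k → w k * (u (punchIn p k) i + s k * u p i))
      combine i = begin
        sum (λ j → v j * u j i)
          ≈⟨ sum-remove {i = p} (λ j → v j * u j i) ⟩
        v p * u p i + sum (λ k → v (punchIn p k) * u (punchIn p k) i)
          ≈⟨ +-cong (trans (*-congʳ v-at) (*-distribʳ-sum (u p i) (λ k → w k * s k)))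
                    (sum-cong λ k → *-congʳ {u (punchIn p k) i} (v-in k)) ⟩
        sum (λ k → w k * s k * u p i) + sum (λ k → w k * u (punchIn p k) i)
          ≈⟨ sym (∑-distrib-+ (λ k → w k * s k * u p i) (λ k → w k * u (punchIn p k) i)) ⟩
        sum (λ k → w k * s k * u p i + w k * u (punchIn p k) i)
          ≈⟨ sum-cong (λ k → collect (w k) (s k) (u p i) (u (punchIn p k) i)) ⟩
        sum (λ k → w k * (u (punchIn p k) i + s k * u p i)) ∎
      rel : ∀ i → sum (λ j → v j * u j i) ≈ 0#
      rel (suc i) = trans (combine (suc i)) (rel′ i)
      rel zero    = trans (combine zero) (sum-zero λ k → vanish (w k) (u (punchIn p k) zero))
        where
        vanish : ∀ w a → w * (a + - (a * r) * u p zero) ≈ 0#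
        vanish w a = begin
          w * (a + - (a * r) * u p zero)    ≈⟨ cancel w a r (u p zero) ⟩
          w * (a * (1# - u p zero * r))     ≈⟨ *-congˡ (*-congˡ (x≈y⇒x∙y⁻¹≈ε (sym inv))) ⟩
          w * (a * 0#)                      ≈⟨ trans (*-congˡ (zeroʳ a)) (zeroʳ w) ⟩
          0#                                ∎

    -- If coordinate zero is void, it can be forgotten; the induction hypothesis then wants one
    -- vector less, and `u zero` is dropped by giving it coefficient zero.
    extend : ∀ {n} (u : Fin (suc (suc n)) → Fin (suc n) → Carrier) → (∀ j → u j zero ≈ 0#) →
             Dependent {suc n} {n} (λ j i → u (suc j) (suc i)) → Dependent u
    extend {n} u col (w , (j , w≉0) , rel′) = v , (suc j , w≉0) , rel
      where
      v : Fin (suc (suc n)) → Carrier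
      v zero    = 0#
      v (suc j) = w j
      rel : ∀ i → sum (λ j → v j * u j i) ≈ 0#
      rel zero    = sum-zero λ j → trans (*-congˡ {v j} (col j)) (zeroʳ _)
      rel (suc i) = trans (+-congʳ (zeroˡ _)) (trans (+-identityˡ _) (rel′ i))

  dependent : ∀ n (u : Fin (suc n) → Fin n → Carrier) → Dependent u
  dependent zero    u = (λ _ → 1#) , (zero , λ e → 0≉1 (sym e)) , λ ()
  dependent (suc n) u with Fin.any? (λ j → ¬? (u j zero ≟ 0#))
  ... | no none = extend u (λ j → decidable-stable (u j zero ≟ 0#) λ ne → none (j , ne)) (dependent n (λ j i → u (suc j) (suc i)))
  ... | yes (p , up≉0) = let (r , inv) = inverse _ up≉0 in eliminate u p r inv
      (dependent n (λ k i → u (punchIn p k) (suc i) + - (u (punchIn p k) zero * r) * u p (suc i)))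

  -- The rows of `W` together with `e` are n + 1 vectors in dimension n. In a relation between them
  -- the coefficient of `e` cannot vanish, since the rows alone are independent, so the relation can
  -- be solved for `e`.
  nondegenerate⇒surjective : ∀ n (W : Fin n → Fin n → Carrier) →
    (∀ v → (∀ j → sum (λ i → v i * W i j) ≈ 0#) → ∀ i → v i ≈ 0#) →
    ∀ e → Σ[ v ∈ (Fin n → Carrier) ] ∀ j → sum (λ i → v i * W i j) ≈ e j
  nondegenerate⇒surjective n W nondegenerate e = v , solves
    where
    u : Fin (suc n) → Fin n → Carrier
    u zero    = e
    u (suc i) = W i
    dep = dependent n u
    a = proj₁ dep
    rel = proj₂ (proj₂ dep)
    tail : ∀ j → a zero * e j + sum (λ i → a (suc i) * W i j) ≈ 0#
    tail = rel
    a₀≉0 : ¬ a zero ≈ 0#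
    a₀≉0 a₀≈0 = proj₂ (proj₁ (proj₂ dep)) (all (proj₁ (proj₁ (proj₂ dep))))
      where
      all : ∀ i → a i ≈ 0#
      all zero    = a₀≈0
      all (suc i) = nondegenerate (λ i → a (suc i))
        (λ j → trans (sym (trans (+-congʳ (trans (*-congʳ a₀≈0) (zeroˡ _))) (+-identityˡ _))) (rel j)) i
    r = proj₁ (inverse _ a₀≉0)
    v : Fin n → Carrier
    v i = - r * a (suc i)
    solves : ∀ j → sum (λ i → v i * W i j) ≈ e j
    solves j = begin
      sum (λ i → - r * a (suc i) * W i j)
        ≈⟨ sum-cong (λ i → *-assoc (- r) (a (suc i)) (W i j)) ⟩
      sum (λ i → - r * (a (suc i) * W i j))
        ≈⟨ sym (*-distribˡ-sum (- r) (λ i → a (suc i) * W i j)) ⟩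
      - r * s
        ≈⟨ solve 4 (λ r s a e → (:- r) :* s := a :* r :* e :- r :* (a :* e :+ s)) refl r s (a zero) (e j) ⟩
      a zero * r * e j - r * (a zero * e j + s)
        ≈⟨ +-cong (trans (*-congʳ (proj₂ (inverse _ a₀≉0))) (*-identityˡ _))
             (trans (-‿cong (trans (*-congˡ (rel j)) (zeroʳ r))) -0#≈0#) ⟩
      e j + 0#                                                    ≈⟨ +-identityʳ _ ⟩
      e j                                                         ∎
      where s = sum (λ i → a (suc i) * W i j)

  -- If the columns x_j are dependent, so are the columns of the Gram matrix;
  -- otherwise v is a combination of them, and this combination is a relation.
  degenerate⇒gram-det≈0 : ∀ {n} (W : Fin n → Fin n → Carrier) (v : Fin n → Carrier) (p : Fin n) → ¬ v p ≈ 0# →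
    (∀ i → sum (λ j → v j * W i j) ≈ 0#) → (x : Fin n → Fin n → Carrier) →
    Determinant.det F (λ i j → sum (λ k → sum (λ l → x i k * (x j l * W k l)))) ≈ 0#
  degenerate⇒gram-det≈0 {n} W v p vp≉0 ker x = *-nonZero aq≉0 (kernel⇒det≈0 G (λ j → a (suc j)) gram-kernel q)
    where
    open DeterminantProperties F
    G : Matrix n
    G i j = sum (λ k → sum (λ l → x i k * (x j l * W k l)))
    u : Fin (suc n) → Fin n → Carrier
    u zero    = v
    u (suc i) = x i
    dep = dependent n u
    a = proj₁ dep
    rel = proj₂ (proj₂ dep)
    nonZero : ∃[ q ] ¬ a (suc q) ≈ 0#
    nonZero with Fin.any? (λ q → ¬? (a (suc q) ≟ 0#))
    ... | yes found = found
    ... | no  none  = ⊥-elim (vp≉0 (*-nonZero (a₀≉0 (proj₁ (proj₂ dep))) (begin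
        a zero * v p                                     ≈⟨ sym (+-identityʳ _) ⟩
        a zero * v p + 0#
          ≈⟨ +-congˡ (sym (sum-zero λ j → trans (*-congʳ {x j p} (vanish j)) (zeroˡ _))) ⟩
        a zero * v p + sum (λ j → a (suc j) * x j p)     ≈⟨ rel p ⟩
        0#                                               ∎)))
      where
      vanish : ∀ j → a (suc j) ≈ 0#
      vanish j = decidable-stable (a (suc j) ≟ 0#) λ ne → none (j , ne)
      a₀≉0 : (∃[ j ] ¬ a j ≈ 0#) → ¬ a zero ≈ 0#
      a₀≉0 (zero  , ne) = ne
      a₀≉0 (suc j , ne) = ⊥-elim (ne (vanish j))
    q = proj₁ nonZero
    aq≉0 = proj₂ nonZero
    gram-kernel : ∀ i → sum (λ j → a (suc j) * G i j) ≈ 0#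
    gram-kernel i = begin
      sum (λ j → a (suc j) * G i j)
        ≈⟨ sum-cong (λ j → *-congˡ {a (suc j)} (∑-comm (λ k l → x i k * (x j l * W k l)))) ⟩
      sum (λ j → a (suc j) * sum (λ l → sum (λ k → x i k * (x j l * W k l))))
        ≈⟨ sum-cong (λ j → *-congˡ {a (suc j)} (sum-cong λ l → trans
             (sum-cong λ k → solve 3 (λ a b w → a :* (b :* w) := b :* (a :* w)) refl (x i k) (x j l) (W k l))
             (sym (*-distribˡ-sum (x j l) (λ k → x i k * W k l))))) ⟩
      sum (λ j → a (suc j) * sum (λ l → x j l * y l))
        ≈⟨ sum-cong (λ j → trans (*-distribˡ-sum (a (suc j)) (λ l → x j l * y l))
            (sum-cong λ l → sym (*-assoc (a (suc j)) (x j l) (y l)))) ⟩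
      sum (λ j → sum (λ l → a (suc j) * x j l * y l))
        ≈⟨ ∑-comm (λ j l → a (suc j) * x j l * y l) ⟩
      sum (λ l → sum (λ j → a (suc j) * x j l * y l))
        ≈⟨ sum-cong (λ l → trans (sym (*-distribʳ-sum (y l) (λ j → a (suc j) * x j l))) (*-congʳ {y l} (sum≈ l))) ⟩
      sum (λ l → - a zero * v l * y l)
        ≈⟨ sum-cong (λ l → *-assoc (- a zero) (v l) (y l)) ⟩
      sum (λ l → - a zero * (v l * y l))
        ≈⟨ sym (*-distribˡ-sum (- a zero) (λ l → v l * y l)) ⟩
      - a zero * sum (λ l → v l * y l)
        ≈⟨ *-congˡ vy≈0 ⟩
      - a zero * 0#  ≈⟨ zeroʳ _ ⟩
      0# ∎
      where
      y : Fin n → Carrier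
      y l = sum (λ k → x i k * W k l)
      sum≈ : ∀ l → sum (λ j → a (suc j) * x j l) ≈ - a zero * v l
      sum≈ l = begin
        s                                         ≈⟨ solve 2 (λ s t → s := (t :+ s) :- t) refl s (a zero * v l) ⟩
        (a zero * v l + s) - a zero * v l         ≈⟨ trans (+-congʳ (rel l)) (+-identityˡ _) ⟩
        - (a zero * v l)                          ≈⟨ -‿distribˡ-* _ _ ⟩
        - a zero * v l                            ∎
        where s = sum (λ j → a (suc j) * x j l)
      vy≈0 : sum (λ l → v l * y l) ≈ 0#
      vy≈0 = begin
        sum (λ l → v l * y l)
          ≈⟨ sum-cong (λ l → trans (*-distribˡ-sum (v l) (λ k → x i k * W k l))
               (sum-cong λ k → solve 3 (λ v x w → v :* (x :* w) := x :* (v :* w)) refl (v l) (x i k) (W k l))) ⟩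
        sum (λ l → sum (λ k → x i k * (v l * W k l)))
          ≈⟨ ∑-comm (λ l k → x i k * (v l * W k l)) ⟩
        sum (λ k → sum (λ l → x i k * (v l * W k l)))
          ≈⟨ sum-zero (λ k → trans (sym (*-distribˡ-sum (x i k) (λ l → v l * W k l)))
              (trans (*-congˡ {x i k} (ker k)) (zeroʳ _))) ⟩
        0# ∎

  -- A nonzero column of M lies in its kernel; dividing it out leaves a smaller
  -- matrix with square zero and the same trace.
  square≈0⇒trace≈0 : ∀ n (M : Fin n → Fin n → Carrier) →
    (∀ i k → sum (λ l → M i l * M l k) ≈ 0#) → sum (λ i → M i i) ≈ 0#
  square≈0⇒trace≈0 zero    M M²≈0 = refl
  square≈0⇒trace≈0 (suc n) M M²≈0 with Fin.any? (λ i → Fin.any? (λ k → ¬? (M i k ≟ 0#)))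
  ... | no none = sum-zero λ i → decidable-stable (M i i ≟ 0#) λ ne → none (i , i , ne)
  ... | yes (i , k , Mik≉0) = begin
    sum (λ j → M j j)
      -- The traces of `M` and `N` differ by a multiple of the entry (i, k) of M², which is zero.
      ≈⟨ sym (trans (+-congˡ (trans (*-congˡ (M²≈0 i k)) (zeroʳ _))) (+-identityʳ _)) ⟩
    sum (λ j → M j j) + - r * sum (λ l → M i l * M l k)       ≈⟨ +-congˡ (*-distribˡ-sum (- r) (λ l → M i l * M l k)) ⟩
    sum (λ j → M j j) + sum (λ l → - r * (M i l * M l k))
      ≈⟨ sym (∑-distrib-+ (λ j → M j j) (λ l → - r * (M i l * M l k))) ⟩
    sum (λ j → M j j + - r * (M i j * M j k))
      ≈⟨ sum-cong (λ j → +-congˡ {M j j} (solve 3 (λ r a b → (:- r) :* (a :* b) := (:- (b :* r)) :* a) refl r (M i j) (M j k))) ⟩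
    sum (λ j → N j j)                                         ≈⟨ sum-remove {i = i} (λ j → N j j) ⟩
    N i i + sum (λ j → N (punchIn i j) (punchIn i j))         ≈⟨ +-congʳ (N-i i) ⟩
    0# + sum (λ j → N (punchIn i j) (punchIn i j))
      ≈⟨ trans (+-identityˡ _)
           (square≈0⇒trace≈0 n (λ j l → N (punchIn i j) (punchIn i l)) N²′) ⟩
    0#                                                        ∎
    where
    r = proj₁ (inverse _ Mik≉0)
    inv = proj₂ (inverse _ Mik≉0)
    N : Fin (suc n) → Fin (suc n) → Carrier
    N j l = M j l + - (M j k * r) * M i l
    N-i : ∀ l → N i l ≈ 0#
    N-i l = begin
      M i l + - (M i k * r) * M i l    ≈⟨ +-congˡ (*-congʳ (-‿cong inv)) ⟩
      M i l + - 1# * M i l             ≈⟨ trans (+-congˡ (-1*x≈-x _)) (-‿inverseʳ _) ⟩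
      0#                               ∎
    N² : ∀ j s → sum (λ l → N j l * N l s) ≈ 0#
    N² j s = begin
      sum (λ l → N j l * N l s)
        ≈⟨ sum-cong (λ l → expand (M j l) (M j k * r) (M i l) (M l s) (M l k) (M i s)) ⟩
      sum (λ l → (1# * (M j l * M l s) + - r * M i s * (M j l * M l k)) +
          (- (M j k * r) * (M i l * M l s) + M j k * r * (r * M i s) * (M i l * M l k)))
        ≈⟨ trans (∑-distrib-+ (λ l → 1# * (M j l * M l s) + - r * M i s * (M j l * M l k))
                                   (λ l → - (M j k * r) * (M i l * M l s) + M j k * r * (r * M i s) * (M i l * M l k)))
             (+-cong (trans (∑-distrib-+ (λ l → 1# * (M j l * M l s)) (λ l → - r * M i s * (M j l * M l k)))
                 (+-cong (kill 1# j s) (kill (- r * M i s) j k)))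
                     (trans (∑-distrib-+ (λ l → - (M j k * r) * (M i l * M l s))
                         (λ l → M j k * r * (r * M i s) * (M i l * M l k)))
                            (+-cong (kill (- (M j k * r)) i s) (kill (M j k * r * (r * M i s)) i k)))) ⟩
      (0# + 0#) + (0# + 0#)  ≈⟨ trans (+-cong (+-identityˡ _) (+-identityˡ _)) (+-identityˡ _) ⟩
      0#                     ∎
      where
      expand : ∀ a p b c d e → (a + - p * b) * (c + - (d * r) * e) ≈
               (1# * (a * c) + - r * e * (a * d)) + (- p * (b * c) + p * (r * e) * (b * d))
      expand a p b c d e = trans (*-congˡ (+-congˡ (solve 3 (λ d r e → (:- (d :* r)) :* e := d :* ((:- r) :* e)) refl d r e)))
        (trans (distribʳ _ _ _) (+-cong
          (solve 4 (λ a c d f → a :* (c :+ d :* f) := :1 :* (a :* c) :+ f :* (a :* d)) refl a c d (- r * e))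
          (trans (*-congˡ (+-congˡ (*-congˡ (sym (-‿distribˡ-* r e)))))
            (solve 5 (λ p b c d g → (:- p) :* b :* (c :+ d :* (:- g)) := (:- p) :* (b :* c) :+ p :* g :*
                (b :* d)) refl p b c d (r * e)))))
      kill : ∀ t a b → sum (λ l → t * (M a l * M l b)) ≈ 0#
      kill t a b = trans (sym (*-distribˡ-sum t (λ l → M a l * M l b))) (trans (*-congˡ (M²≈0 a b)) (zeroʳ t))
    N²′ : ∀ j s → sum (λ l → N (punchIn i j) (punchIn i l) * N (punchIn i l) (punchIn i s)) ≈ 0#
    N²′ j s = trans (sym (+-identityˡ _)) (trans (+-congʳ (sym (trans (*-congˡ {N (punchIn i j) i} (N-i _)) (zeroʳ _))))
      (trans (sym (sum-remove {i = i} (λ l → N (punchIn i j) l * N l (punchIn i s)))) (N² _ _)))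

-- Polynomials with many roots over a ring

module Roots (R : CommutativeRing c ℓ) where

  open Ring R
  open IntegerSolver R

  evaluate : ∀ {n} → (Fin n → Carrier) → Carrier → Carrier
  evaluate a x = sum (λ i → a i * x ^ toℕ i)

  evaluate-suc : ∀ {n} (a : Fin (suc n) → Carrier) x →
                 evaluate a x ≈ a zero + x * evaluate (λ i → a (suc i)) x
  evaluate-suc a x = +-cong (*-identityʳ _) (trans
    (sum-cong λ i → solve 3 (λ a x y → a :* (x :* y) := x :* (a :* y)) refl (a (suc i)) x (x ^ toℕ i))
    (sym (*-distribˡ-sum x (λ i → a (suc i) * x ^ toℕ i))))

  evaluate-init : ∀ {n} (a : Fin (suc n) → Carrier) x →
                  evaluate a x ≈ evaluate (λ i → a (inject₁ i)) x + a (fromℕ n) * x ^ n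
  evaluate-init {n} a x = trans (SemiringSum.sum-init-last semiring (λ i → a i * x ^ toℕ i))
    (+-cong (sum-cong λ i → *-congˡ {a (inject₁ i)} (reflexive (≡.cong (x ^_) (Fin.toℕ-inject₁ i))))
            (*-congˡ (reflexive (≡.cong (x ^_) (Fin.toℕ-fromℕ n)))))

  -- Synthetic division of a(X) - a(b) by X - b: the coefficients of the quotient are the values at
  -- `b` of the successive tails of `a`.
  dividedDifference : ∀ {n} → (Fin (suc n) → Carrier) → Carrier → Fin n → Carrier
  dividedDifference a b zero    = evaluate (λ i → a (suc i)) b
  dividedDifference a b (suc i) = dividedDifference (λ i → a (suc i)) b i

  -- Division by a monic linear factor keeps the leading coefficient; its invertibility thus
  -- survives the induction in `unitTop`.
  dividedDifference-top : ∀ n (a : Fin (suc (suc n)) → Carrier) b → dividedDifference a b (fromℕ n) ≈ a (fromℕ (suc n))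
  dividedDifference-top zero    a b = trans (+-identityʳ _) (*-identityʳ _)
  dividedDifference-top (suc n) a b = dividedDifference-top n (λ i → a (suc i)) b

  evaluate-dividedDifference : ∀ {n} (a : Fin (suc n) → Carrier) b x →
                      evaluate a x - evaluate a b ≈ (x - b) * evaluate (dividedDifference a b) x
  evaluate-dividedDifference {zero}  a b x = solve 3 (λ a x b → (a :* :1 :+ :0) :- (a :* :1 :+ :0) :=
      (x :- b) :* :0) refl (a zero) x b
  evaluate-dividedDifference {suc n} a b x = begin
    evaluate a x - evaluate a b                   ≈⟨ +-cong (evaluate-suc a x) (-‿cong (evaluate-suc a b)) ⟩
    (a zero + x * ex) - (a zero + b * eb)
      ≈⟨ solve 5 (λ a x e b f → (a :+ x :* e) :- (a :+ b :* f) := (x :- b) :* f :+ x :* (e :- f)) refl (a zero) x ex b eb ⟩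
    (x - b) * eb + x * (ex - eb)                  ≈⟨ +-congˡ (*-congˡ (evaluate-dividedDifference a′ b x)) ⟩
    (x - b) * eb + x * ((x - b) * eq)
      ≈⟨ solve 4 (λ x b f q → (x :- b) :* f :+ x :* ((x :- b) :* q) := (x :- b) :* (f :+ x :* q)) refl x b eb eq ⟩
    (x - b) * (eb + x * eq)                       ≈⟨ *-congˡ (sym (evaluate-suc (dividedDifference a b) x)) ⟩
    (x - b) * evaluate (dividedDifference a b) x           ∎
    where
    a′ : Fin (suc n) → Carrier
    a′ i = a (suc i)
    ex = evaluate a′ x
    eb = evaluate a′ b
    eq = evaluate (dividedDifference a′ b) x

  module _ (t : Carrier) where

    -- This is the vanishing of `y` in the localization R[1/t], expressed without constructing that
    -- ring. In the localization the differences of the points `b`, being divisors of powers of `t`,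
    -- are units.
    Kills : Carrier → Set ℓ
    Kills y = ∃[ e ] t ^ e * y ≈ 0#

    private
      kills-multiple : ∀ {y} z → Kills y → Kills (z * y)
      kills-multiple {y} z (e , eq) = e , trans (solve 3 (λ t z y → t :* (z :* y) := z :* (t :* y)) refl (t ^ e) z y)
                                            (trans (*-congˡ eq) (zeroʳ z))

      kills-- : ∀ {x y} → Kills x → Kills y → Kills (x - y)
      kills-- {x} {y} (e , p) (f , q) = e ℕ.+ f , (begin
        t ^ (e ℕ.+ f) * (x - y)      ≈⟨ *-congʳ (^-homo-* t e f) ⟩
        t ^ e * t ^ f * (x - y)
          ≈⟨ solve 4 (λ a b x y → a :* b :* (x :- y) := b :* (a :* x) :- a :* (b :* y)) refl (t ^ e) (t ^ f) x y ⟩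
        t ^ f * (t ^ e * x) - t ^ e * (t ^ f * y)
          ≈⟨ +-cong (trans (*-congˡ p) (zeroʳ _)) (-‿cong (trans (*-congˡ q) (zeroʳ _))) ⟩
        0# - 0#                      ≈⟨ -‿inverseʳ 0# ⟩
        0#                           ∎)

      kills-factor : ∀ {d y e} → d ∣ t ^ e → Kills (d * y) → Kills y
      kills-factor {d} {y} {e} (q , eq) k = proj₁ k′ ℕ.+ e , (begin
        t ^ (proj₁ k′ ℕ.+ e) * y       ≈⟨ *-congʳ (^-homo-* t (proj₁ k′) e) ⟩
        t ^ proj₁ k′ * t ^ e * y       ≈⟨ *-congʳ (*-congˡ (sym eq)) ⟩
        t ^ proj₁ k′ * (q * d) * y
          ≈⟨ solve 4 (λ a q d y → a :* (q :* d) :* y := a :* (q :* (d :* y))) refl _ q d y ⟩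
        t ^ proj₁ k′ * (q * (d * y))   ≈⟨ proj₂ k′ ⟩
        0#                             ∎)
        where k′ = kills-multiple q k

      kills-resp : ∀ {x y} → x ≈ y → Kills x → Kills y
      kills-resp eq (e , p) = e , trans (*-congˡ (sym eq)) p

      Separated : ∀ {n} → (Fin n → Carrier) → Set _
      Separated b = ∀ i j → i Fin.< j → ∃[ e ] (b j - b i) ∣ t ^ e

      -- A polynomial of degree n with unit leading coefficient and n + 1 roots with invertible
      -- differences forces R[1/t] to be zero: subtracting the value at the first root and
      -- cancelling the difference lowers the degree and uses up one root.
      unitTop : ∀ n (a b : Fin (suc n) → Carrier) → Unit (a (fromℕ n)) → Separated b →
                (∀ j → Kills (evaluate a (b j))) → Kills 1#
      unitTop zero a b (u , au≈1) sep k = kills-resp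
        (trans (*-congˡ (trans (+-identityʳ _) (*-identityʳ _))) (trans (*-comm u _) au≈1)) (kills-multiple u (k zero))
      unitTop (suc n) a b (u , au≈1) sep k = unitTop n (dividedDifference a (b zero)) (λ j → b (suc j))
        (u , trans (*-congʳ (dividedDifference-top n a (b zero))) au≈1)
        (λ i j i<j → sep (suc i) (suc j) (s≤s i<j))
        (λ j → kills-factor {e = proj₁ (sep zero (suc j) (s≤s z≤n))} (proj₂ (sep zero (suc j) (s≤s z≤n)))
          (kills-resp (evaluate-dividedDifference a (b zero) (b (suc j))) (kills-- (k (suc j)) (k zero))))

    -- Descent from the top coefficient. A unit there makes `unitTop` applicable; a zero is
    -- discarded together with one of the points. The hypothesis that coefficients are zero or units
    -- is what a polynomial over a field retains after mapping it into an algebra.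
    roots⇒zero-or-nilpotent : ∀ n (a b : Fin n → Carrier) → (∀ i → a i ≈ 0# ⊎ Unit (a i)) →
      (∀ i j → i Fin.< j → ∃[ e ] (b j - b i) ∣ t ^ e) → (∀ j → evaluate a (b j) ≈ 0#) →
      (∀ i → a i ≈ 0#) ⊎ (∃[ e ] t ^ e ≈ 0#)
    roots⇒zero-or-nilpotent zero    a b unit? sep root = inj₁ λ ()
    roots⇒zero-or-nilpotent (suc n) a b unit? sep root with unit? (fromℕ n)
    ... | inj₂ unit = let (e , eq) = unitTop n a b unit sep (λ j → 0 , trans (*-congˡ (root j)) (zeroʳ _))
                      in inj₂ (e , trans (sym (*-identityʳ _)) eq)
    ... | inj₁ top≈0 with roots⇒zero-or-nilpotent n (λ i → a (inject₁ i)) (λ j → b (inject₁ j)) (λ i → unit? (inject₁ i))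
        (λ i j i<j → sep (inject₁ i) (inject₁ j) (≡.subst₂ ℕ._<_ (≡.sym (Fin.toℕ-inject₁ i)) (≡.sym (Fin.toℕ-inject₁ j)) i<j))
        (λ j → trans (sym (trans (+-congˡ (trans (*-congʳ top≈0) (zeroˡ _))) (+-identityʳ _)))
          (trans (sym (evaluate-init a (b (inject₁ j)))) (root (inject₁ j))))
    ... | inj₂ nilpotent = inj₂ nilpotent
    ... | inj₁ init≈0    = inj₁ all
      where
      all : ∀ i → a i ≈ 0#
      all i with view i
      ... | ‵fromℕ     = top≈0
      ... | ‵inject₁ j = init≈0 j

-- Finite fields and the additivity of Frobenius

-- Opaque because comparing values of _C_ by unfolding is slow.
opaque

  choose : ℕ → ℕ → ℕ
  choose = _C_

module BinomialExpansion (R : CommutativeRing c ℓ) where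

  open Ring R
  open Multiple semiring public using () renaming (_×_ to _×ₙ_; ×-congʳ to ×ₙ-congʳ; ×-homo-1 to ×ₙ-homo-1; ×-assoc-* to ×ₙ-assoc-*)
  open Binomial commutativeSemiring using (binomialTerm; theorem)

  private
    last : ∀ x y {m k} → k ≡ m → (m C k) ×ₙ (x ^ k * y ^ (m ℕ.∸ k)) ≈ x ^ m
    last x y {m} ≡.refl rewrite nCn≡1 m | ℕ.n∸n≡0 m = trans (×ₙ-homo-1 _) (*-identityʳ _)

    inner : ∀ x y n {k k′} → k ≡ k′ → (suc n C suc k) ×ₙ (x ^ suc k * y ^ (n ℕ.∸ k)) ≈ (suc n C suc k′) ×ₙ 1# *
        (x ^ suc k′ * y ^ (n ℕ.∸ k′))
    inner x y n {k} ≡.refl = sym (trans (×ₙ-assoc-* (suc n C suc k) 1# (x ^ suc k * y ^ (n ℕ.∸ k)))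
        (×ₙ-congʳ (suc n C suc k) (*-identityˡ _)))

  opaque
    unfolding choose

    -- The two extreme terms are separated because the terms between them are those that vanish when
    -- the exponent is the order of a finite field.
    expansion : ∀ x y n → (x + y) ^ suc n ≈
      y ^ suc n + sum {n} (λ k → choose (suc n) (suc (toℕ k)) ×ₙ 1# * (x ^ suc (toℕ k) * y ^ (n ℕ.∸ toℕ k))) + x ^ suc n
    expansion x y n = trans (theorem (suc n) x y) (trans (SemiringSum.sum-init-last semiring (binomialTerm x y (suc n)))
      (+-cong (+-cong (trans (×ₙ-homo-1 _) (*-identityˡ _)) (sum-cong {n} λ k → inner x y n (Fin.toℕ-inject₁ k)))
              (last x y (Fin.toℕ-fromℕ (suc n)))))

module FiniteFieldProperties (F : CommutativeRing c ℓ) (isField : IsField F) {q : ℕ} (card : HasCardinality F q) where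

  open Ring F
  open IsField isField
  open Inverse card using (to; from; inverseˡ; inverseʳ; from-cong)
  private
    _≟_ = finite⇒decidable F card

  open FieldLinearAlgebra F isField _≟_ using (*-nonZero)

  to∘from : ∀ x → to (from x) ≈ x
  to∘from x = inverseˡ {x} ≡.refl

  from∘to : ∀ i → from (to i) ≡ i
  from∘to i = inverseʳ refl

  to-injective : ∀ {i j} → to i ≈ to j → i ≡ j
  to-injective {i} {j} e = ≡.trans (≡.sym (from∘to i)) (≡.trans (from-cong e) (from∘to j))

  q≥1 : 1 ℕ.≤ q
  q≥1 = ℕ.≤-trans (s≤s z≤n) (Fin.toℕ<n (from 0#))

  private
    module Product = MonoidSum *-commutativeMonoid
    product = Product.sum

    product-const : ∀ {n} x {f : Fin n → Carrier} → (∀ i → f i ≈ x) → product f ≈ x ^ n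
    product-const {zero}  x e = refl
    product-const {suc n} x e = *-cong (e zero) (product-const x (λ i → e (suc i)))

    product-nonZero : ∀ {n} (f : Fin n → Carrier) → (∀ i → ¬ f i ≈ 0#) → ¬ product f ≈ 0#
    product-nonZero {zero}  f ne e = 0≉1 (sym e)
    product-nonZero {suc n} f ne e = product-nonZero (λ i → f (suc i)) (λ i → ne (suc i)) (*-nonZero (ne zero) e)

    -- Lets a product over the nonzero elements run over the whole enumeration of F: the zero
    -- element contributes the factor 1.
    replaceZero : Carrier → Carrier → Carrier
    replaceZero x y with x ≟ 0#
    ... | yes _ = 1#
    ... | no  _ = y

    replaceZero-zero : ∀ {x} y → x ≈ 0# → replaceZero x y ≈ 1#
    replaceZero-zero {x} y e with x ≟ 0#
    ... | yes _ = refl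
    ... | no ne = ⊥-elim (ne e)

    replaceZero-nonZero : ∀ {x} y → ¬ x ≈ 0# → replaceZero x y ≈ y
    replaceZero-nonZero {x} y ne with x ≟ 0#
    ... | yes e = ⊥-elim (ne e)
    ... | no _ = refl

    replaced-nonZero : ∀ x → ¬ replaceZero x x ≈ 0#
    replaced-nonZero x with x ≟ 0#
    ... | yes _ = λ e → 0≉1 (sym e)
    ... | no ne = ne

  -- Multiplication by x permutes the nonzero elements.
  power≈1 : ∀ {n} → q ≡ suc n → ∀ x → ¬ x ≈ 0# → x ^ n ≈ 1#
  power≈1 {n} ≡.refl x x≉0 = begin
    x ^ n
      ≈⟨ sym (product-const x (λ i → replaceZero-nonZero x (λ e → Fin.punchInᵢ≢i i₀ i
          (≡.trans (≡.sym (from∘to (punchIn i₀ i))) (from-cong e))))) ⟩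
    product (λ i → h (punchIn i₀ i))
      ≈⟨ sym (trans (Product.sum-remove {i = i₀} h) (trans (*-congʳ (replaceZero-zero x (to∘from 0#))) (*-identityˡ _))) ⟩
    product h              ≈⟨ sym (*-identityʳ _) ⟩
    product h * 1#         ≈⟨ *-congˡ (sym G*G⁻¹) ⟩
    product h * (G * G⁻¹)  ≈⟨ sym (*-assoc _ _ _) ⟩
    product h * G * G⁻¹    ≈⟨ *-congʳ (sym G≈hG) ⟩
    G * G⁻¹                ≈⟨ G*G⁻¹ ⟩
    1#                     ∎
    where
    i₀ = from 0#
    x⁻¹ = proj₁ (inverse x x≉0)
    h g : Fin q → Carrier
    h i = replaceZero (to i) x
    g i = replaceZero (to i) (to i)
    G = product g
    G⁻¹ = proj₁ (inverse G (product-nonZero g (λ i → replaced-nonZero (to i))))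
    G*G⁻¹ : G * G⁻¹ ≈ 1#
    G*G⁻¹ = proj₂ (inverse G (product-nonZero g (λ i → replaced-nonZero (to i))))
    cancel : ∀ u v y → u * v ≈ 1# → from (u * to (from (v * y))) ≡ from y
    cancel u v y e = from-cong (trans (*-congˡ (to∘from _)) (trans (sym (*-assoc _ _ _)) (trans (*-congʳ e) (*-identityˡ _))))
    π : Permutation.Permutation′ q
    π = Permutation.permutation (λ i → from (x * to i)) (λ i → from (x⁻¹ * to i))
      (λ i → ≡.trans (cancel x x⁻¹ (to i) (proj₂ (inverse x x≉0))) (from∘to i))
      (λ i → ≡.trans (cancel x⁻¹ x (to i) (trans (*-comm _ _) (proj₂ (inverse x x≉0)))) (from∘to i))
    g-π : ∀ i → g (π Permutation.⟨$⟩ʳ i) ≈ h i * g i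
    g-π i with to i ≟ 0#
    ... | yes e = trans (replaceZero-zero _ (trans (to∘from _) (trans (*-congˡ e) (zeroʳ x)))) (sym (*-identityˡ 1#))
    ... | no ne = trans (replaceZero-nonZero _ λ e → ne (*-nonZero x≉0 (trans (sym (to∘from _)) e))) (to∘from _)
    G≈hG : G ≈ product h * G
    G≈hG = trans (Product.sum-permute g π) (trans (Product.sum-cong-≋ g-π) (Product.∑-distrib-+ h g))

  fermat : ∀ x → x ^ q ≈ x
  fermat x with x ≟ 0#
  ... | yes e = trans (^-congˡ q e) (trans (0^n≈0 q q≥1) (sym e))
  ... | no ne = go q≥1 ≡.refl
    where
    go : ∀ {n} → 1 ℕ.≤ n → q ≡ n → x ^ n ≈ x
    go {suc n} _ e = trans (*-congˡ (power≈1 e x ne)) (*-identityʳ x)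

  open BinomialExpansion F
  open Roots F

  private
    inner : ∀ n → Fin (suc n) → Carrier
    inner n zero    = 0#
    inner n (suc k) = choose (suc n) (suc (toℕ k)) ×ₙ 1#

    -- By Fermat, (y + 1)^q = y^q + 1 for all y ∈ F.
    inner-root : ∀ {n} → q ≡ suc n → ∀ y → evaluate (inner n) y ≈ 0#
    inner-root {n} ≡.refl y = begin
      evaluate (inner n) y                ≈⟨ insert ⟩
      (1# + m + y ^ q) - (1# + y ^ q)     ≈⟨ +-congʳ (sym binomial) ⟩
      (y + 1#) ^ q - (1# + y ^ q)
        ≈⟨ +-cong (fermat (y + 1#)) (-‿cong (trans (+-congˡ (fermat y)) (+-comm 1# y))) ⟩
      (y + 1#) - (y + 1#)                 ≈⟨ -‿inverseʳ _ ⟩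
      0#                                  ∎
      where
      open IntegerSolver F
      m = sum (λ k → inner n (suc k) * y ^ toℕ (suc k))
      insert : evaluate (inner n) y ≈ (1# + m + y ^ q) - (1# + y ^ q)
      insert = trans (+-congʳ (zeroˡ _)) (solve 2 (λ m z → :0 :+ m := (:1 :+ m :+ z) :- (:1 :+ z)) refl m (y ^ q))
      ones : ∀ z k → z * 1# ^ k ≈ z
      ones z k = trans (*-congˡ (1^n≈1 k)) (*-identityʳ z)
      binomial : (y + 1#) ^ q ≈ 1# + m + y ^ q
      binomial = trans (expansion y 1# n) (+-congʳ (+-cong (1^n≈1 q)
          (sum-cong {n} λ k → *-congˡ {choose (suc n) (suc (toℕ k)) ×ₙ 1#} (ones (y ^ suc (toℕ k)) (n ℕ.∸ toℕ k)))))

  -- These are the coefficients of a polynomial of degree below q that vanishes at all q elements of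
  -- F, so no description of the characteristic enters. The root count is applied with `t` equal to
  -- 1: differences of distinct elements are units, and a power of 1 cannot vanish.
  binomials≈0 : ∀ {n} → q ≡ suc n → ∀ (k : Fin n) → choose q (suc (toℕ k)) ×ₙ 1# ≈ 0#
  binomials≈0 {n} ≡.refl k = conclude (roots⇒zero-or-nilpotent 1# q (inner n) to
      (λ i → unit? (inner n i))
      (λ i j i<j → 0 , (proj₁ (inv i j i<j) , trans (*-comm _ _) (proj₂ (inv i j i<j))))
      (λ j → inner-root ≡.refl (to j)))
    where
    unit? : ∀ x → x ≈ 0# ⊎ Unit x
    unit? x with x ≟ 0#
    ... | yes e = inj₁ e
    ... | no ne = inj₂ (inverse x ne)
    inv : ∀ i j → i Fin.< j → Unit (to j - to i)
    inv i j i<j = inverse _ λ e → ℕ.<⇒≢ i<j (≡.cong toℕ (≡.sym (to-injective (x∙y⁻¹≈ε⇒x≈y _ _ e))))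
    conclude : (∀ i → inner n i ≈ 0#) ⊎ (∃[ e ] 1# ^ e ≈ 0#) → choose q (suc (toℕ k)) ×ₙ 1# ≈ 0#
    conclude (inj₁ all≈0)   = all≈0 (suc k)
    conclude (inj₂ (e , p)) = ⊥-elim (0≉1 (sym (trans (sym (1^n≈1 e)) p)))

module Frobenius (F : CommutativeRing c ℓ) (isField : IsField F) {q : ℕ} (card : HasCardinality F q)
                 (R : CommutativeRing c′ ℓ′) (φ : Hom F R) where

  open Ring R
  private
    module F = Ring F
    module F* = FiniteFieldProperties F isField card
    module φ = RingHom F R φ
    open BinomialExpansion R
    open Multiple F.semiring using () renaming (_×_ to _×F_)

    ×-homo : ∀ n x → φ.⟦ n ×F x ⟧ ≈ n ×ₙ φ.⟦ x ⟧
    ×-homo zero    x = φ.0#-homo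
    ×-homo (suc n) x = trans (φ.+-homo _ _) (+-congˡ (×-homo n x))

  q≥1 : 1 ℕ.≤ q
  q≥1 = F*.q≥1

  -- The inner binomial coefficients vanish as multiples of 1 in F, and such an identity passes to
  -- every F-algebra.
  frobenius-+ : ∀ x y → (x + y) ^ q ≈ x ^ q + y ^ q
  frobenius-+ x y = go q≥1 ≡.refl
    where
    go : ∀ {n} → 1 ℕ.≤ n → q ≡ n → (x + y) ^ q ≈ x ^ q + y ^ q
    go {suc n} _ ≡.refl = trans (expansion x y n) (trans (+-congʳ
        (trans (+-congˡ (sum-zero inner)) (+-identityʳ (y ^ q)))) (+-comm _ _))
      where
      inner : ∀ k → choose q (suc (toℕ k)) ×ₙ 1# * (x ^ suc (toℕ k) * y ^ (n ℕ.∸ toℕ k)) ≈ 0#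
      inner k = begin
        choose q (suc (toℕ k)) ×ₙ 1# * z           ≈⟨ *-congʳ (×ₙ-congʳ (choose q (suc (toℕ k))) (sym φ.1#-homo)) ⟩
        choose q (suc (toℕ k)) ×ₙ φ.⟦ F.1# ⟧ * z   ≈⟨ *-congʳ (sym (×-homo (choose q (suc (toℕ k))) F.1#)) ⟩
        φ.⟦ choose q (suc (toℕ k)) ×F F.1# ⟧ * z   ≈⟨ *-congʳ (trans (φ.⟦⟧-cong (F*.binomials≈0 ≡.refl k)) φ.0#-homo) ⟩
        0# * z                                ≈⟨ zeroˡ z ⟩
        0#                                    ∎
        where z = x ^ suc (toℕ k) * y ^ (n ℕ.∸ toℕ k)

  power-+ : ∀ r x y → (x + y) ^ (q ℕ.^ r) ≈ x ^ (q ℕ.^ r) + y ^ (q ℕ.^ r)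
  power-+ zero    x y = trans (*-identityʳ _) (sym (+-cong (*-identityʳ x) (*-identityʳ y)))
  power-+ (suc r) x y = begin
    (x + y) ^ (q ℕ.* q ℕ.^ r)             ≈⟨ sym (^-assocʳ (x + y) q _) ⟩
    ((x + y) ^ q) ^ (q ℕ.^ r)             ≈⟨ ^-congˡ (q ℕ.^ r) (frobenius-+ x y) ⟩
    (x ^ q + y ^ q) ^ (q ℕ.^ r)           ≈⟨ power-+ r (x ^ q) (y ^ q) ⟩
    (x ^ q) ^ (q ℕ.^ r) + (y ^ q) ^ (q ℕ.^ r)   ≈⟨ +-cong (^-assocʳ x q _) (^-assocʳ y q _) ⟩
    x ^ (q ℕ.* q ℕ.^ r) + y ^ (q ℕ.* q ℕ.^ r)   ∎

  power-0 : ∀ r → 0# ^ (q ℕ.^ r) ≈ 0#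
  power-0 r = 0^n≈0 (q ℕ.^ r) (ℕ.m^n>0 q {{ℕ.>-nonZero q≥1}} r)

  power-sum : ∀ r {n} (f : Fin n → Carrier) → sum f ^ (q ℕ.^ r) ≈ sum (λ i → f i ^ (q ℕ.^ r))
  power-sum r {zero}  f = power-0 r
  power-sum r {suc n} f = trans (power-+ r _ _) (+-congˡ (power-sum r (λ i → f (suc i))))

  -- Additivity is applied to (x - y) + y, which avoids computing the sign of a power of - 1.
  power-- : ∀ r x y → (x - y) ^ (q ℕ.^ r) ≈ x ^ (q ℕ.^ r) - y ^ (q ℕ.^ r)
  power-- r x y = begin
    z                                    ≈⟨ solve 2 (λ z w → z := (z :+ w) :- w) refl z (y ^ (q ℕ.^ r)) ⟩
    (z + y ^ (q ℕ.^ r)) - y ^ (q ℕ.^ r)  ≈⟨ +-congʳ (trans (sym (power-+ r (x - y) y)) (^-congˡ (q ℕ.^ r)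
                                              (solve 2 (λ x y → (x :- y) :+ y := x) refl x y))) ⟩
    x ^ (q ℕ.^ r) - y ^ (q ℕ.^ r)        ∎
    where
    open IntegerSolver R
    z = (x - y) ^ (q ℕ.^ r)

-- Free algebras, traces and discriminants

record Basis (A : CommutativeRing c ℓ) (R : CommutativeRing c′ ℓ′) (φ : Hom A R) (d : ℕ) : Set (c Level.⊔ ℓ Level.⊔ c′ Level.⊔ ℓ′) where
  private
    module A = Ring A
    module R = Ring R
  open RingHomomorphism φ using (⟦_⟧)
  field
    basis       : Fin d → R.Carrier
    coordinate  : R.Carrier → Fin d → A.Carrier
    expansion   : ∀ x → x R.≈ R.sum (λ i → ⟦ coordinate x i ⟧ R.* basis i)
    independent : ∀ (a : Fin d → A.Carrier) → R.sum (λ i → ⟦ a i ⟧ R.* basis i) R.≈ R.0# → ∀ i → a i A.≈ A.0#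

module FreeAlgebra (A : CommutativeRing c ℓ) (R : CommutativeRing c′ ℓ′) (φ : Hom A R) {d : ℕ} (fb : Basis A R φ d) where

  private
    module A = Ring A
    module φ = RingHom A R φ
  open φ using (⟦_⟧)
  open Ring R
  open Basis fb public

  combination : (Fin d → A.Carrier) → Carrier
  combination a = sum (λ i → ⟦ a i ⟧ * basis i)

  combination-cong : ∀ {a b} → (∀ i → a i A.≈ b i) → combination a ≈ combination b
  combination-cong e = sum-cong λ i → *-congʳ (φ.⟦⟧-cong (e i))

  combination-+ : ∀ a b → combination (λ i → a i A.+ b i) ≈ combination a + combination b
  combination-+ a b = trans (sum-cong λ i → trans (*-congʳ (φ.+-homo (a i) (b i))) (distribʳ (basis i) _ _))
    (∑-distrib-+ (λ i → ⟦ a i ⟧ * basis i) (λ i → ⟦ b i ⟧ * basis i))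

  combination-scale : ∀ s a → combination (λ i → s A.* a i) ≈ ⟦ s ⟧ * combination a
  combination-scale s a = trans (sum-cong λ i → trans (*-congʳ (φ.*-homo s (a i))) (*-assoc _ _ _))
    (sym (*-distribˡ-sum ⟦ s ⟧ (λ i → ⟦ a i ⟧ * basis i)))

  combination-zero : ∀ {a} → (∀ i → a i A.≈ A.0#) → combination a ≈ 0#
  combination-zero e = sum-zero λ i → trans (*-congʳ (trans (φ.⟦⟧-cong (e i)) φ.0#-homo)) (zeroˡ _)

  combination-injective : ∀ {a b} → combination a ≈ combination b → ∀ i → a i A.≈ b i
  combination-injective {a} {b} e i = A.x∙y⁻¹≈ε⇒x≈y _ _ (independent (λ i → a i A.- b i) (begin
    combination (λ i → a i A.- b i)                       ≈⟨ combination-+ a (λ i → A.- b i) ⟩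
    combination a + combination (λ i → A.- b i)           ≈⟨ +-congˡ (combination-cong λ i → A.sym (A.-1*x≈-x (b i))) ⟩
    combination a + combination (λ i → A.- A.1# A.* b i)  ≈⟨ +-cong e (combination-scale (A.- A.1#) b) ⟩
    combination b + ⟦ A.- A.1# ⟧ * combination b
      ≈⟨ +-congˡ (trans (*-congʳ (trans (φ.-‿homo _) (-‿cong φ.1#-homo))) (-1*x≈-x _)) ⟩
    combination b - combination b                         ≈⟨ -‿inverseʳ _ ⟩
    0#                                                    ∎) i)

  coordinate-unique : ∀ {x} a → x ≈ combination a → ∀ i → coordinate x i A.≈ a i
  coordinate-unique {x} a e = combination-injective (trans (sym (expansion x)) e)

  coordinate-cong : ∀ {x y} → x ≈ y → ∀ i → coordinate x i A.≈ coordinate y i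
  coordinate-cong {x} {y} e = coordinate-unique (coordinate y) (trans e (expansion y))

  coordinate-+ : ∀ x y i → coordinate (x + y) i A.≈ coordinate x i A.+ coordinate y i
  coordinate-+ x y = coordinate-unique _ (trans (+-cong (expansion x) (expansion y))
      (sym (combination-+ (coordinate x) (coordinate y))))

  coordinate-scale : ∀ s x i → coordinate (⟦ s ⟧ * x) i A.≈ s A.* coordinate x i
  coordinate-scale s x = coordinate-unique _ (trans (*-congˡ (expansion x)) (sym (combination-scale s (coordinate x))))

  coordinate-zero : ∀ {x} → x ≈ 0# → ∀ i → coordinate x i A.≈ A.0#
  coordinate-zero {x} e = coordinate-unique (λ _ → A.0#) (trans e (sym (combination-zero λ _ → A.refl)))

  coordinate-sum : ∀ {n} (f : Fin n → Carrier) i → coordinate (sum f) i A.≈ A.sum (λ j → coordinate (f j) i)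
  coordinate-sum {zero}  f i = coordinate-zero refl i
  coordinate-sum {suc n} f i = A.trans (coordinate-+ _ _ i) (A.+-congˡ (coordinate-sum (λ j → f (suc j)) i))

  zeroCoordinates⇒≈0 : ∀ {x} → (∀ i → coordinate x i A.≈ A.0#) → x ≈ 0#
  zeroCoordinates⇒≈0 {x} e = trans (expansion x) (combination-zero e)

  decide≈0 : Decidable A._≈_ → ∀ x → Dec (x ≈ 0#)
  decide≈0 _≟_ x with Fin.all? (λ i → coordinate x i ≟ A.0#)
  ... | yes e = yes (zeroCoordinates⇒≈0 e)
  ... | no ne = no λ e → ne (coordinate-zero e)

  matrix : Carrier → Fin d → Fin d → A.Carrier
  matrix x i j = coordinate (x * basis j) i

  matrix-* : ∀ x y i k → matrix (x * y) i k A.≈ A.sum (λ l → matrix x i l A.* matrix y l k)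
  matrix-* x y i k = A.trans (coordinate-cong (begin
      x * y * basis k                                     ≈⟨ *-assoc x y _ ⟩
      x * (y * basis k)                                   ≈⟨ *-congˡ (expansion (y * basis k)) ⟩
      x * combination (λ l → matrix y l k)                ≈⟨ *-distribˡ-sum x (λ l → ⟦ matrix y l k ⟧ * basis l) ⟩
      sum (λ l → x * (⟦ matrix y l k ⟧ * basis l))        ≈⟨ sum-cong (λ l → swap x ⟦ matrix y l k ⟧ (basis l)) ⟩
      sum (λ l → ⟦ matrix y l k ⟧ * (x * basis l))        ∎) i)
    (A.trans (coordinate-sum (λ l → ⟦ matrix y l k ⟧ * (x * basis l)) i)
      (A.sum-cong λ l → A.trans (coordinate-scale (matrix y l k) (x * basis l) i) (A.*-comm _ _)))
    where
    swap : ∀ x y z → x * (y * z) ≈ y * (x * z)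
    swap x y z = trans (sym (*-assoc x y z)) (trans (*-congʳ (*-comm x y)) (*-assoc y x z))

  trace : Carrier → A.Carrier
  trace x = A.sum (λ i → coordinate (x * basis i) i)

  disc : (Fin d → Carrier) → A.Carrier
  disc x = Determinant.det A (λ i j → trace (x i * x j))

  trace-cong : ∀ {x y} → x ≈ y → trace x A.≈ trace y
  trace-cong e = A.sum-cong λ i → coordinate-cong (*-congʳ e) i

  trace-+ : ∀ x y → trace (x + y) A.≈ trace x A.+ trace y
  trace-+ x y = A.trans (A.sum-cong λ i → A.trans (coordinate-cong (distribʳ (basis i) x y) i) (coordinate-+ _ _ i))
    (A.∑-distrib-+ (λ i → matrix x i i) (λ i → matrix y i i))

  trace-scale : ∀ s x → trace (⟦ s ⟧ * x) A.≈ s A.* trace x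
  trace-scale s x = A.trans (A.sum-cong λ i → A.trans (coordinate-cong (*-assoc ⟦ s ⟧ x (basis i)) i) (coordinate-scale s _ i))
    (A.sym (A.*-distribˡ-sum s (λ i → matrix x i i)))

  trace-zero : ∀ {x} → x ≈ 0# → trace x A.≈ A.0#
  trace-zero e = A.sum-zero λ i → coordinate-zero (trans (*-congʳ e) (zeroˡ _)) i

  trace-sum : ∀ {n} (f : Fin n → Carrier) → trace (sum f) A.≈ A.sum (λ i → trace (f i))
  trace-sum {zero}  f = trace-zero refl
  trace-sum {suc n} f = A.trans (trace-+ _ _) (A.+-congˡ (trace-sum (λ i → f (suc i))))

  trace-combinationʳ : ∀ x b → trace (x * combination b) A.≈ A.sum (λ l → b l A.* trace (x * basis l))
  trace-combinationʳ x b = A.trans (trace-cong (*-distribˡ-sum x (λ l → ⟦ b l ⟧ * basis l)))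
    (A.trans (trace-sum (λ l → x * (⟦ b l ⟧ * basis l))) (A.sum-cong λ l →
      A.trans (trace-cong (trans (sym (*-assoc x _ _)) (trans (*-congʳ (*-comm x _)) (*-assoc _ x _)))) (trace-scale (b l) _)))

  -- The trace matrix of a tuple is X W Xᵀ, where X holds its coordinates and W the traces of
  -- products of basis elements. This is the shape of matrix that `degenerate⇒gram-det≈0` treats.
  trace-bilinear : ∀ x y → trace (x * y) A.≈
    A.sum (λ k → A.sum (λ l → coordinate x k A.* (coordinate y l A.* trace (basis k * basis l))))
  trace-bilinear x y = A.trans (trace-cong (trans (*-congˡ (expansion y)) (*-congʳ (expansion x))))
    (A.trans (trace-cong (*-comm _ _)) (A.trans (trace-combinationʳ (combination (coordinate y)) (coordinate x))
      (A.sum-cong λ k → A.trans (A.*-congˡ {coordinate x k}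
          (A.trans (trace-cong (*-comm _ _)) (trace-combinationʳ (basis k) (coordinate y))))
        (A.*-distribˡ-sum (coordinate x k) (λ l → coordinate y l A.* trace (basis k * basis l))))))

  ∣-coordinate : ∀ {s x} → ⟦ s ⟧ ∣ x → ∀ i → s A.∣ coordinate x i
  ∣-coordinate {s} (y , e) i = coordinate y i A., A.trans (A.*-comm _ _)
    (A.trans (A.sym (coordinate-scale s y i)) (coordinate-cong (trans (*-comm _ _) e) i))

  coordinate-∣ : ∀ {s x} → (∀ i → s A.∣ coordinate x i) → ⟦ s ⟧ ∣ x
  coordinate-∣ {s} {x} div = ∣ʳ-respʳ-≈ (sym (expansion x)) (∣-sum λ i →
    ∣ʳ-respʳ-≈ (*-comm _ _) (x∣ʳy⇒x∣ʳzy (basis i) (φ.∣-homo (div i))))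

module FieldAlgebra (F : CommutativeRing c ℓ) (isField : IsField F) (_≟_ : Decidable (CommutativeRing._≈_ F))
                    (S : CommutativeRing c′ ℓ′) (φ : Hom F S) {d : ℕ} (fb : Basis F S φ d) where

  private module F = Ring F
  open Ring S
  open FreeAlgebra F S φ fb
  open FieldLinearAlgebra F isField _≟_
  private module φ = RingHom F S φ
  open φ using (⟦_⟧)

  degenerate⇒disc≈0 : ∀ (v : Fin d → F.Carrier) p → ¬ v p F.≈ F.0# →
    (∀ i → F.sum (λ j → v j F.* trace (basis i * basis j)) F.≈ F.0#) → ∀ x → disc x F.≈ F.0#
  degenerate⇒disc≈0 v p vp≉0 ker x = F.trans (DeterminantProperties.det-cong F λ i j → trace-bilinear (x i) (x j))
    (degenerate⇒gram-det≈0 (λ k l → trace (basis k * basis l)) v p vp≉0 ker (λ i → coordinate (x i)))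

  -- If b² = 0 then (b y)² = 0, so b is orthogonal to every y.
  square≈0⇒≈0 : ¬ (∀ x → disc x F.≈ F.0#) → ∀ b → b * b ≈ 0# → b ≈ 0#
  square≈0⇒≈0 nondegenerate b b²≈0 = decidable-stable (decide≈0 _≟_ b) λ b≉0 → b≉0 (zeroCoordinates⇒≈0 λ p →
    decidable-stable (coordinate b p ≟ F.0#) λ bp≉0 → nondegenerate (degenerate⇒disc≈0 (coordinate b) p bp≉0 λ i →
      F.trans (F.sym (trace-combinationʳ (basis i) (coordinate b))) (orthogonal i)))
    where
    swap : ∀ w b → (w * b) * (w * b) ≈ w * w * (b * b)
    swap = solve 2 (λ w b → (w :* b) :* (w :* b) := w :* w :* (b :* b)) refl
      where open IntegerSolver S
    orthogonal : ∀ i → trace (basis i * combination (coordinate b)) F.≈ F.0#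
    orthogonal i = F.trans (trace-cong (*-congˡ (sym (expansion b)))) (square≈0⇒trace≈0 d (matrix (basis i * b)) λ j k →
      F.trans (F.sym (matrix-* (basis i * b) (basis i * b) j k))
        (coordinate-zero (trans (*-congʳ (trans (swap (basis i) b) (trans (*-congˡ b²≈0) (zeroʳ _)))) (zeroˡ _)) j))

  module _ (reduced : ∀ b → b * b ≈ 0# → b ≈ 0#) where

    -- Descent on the exponent: for e ≥ 2 the square of t^(e-1) has exponent 2e - 2 ≥ e and
    -- vanishes, so t^(e-1) vanishes because the algebra is reduced.
    nilpotent⇒≈0 : ∀ e t → t ^ e ≈ 0# → t ≈ 0#
    nilpotent⇒≈0 zero          t p = trans (sym (*-identityʳ t)) (trans (*-congˡ p) (zeroʳ t))
    nilpotent⇒≈0 (suc zero)    t p = trans (sym (*-identityʳ t)) p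
    nilpotent⇒≈0 (suc (suc e)) t p = nilpotent⇒≈0 (suc e) t (reduced (t ^ suc e) (begin
      (t * t ^ e) * (t * t ^ e)      ≈⟨ solve 2 (λ t u → (t :* u) :* (t :* u) := t :* (t :* u) :* u) refl t (t ^ e) ⟩
      (t * (t * t ^ e)) * t ^ e      ≈⟨ *-congʳ p ⟩
      0# * t ^ e                     ≈⟨ zeroˡ _ ⟩
      0#                             ∎))
      where open IntegerSolver S

  -- The powers 1, a, ..., a^d are d + 1 vectors in dimension d. The relation need not be monic, and
  -- its leading nonzero coefficient is located later by `roots⇒zero-or-nilpotent`.
  relation : ∀ a → Σ[ v ∈ (Fin (suc d) → F.Carrier) ] (∃[ j ] ¬ v j F.≈ F.0#) × sum (λ j → ⟦ v j ⟧ * a ^ toℕ j) ≈ 0#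
  relation a = let (v , nz , rel) = dependent d (λ j → coordinate (a ^ toℕ j)) in
    v , nz , zeroCoordinates⇒≈0 λ i → F.trans (coordinate-sum (λ j → ⟦ v j ⟧ * a ^ toℕ j) i)
      (F.trans (F.sum-cong λ j → coordinate-scale (v j) (a ^ toℕ j) i) (rel i))

-- Elements fixed by a power of Frobenius

-- Over F with q^m elements, the powers a^(q^(m j)) for j = 0, …, d are roots of
-- a relation of degree at most d satisfied by a. Hence the product of their
-- differences vanishes, and each difference divides a power of a^(q^e) - a.
module FrobeniusFixed
  (k : CommutativeRing c ℓ) (k-isField : IsField k) {q : ℕ} (k-card : HasCardinality k q)
  {c₁ ℓ₁} (F : CommutativeRing c₁ ℓ₁) (isField : IsField F) {m : ℕ} (card : HasCardinality F (q ℕ.^ m))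
  (S : CommutativeRing c′ ℓ′) (ψ : Hom k S) (φ : Hom F S) {d : ℕ} (fb : Basis F S φ d)
  (reduced : ∀ b → CommutativeRing._≈_ S (CommutativeRing._*_ S b b) (CommutativeRing.0# S) → CommutativeRing._≈_ S b
      (CommutativeRing.0# S))
  (e : ℕ) (divides : ∀ f → 1 ℕ.≤ f → f ℕ.≤ d → f ℕ.* m ℕ.∣ e) where

  open Ring S
  private
    module F = Ring F
    module φ = RingHom F S φ
    _≟_ = finite⇒decidable F card
  open φ using (⟦_⟧)
  open Frobenius k k-isField k-card S ψ
  open FiniteFieldProperties F isField card using (fermat)
  open FieldAlgebra F isField _≟_ S φ fb
  open Roots S
  open IntegerSolver S

  Q : ℕ → ℕ
  Q r = q ℕ.^ r

  Q≥1 : ∀ r → 1 ℕ.≤ Q r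
  Q≥1 r = ℕ.m^n>0 q {{ℕ.>-nonZero q≥1}} r

  power-Q : ∀ x r s → x ^ Q (r ℕ.+ s) ≈ (x ^ Q r) ^ Q s
  power-Q x r s = trans (reflexive (≡.cong (x ^_) (ℕ.^-distribˡ-+-* q r s))) (sym (^-assocʳ x (Q r) (Q s)))

  ∣-power : ∀ {x y} n → x ∣ y → x ^ n ∣ y ^ n
  ∣-power {x} {y} n (z , eq) = z ^ n , trans (sym (^-distrib-* z x n)) (^-congˡ n eq)

  ∣-power≥1 : ∀ {x y n} → 1 ℕ.≤ n → x ∣ y → x ∣ y ^ n
  ∣-power≥1 {x} {y} {suc n} _ (z , eq) = y ^ n * z , trans (*-assoc _ _ _) (trans (*-congˡ eq) (*-comm _ _))

  -- Since Frobenius is additive, the difference for exponent (s + 1) r is the q^r-th power of the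
  -- difference for s r plus the difference for r, and both summands are multiples of a^(q^r) - a.
  differences-divide : ∀ a r s → (a ^ Q r - a) ∣ (a ^ Q (s ℕ.* r) - a)
  differences-divide a r zero    = 0# , trans (zeroˡ _) (sym (trans (+-congʳ (*-identityʳ a)) (-‿inverseʳ a)))
  differences-divide a r (suc s) = ∣ʳ-respʳ-≈ eq
    (∣-+ (∣-power≥1 (Q≥1 r) (differences-divide a r s)) ∣ʳ-refl)
    where
    eq : (a ^ Q (s ℕ.* r) - a) ^ Q r + (a ^ Q r - a) ≈ a ^ Q (r ℕ.+ s ℕ.* r) - a
    eq = begin
      (a ^ Q (s ℕ.* r) - a) ^ Q r + (a ^ Q r - a)         ≈⟨ +-congʳ (power-- r _ _) ⟩
      ((a ^ Q (s ℕ.* r)) ^ Q r - a ^ Q r) + (a ^ Q r - a)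
        ≈⟨ solve 3 (λ x y a → (x :- y) :+ (y :- a) := x :- a) refl _ (a ^ Q r) a ⟩
      (a ^ Q (s ℕ.* r)) ^ Q r - a                          ≈⟨ +-congʳ (sym (power-Q a (s ℕ.* r) r)) ⟩
      a ^ Q (s ℕ.* r ℕ.+ r) - a
        ≈⟨ +-congʳ (reflexive (≡.cong (λ n → a ^ Q n) (ℕ.+-comm (s ℕ.* r) r))) ⟩
      a ^ Q (r ℕ.+ s ℕ.* r) - a                            ∎

  fermat-power : ∀ j x → x F.^ Q (j ℕ.* m) F.≈ x
  fermat-power zero    x = F.*-identityʳ x
  fermat-power (suc j) x = F.trans (F.reflexive (≡.cong (x F.^_) (ℕ.^-distribˡ-+-* q m (j ℕ.* m))))
    (F.trans (F.sym (F.^-assocʳ x (Q m) (Q (j ℕ.* m)))) (F.trans (F.^-congˡ (Q (j ℕ.* m)) (fermat x)) (fermat-power j x)))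

  module _ (a : Carrier) where

    private
      t : Carrier
      t = a ^ Q e - a

      v : Fin (suc d) → F.Carrier
      v = proj₁ (relation a)

      b : Fin (suc d) → Carrier
      b j = a ^ Q (toℕ j ℕ.* m)

      unit? : ∀ i → ⟦ v i ⟧ ≈ 0# ⊎ Unit ⟦ v i ⟧
      unit? i with v i ≟ F.0#
      ... | yes z = inj₁ (trans (φ.⟦⟧-cong z) φ.0#-homo)
      ... | no nz = let (u , p) = IsField.inverse isField (v i) nz in
                    inj₂ (⟦ u ⟧ , trans (sym (φ.*-homo _ _)) (trans (φ.⟦⟧-cong p) φ.1#-homo))

      -- Frobenius to the power i m can be pulled out of the difference of two conjugates, so up to
      -- a power only the gap f between them matters.
      difference : ∀ i f → a ^ Q ((i ℕ.+ f) ℕ.* m) - a ^ Q (i ℕ.* m) ≈ (a ^ Q (f ℕ.* m) - a) ^ Q (i ℕ.* m)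
      difference i f = sym (trans (power-- (i ℕ.* m) _ _) (+-congʳ (trans (sym (power-Q a (f ℕ.* m) (i ℕ.* m)))
        (reflexive (≡.cong (λ n → a ^ Q n) (≡.trans (≡.sym (ℕ.*-distribʳ-+ m f i)) (≡.cong (ℕ._* m) (ℕ.+-comm f i))))))))

      separated : ∀ i j → i Fin.< j → ∃[ n ] (b j - b i) ∣ t ^ n
      separated i j i<j = Q (toℕ i ℕ.* m) , ∣ʳ-respˡ-≈ (sym
          (trans (+-congʳ (reflexive (≡.cong (λ n → a ^ Q (n ℕ.* m)) (≡.sym j≡)))) (difference (toℕ i) f)))
        (∣-power (Q (toℕ i ℕ.* m)) divided)
        where
        f = toℕ j ℕ.∸ toℕ i
        j≡ : toℕ i ℕ.+ f ≡ toℕ j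
        j≡ = ℕ.m+[n∸m]≡n (ℕ.<⇒≤ i<j)
        divided : (a ^ Q (f ℕ.* m) - a) ∣ t
        -- Two distinct indices from 0 to d differ by at least 1 and at most d, exactly the range in
        -- which `divides` is available.
        divided with divides f (ℕ.m<n⇒0<n∸m i<j) (ℕ.≤-trans (ℕ.m∸n≤m (toℕ j) (toℕ i)) (ℕ.≤-pred (Fin.toℕ<n j)))
        ... | ℕ.divides s ≡.refl = differences-divide a (f ℕ.* m) s

      -- Raising the relation for `a` to the power q^(jm) acts termwise; the coefficients come from
      -- F and are fixed by Fermat, while `a` moves to `b j`.
      root : ∀ j → evaluate (λ i → ⟦ v i ⟧) (b j) ≈ 0#
      root j = begin
        sum (λ i → ⟦ v i ⟧ * b j ^ toℕ i)
          ≈⟨ sum-cong (λ i → *-cong (trans (φ.⟦⟧-cong (F.sym (fermat-power (toℕ j) (v i)))) (φ.^-homo (v i) M)) (swap (toℕ i))) ⟩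
        sum (λ i → ⟦ v i ⟧ ^ M * (a ^ toℕ i) ^ M)
          ≈⟨ sum-cong (λ i → sym (^-distrib-* ⟦ v i ⟧ (a ^ toℕ i) M)) ⟩
        sum (λ i → (⟦ v i ⟧ * a ^ toℕ i) ^ M)
          ≈⟨ sym (power-sum (toℕ j ℕ.* m) (λ i → ⟦ v i ⟧ * a ^ toℕ i)) ⟩
        sum (λ i → ⟦ v i ⟧ * a ^ toℕ i) ^ M                 ≈⟨ ^-congˡ M (proj₂ (proj₂ (relation a))) ⟩
        0# ^ M                                              ≈⟨ 0^n≈0 M (Q≥1 (toℕ j ℕ.* m)) ⟩
        0#                                                  ∎
        where
        M = Q (toℕ j ℕ.* m)
        swap : ∀ i → (a ^ M) ^ i ≈ (a ^ i) ^ M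
        swap i = trans (^-assocʳ a M i) (trans (reflexive (≡.cong (a ^_) (ℕ.*-comm M i))) (sym (^-assocʳ a i M)))

      conclude : (∀ i → ⟦ v i ⟧ ≈ 0#) ⊎ (∃[ n ] t ^ n ≈ 0#) → t ≈ 0#
      conclude (inj₂ (n , p)) = nilpotent⇒≈0 reduced n t p
      -- A nonzero `v j` is a unit of F, so its vanishing in S means 1 = 0 there. Exponent 0 in
      -- `nilpotent⇒≈0` handles this zero ring.
      conclude (inj₁ v≈0) = let (j , vj≉0) = proj₁ (proj₂ (relation a)) ; (u , p) = IsField.inverse isField (v j) vj≉0 in
        nilpotent⇒≈0 reduced 0 t (trans (sym φ.1#-homo) (trans (φ.⟦⟧-cong (F.sym p))
            (trans (φ.*-homo _ _) (trans (*-congʳ (v≈0 j)) (zeroˡ _)))))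

    frobenius-fixed : a ^ Q e ≈ a
    frobenius-fixed = x∙y⁻¹≈ε⇒x≈y _ _ (conclude (roots⇒zero-or-nilpotent t (suc d) (λ i → ⟦ v i ⟧) b unit? separated root))

-- Euclidean domains with finite residue rings

funToFin-cong : ∀ {m N} {f f′ : Fin m → Fin N} → (∀ i → f i ≡ f′ i) → Fin.funToFin f ≡ Fin.funToFin f′
funToFin-cong {zero}  e = ≡.refl
funToFin-cong {suc m} e = ≡.cong₂ Fin.combine (e zero) (funToFin-cong (λ i → e (suc i)))

-- That `index` respects congruence follows from the last hypothesis, applied to the representative
-- of the second element.
quotient-hasCardinality : (R : CommutativeRing c ℓ) → let open Ring R in
  ∀ g {N} (rep : Fin N → Carrier) (index : Carrier → Fin N) →
  (∀ x → g ∣ (rep (index x) - x)) → (∀ i x → g ∣ (x - rep i) → index x ≡ i) →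
  HasCardinality (quotient R (principal R g)) N
quotient-hasCardinality R g rep index rep-index unique = record
  { to = rep
  ; from = index
  ; to-cong = λ { {i} ≡.refl → mk∼ (0# , trans (zeroˡ g) (sym (-‿inverseʳ (rep i)))) }
  ; from-cong = λ { {x} {y} (mk∼ d) → unique (index y) x (∣ʳ-respʳ-≈ (move x y (rep (index y))) (∣-+ d (∣-neg (rep-index y)))) }
  ; inverse = (λ { {x} ≡.refl → mk∼ (rep-index x) }) , λ { {i} {x} (mk∼ d) → unique i x d }
  }
  where
  open Ring R
  open IntegerSolver R
  move : ∀ x y z → (x - y) + - (z - y) ≈ x - z
  move = solve 3 (λ x y z → (x :- y) :+ (:- (z :- y)) := x :- z) refl

-- A Euclidean domain with finite quotients, of which F_q[t] is an instance.
record EuclideanDomain (A : CommutativeRing c ℓ) : Set (Level.suc (c Level.⊔ ℓ)) where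
  open Ring A
  field
    1≉0       : ¬ 1# ≈ 0#
    cancel    : AlmostLeftCancellative _≈_ 0# _*_
    _≟_       : Decidable _≈_
    HasDegree : Carrier → ℕ → Set ℓ
    degree          : ∀ {p} → ¬ p ≈ 0# → ∃ (HasDegree p)
    degree⇒≉0       : ∀ {p n} → HasDegree p n → ¬ p ≈ 0#
    degree-unique   : ∀ {p q m n} → p ≈ q → HasDegree p m → HasDegree q n → m ≡ n
    degree-*        : ∀ {p q m n} → HasDegree p m → HasDegree q n → HasDegree (p * q) (m ℕ.+ n)
    degree-zero⇒unit : ∀ {p} → HasDegree p 0 → p ∣ 1#

  Below : ℕ → Carrier → Set ℓ
  Below n p = p ≈ 0# ⊎ (∃[ m ] HasDegree p m × m ℕ.< n)

  field
    below-- : ∀ {p q n} → Below n p → Below n q → Below n (p - q)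
    divide  : ∀ {g n} → HasDegree g n → ∀ p → ∃[ q ] ∃[ r ] (p ≈ q * g + r) × Below n r
    q       : ℕ
    hasCardinality : ∀ {g n} → HasDegree g n → HasCardinality (quotient A (principal A g)) (q ℕ.^ n)
    representative-below : ∀ {g n} (dg : HasDegree g n) i → Below n (Inverse.to (hasCardinality dg) i)

module EuclideanArithmetic (A : CommutativeRing c ℓ) (domain : EuclideanDomain A) where

  open Ring A
  open EuclideanDomain domain public
  open IntegerSolver A

  *-cancelˡ : ∀ {x y z} → ¬ x ≈ 0# → x * y ≈ x * z → y ≈ z
  *-cancelˡ {x} {y} {z} = cancel x y z

  *-nonZero : ∀ {x y} → ¬ x ≈ 0# → x * y ≈ 0# → y ≈ 0#
  *-nonZero {x} x≉0 e = *-cancelˡ x≉0 (trans e (sym (zeroʳ x)))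

  divisor-degree : ∀ {p q m n} → p ∣ q → HasDegree p m → HasDegree q n → m ℕ.≤ n
  divisor-degree {p} {q} {m} (r , e) dp dq =
    let (i , dr) = degree (λ r≈0 → degree⇒≉0 dq (trans (sym e) (x≈0⇒xy≈0 p r≈0)))
    in ≡.subst (m ℕ.≤_) (degree-unique e (degree-* dr dp) dq) (ℕ.m≤n+m m i)

  small-multiple≈0 : ∀ {g n x} → HasDegree g n → g ∣ x → Below n x → x ≈ 0#
  small-multiple≈0 dg div (inj₁ e)              = e
  small-multiple≈0 dg div (inj₂ (m , dx , m<n)) = ⊥-elim (ℕ.<⇒≱ m<n (divisor-degree div dg dx))

  _∣?_ : Decidable _∣_
  g ∣? x with g ≟ 0#
  ... | yes g≈0 with x ≟ 0#
  ...   | yes x≈0 = yes (0# , trans (zeroˡ g) (sym x≈0))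
  ...   | no  x≉0 = no λ { (q , e) → x≉0 (trans (sym e) (y≈0⇒xy≈0 q g≈0)) }
  g ∣? x | no g≉0 with divide (proj₂ (degree g≉0)) x
  ... | q , r , eq , below with r ≟ 0#
  ...   | yes r≈0 = yes (q , sym (trans eq (trans (+-congˡ r≈0) (+-identityʳ _))))
  ...   | no  r≉0 = no λ div → r≉0 (small-multiple≈0 (proj₂ (degree g≉0))
          (∣ʳ-respʳ-≈ (trans (+-congʳ eq) (move (q * g) r)) (∣-+ div (∣-neg (q , refl)))) below)
    where
    move : ∀ x y → (x + y) - x ≈ y
    move = solve 2 (λ x y → (x :+ y) :- x := y) refl

  record Bezout (a b : Carrier) : Set (c Level.⊔ ℓ) where
    field
      gcd u v : Carrier
      gcd≈    : gcd ≈ u * a + v * b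
      gcd∣a   : gcd ∣ a
      gcd∣b   : gcd ∣ b

  private
    bezout-zero : ∀ {a b} → b ≈ 0# → Bezout a b
    bezout-zero {a} {b} b≈0 = record
      { gcd = a ; u = 1# ; v = 0#
      ; gcd≈ = solve 2 (λ a b → a := :1 :* a :+ :0 :* b) refl a b
      ; gcd∣a = ∣ʳ-refl ; gcd∣b = 0# , trans (zeroˡ a) (sym b≈0) }

    bezout-step : ∀ {a b q r} → a ≈ q * b + r → Bezout b r → Bezout a b
    bezout-step {a} {b} {q} {r} e B = record
      { gcd = gcd ; u = v ; v = u - v * q
      ; gcd≈ = trans gcd≈ (trans (move u v b q r) (+-congʳ (*-congˡ (sym e))))
      ; gcd∣a = ∣ʳ-respʳ-≈ (sym e) (∣-+ (x∣ʳy⇒x∣ʳzy q gcd∣a) gcd∣b)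
      ; gcd∣b = gcd∣a }
      where
      open Bezout B
      move : ∀ u v b q r → u * b + v * r ≈ v * (q * b + r) + (u - v * q) * b
      move = solve 5 (λ u v b q r → u :* b :+ v :* r := v :* (q :* b :+ r) :+ (u :- v :* q) :* b) refl

    bezout-below : ∀ n {a b} → Below n b → Bezout a b
    bezout-below n       (inj₁ b≈0) = bezout-zero b≈0
    bezout-below (suc n) {a} (inj₂ (m , db , s≤s m≤n)) = let (q , r , eq , below) = divide db a in
      bezout-step eq (bezout-below n (weaken m≤n below))
      where
      weaken : ∀ {m n r} → m ℕ.≤ n → Below m r → Below n r
      weaken m≤n (inj₁ e)             = inj₁ e
      weaken m≤n (inj₂ (i , d , i<m)) = inj₂ (i , d , ℕ.<-≤-trans i<m m≤n)

  bezout : ∀ a b → Bezout a b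
  bezout a b with b ≟ 0#
  ... | yes b≈0 = bezout-zero b≈0
  ... | no  b≉0 = let (m , db) = degree b≉0 in bezout-below (suc m) (inj₂ (m , db , ℕ.≤-refl))

  module _ {P : Carrier} (irr : Irreducible P) where

    open RingNotions.Irreducible A irr

    irreducible≉0 : ¬ P ≈ 0#
    irreducible≉0 P≈0 = 0∤1 (both (split-∣1 (trans P≈0 (sym (zeroˡ 0#)))))
      where
      both : 0# ∣ 1# ⊎ 0# ∣ 1# → 0# ∣ 1#
      both (inj₁ d) = d
      both (inj₂ d) = d
      0∤1 : ¬ 0# ∣ 1#
      0∤1 (q , e) = 1≉0 (trans (sym e) (zeroʳ q))

    -- The gcd of `x` and the irreducible `P` either is a unit, and Bezout's identity gives the
    -- inverse, or has a unit cofactor in `P`, and then `P` would divide `x`.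
    inverse-mod : ∀ x → P ∤ x → ∃[ y ] P ∣ (x * y - 1#)
    inverse-mod x P∤x = split (split-∣1 (trans (sym h*gcd) (*-comm h gcd)))
      where
      open Bezout (bezout x P)
      open RawMagmaDefinitions._∣ʳ_ gcd∣b renaming (quotient to h; equality to h*gcd)
      move : ∀ w u x v P → x * (u * w) - w * (u * x + v * P) ≈ - (w * v) * P
      move = solve 5 (λ w u x v P → x :* (u :* w) :- w :* (u :* x :+ v :* P) := (:- (w :* v)) :* P) refl
      split : gcd ∣ 1# ⊎ h ∣ 1# → ∃[ y ] P ∣ (x * y - 1#)
      split (inj₁ (w , wg≈1)) = u * w , ∣ʳ-respʳ-≈ (trans (sym (move w u x v P))
          (+-congˡ (-‿cong (trans (*-congˡ (sym gcd≈)) wg≈1))))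
        (x∣ʳy⇒x∣ʳzy (- (w * v)) ∣ʳ-refl)
      split (inj₂ (w , wh≈1)) = ⊥-elim (P∤x (∣ʳ-trans (w , (begin
        w * P              ≈⟨ *-congˡ (sym h*gcd) ⟩
        w * (h * gcd)      ≈⟨ sym (*-assoc _ _ _) ⟩
        w * h * gcd        ≈⟨ trans (*-congʳ wh≈1) (*-identityˡ gcd) ⟩
        gcd                ∎)) gcd∣a))

    residueField : IsField (quotient A (principal A P))
    residueField = record
      { 0≉1 = λ { (mk∼ (q , e)) → p∤1 (- q , trans (sym (-‿distribˡ-* q P)) (trans (-‿cong e) (move 1#))) }
      ; inverse = λ x ne → let (y , d) = inverse-mod x (λ d → ne (mk∼ (∣ʳ-respʳ-≈ (sym (trans (+-congˡ -0#≈0#) (+-identityʳ x))) d)))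
                           in y , mk∼ d }
      where
      move : ∀ x → - (0# - x) ≈ x
      move = solve 1 (λ x → :- (:0 :- x) := x) refl

    euclid : ∀ {x y} → P ∣ x * y → P ∤ x → P ∣ y
    euclid {x} {y} (q , e) P∤x = let (z , (r , f)) = inverse-mod x P∤x in q * z - r * y , (begin
      (q * z - r * y) * P               ≈⟨ move q z r y P ⟩
      z * (q * P) - (r * P) * y         ≈⟨ +-cong (*-congˡ e) (-‿cong (*-congʳ f)) ⟩
      z * (x * y) - (x * z - 1#) * y    ≈⟨ move′ x y z ⟩
      y                                 ∎)
      where
      move : ∀ q z r y P → (q * z - r * y) * P ≈ z * (q * P) - (r * P) * y
      move = solve 5 (λ q z r y P → (q :* z :- r :* y) :* P := z :* (q :* P) :- (r :* P) :* y) refl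
      move′ : ∀ x y z → z * (x * y) - (x * z - 1#) * y ≈ y
      move′ = solve 3 (λ x y z → z :* (x :* y) :- (x :* z :- :1) :* y := y) refl

  private
    -- A divisor of degree below n is its own representative modulo `f`, so a search through the
    -- finitely many residues finds a nonunit divisor of lower degree or shows that there is none.
    -- In the first case the search continues in that divisor, in the second `f` is irreducible.
    irreducibleFactor′ : ∀ N {f n} → n ℕ.≤ N → HasDegree f n → f ∤ 1# → ∃[ P ] Irreducible P × P ∣ f
    irreducibleFactor′ N {f} {n} n≤N df f∤1 = search N n≤N (Fin.any? (λ i → proper? (residue i)))
      where
      residue : Fin (q ℕ.^ n) → Carrier
      residue = Inverse.to (hasCardinality df)
      index : Carrier → Fin (q ℕ.^ n)
      index = Inverse.from (hasCardinality df)
      Proper : Carrier → Set _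
      Proper x = x ∣ f × x ∤ 1#
      proper? : ∀ x → Dec (Proper x)
      proper? x with x ∣? f | x ∣? 1#
      ... | no ¬d | _     = no λ p → ¬d (proj₁ p)
      ... | yes d | yes u = no λ p → proj₂ p u
      ... | yes d | no ¬u = yes (d , ¬u)
      divisor≉0 : ∀ {x} → x ∣ f → ¬ x ≈ 0#
      divisor≉0 (q , e) x≈0 = degree⇒≉0 df (trans (sym e) (y≈0⇒xy≈0 q x≈0))
      below⇒degree< : ∀ {x m} → Below n x → HasDegree x m → m ℕ.< n
      below⇒degree< (inj₁ e) dx = ⊥-elim (degree⇒≉0 dx e)
      below⇒degree< (inj₂ (_ , dx′ , lt)) dx = ≡.subst (ℕ._< n) (degree-unique refl dx′ dx) lt
      search : ∀ N → n ℕ.≤ N → Dec (∃ λ i → Proper (residue i)) → ∃[ P ] Irreducible P × P ∣ f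
      search zero n≤0 _ = ⊥-elim (f∤1 (degree-zero⇒unit (≡.subst (HasDegree f) (ℕ.n≤0⇒n≡0 n≤0) df)))
      search (suc N) n≤N (yes (i , div , ∤1)) =
        let (m , dr) = degree (divisor≉0 div)
            m≤N = ℕ.≤-pred (ℕ.≤-trans (below⇒degree< (representative-below df i) dr) n≤N)
            (P , irr , P∣r) = irreducibleFactor′ N m≤N dr ∤1
        in P , irr , ∣ʳ-trans P∣r div
      search (suc N) n≤N (no none) = f , mkIrred f∤1 split , ∣ʳ-refl
        where
        lower-unit : ∀ {x m} → x ∣ f → HasDegree x m → m ℕ.< n → x ∣ 1#
        lower-unit {x} {m} div dx m<n = decidable-stable (x ∣? 1#) λ ∤1 → none
            (index x , ∣ʳ-respˡ-≈ x≈ div , λ u → ∤1 (∣ʳ-respˡ-≈ (sym x≈) u))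
          where
          x≈ : x ≈ residue (index x)
          x≈ = sym (x∙y⁻¹≈ε⇒x≈y _ _ (small-multiple≈0 df (_∼_.difference (Inverse.inverseˡ (hasCardinality df) {x} ≡.refl))
            (below-- (representative-below df (index x)) (inj₂ (m , dx , m<n)))))
        split : ∀ {x y} → f ≈ x * y → x ∣ 1# ⊎ y ∣ 1#
        split {x} {y} e = cases (degree (divisor≉0 x∣f)) (degree (divisor≉0 y∣f))
          where
          x∣f : x ∣ f
          x∣f = y , trans (*-comm y x) (sym e)
          y∣f : y ∣ f
          y∣f = x , sym e
          cases : ∃ (HasDegree x) → ∃ (HasDegree y) → x ∣ 1# ⊎ y ∣ 1#
          cases (zero  , dx) (j , dy) = inj₁ (degree-zero⇒unit dx)
          cases (suc i , dx) (j , dy) = inj₂ (lower-unit y∣f dy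
            (≡.subst (j ℕ.<_) (degree-unique (sym e) (degree-* dx dy) df) (s≤s (ℕ.m≤n+m j i))))

  irreducibleFactor : ∀ {f} → ¬ f ≈ 0# → f ∤ 1# → ∃[ P ] Irreducible P × P ∣ f
  irreducibleFactor {f} f≉0 f∤1 = let (n , df) = degree f≉0 in irreducibleFactor′ n ℕ.≤-refl df f∤1

  cofactor-degree : ∀ {f P h n} → HasDegree f n → f ≈ P * h → P ∤ 1# → ∃[ m ] HasDegree h m × m ℕ.< n
  cofactor-degree {f} {P} {h} {n} df e P∤1 = cases (degree P≉0) (degree h≉0)
    where
    P≉0 : ¬ P ≈ 0#
    P≉0 z = degree⇒≉0 df (trans e (x≈0⇒xy≈0 h z))
    h≉0 : ¬ h ≈ 0#
    h≉0 z = degree⇒≉0 df (trans e (y≈0⇒xy≈0 P z))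
    cases : ∃ (HasDegree P) → ∃ (HasDegree h) → ∃[ m ] HasDegree h m × m ℕ.< n
    cases (zero  , dP) _        = ⊥-elim (P∤1 (degree-zero⇒unit dP))
    cases (suc i , dP) (m , dh) = m , dh ,
      ≡.subst (m ℕ.<_) (degree-unique (sym e) (degree-* dP dh) df) (s≤s (ℕ.m≤n+m m i))

  IsSquareFree : Carrier → Set (c Level.⊔ ℓ)
  IsSquareFree g = ∀ h → (h * h) ∣ g → h ∣ 1#

  -- In the step g = P h, square-freeness makes P and h coprime.
  module _ (R : CommutativeRing c′ ℓ′) (φ : Hom A R) (x : CommutativeRing.Carrier R) where

    private
      module R = Ring R
      module φ = RingHom A R φ

      squareFree-∣′ : ∀ N {g n} → n ℕ.≤ N → HasDegree g n → IsSquareFree g →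
        (∀ P → Irreducible P → P ∣ g → φ.⟦ P ⟧ R.∣ x) → φ.⟦ g ⟧ R.∣ x
      squareFree-∣′ N {g} {n} n≤N dg sf all = split (g ∣? 1#)
        where
        split : Dec (g ∣ 1#) → φ.⟦ g ⟧ R.∣ x
        split (yes (w , e)) = x R.* φ.⟦ w ⟧ R., R.trans (R.*-assoc _ _ _) (R.trans (R.*-congˡ
          (R.trans (R.sym (φ.*-homo w g)) (R.trans (φ.⟦⟧-cong e) φ.1#-homo))) (R.*-identityʳ x))
        split (no g∤1) with irreducibleFactor (degree⇒≉0 dg) g∤1
        ... | P , irr@(mkIrred P∤1 P-split) , P∣g@(h , e) = step N n≤N
          where
          g≈Ph : g ≈ P * h
          g≈Ph = trans (sym e) (*-comm h P)
          dh = cofactor-degree dg g≈Ph P∤1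
          h∣g : h ∣ g
          h∣g = P , sym g≈Ph
          P∤h : P ∤ h
          P∤h (r , f) = P∤1 (sf P (r , trans (sym (*-assoc r P P)) (trans (*-congʳ f) e)))
          combine : φ.⟦ P ⟧ R.∣ x → φ.⟦ h ⟧ R.∣ x → φ.⟦ g ⟧ R.∣ x
          combine (y R., yP) (z R., zh) with inverse-mod irr h P∤h
          -- From h w - s P = 1 follows x = h w x - s P x. Writing x as a multiple of P in the first
          -- term and as a multiple of h in the second exhibits the factor P h.
          ... | w , (s , sP) = φ.⟦ w ⟧ R.* y R.- φ.⟦ s ⟧ R.* z R., (R.begin
            (φ.⟦ w ⟧ R.* y R.- φ.⟦ s ⟧ R.* z) R.* φ.⟦ g ⟧
              R.≈⟨ R.*-congˡ (R.trans (φ.⟦⟧-cong g≈Ph) (φ.*-homo P h)) ⟩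
            (φ.⟦ w ⟧ R.* y R.- φ.⟦ s ⟧ R.* z) R.* (φ.⟦ P ⟧ R.* φ.⟦ h ⟧)
              R.≈⟨ move φ.⟦ w ⟧ y φ.⟦ s ⟧ z φ.⟦ P ⟧ φ.⟦ h ⟧ ⟩
            φ.⟦ h ⟧ R.* φ.⟦ w ⟧ R.* (y R.* φ.⟦ P ⟧) R.- φ.⟦ s ⟧ R.* φ.⟦ P ⟧ R.* (z R.* φ.⟦ h ⟧)
              R.≈⟨ R.+-cong (R.*-cong (R.sym (φ.*-homo h w)) yP)
                  (R.-‿cong (R.*-cong (R.trans (R.sym (φ.*-homo s P)) (φ.⟦⟧-cong sP)) zh)) ⟩
            φ.⟦ h * w ⟧ R.* x R.- φ.⟦ h * w - 1# ⟧ R.* x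
              R.≈⟨ R.sym (R.[y-z]x≈yx-zx x φ.⟦ h * w ⟧ φ.⟦ h * w - 1# ⟧) ⟩
            (φ.⟦ h * w ⟧ R.- φ.⟦ h * w - 1# ⟧) R.* x
              R.≈⟨ R.*-congʳ (R.trans (R.+-congˡ (R.sym (φ.-‿homo _)))
                  (R.trans (R.sym (φ.+-homo _ _)) (R.trans (φ.⟦⟧-cong (one (h * w))) φ.1#-homo))) ⟩
            R.1# R.* x
              R.≈⟨ R.*-identityˡ x ⟩
            x R.∎)
            where
            open IntegerSolver R using () renaming (solve to solveR; _:=_ to _:≈_; _:+_ to _⊕_; _:*_ to _⊛_; _:-_ to _⊝_)
            move : ∀ w y s z P h → (w R.* y R.- s R.* z) R.* (P R.* h) R.≈ h R.* w R.* (y R.* P) R.- s R.* P R.* (z R.* h)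
            move = solveR 6 (λ w y s z P h → (w ⊛ y ⊝ s ⊛ z) ⊛ (P ⊛ h) :≈ h ⊛ w ⊛ (y ⊛ P) ⊝ s ⊛ P ⊛ (z ⊛ h)) R.refl
            one : ∀ x → x + - (x - 1#) ≈ 1#
            one = solve 1 (λ x → x :+ (:- (x :- :1)) := :1) refl
          step : ∀ N → n ℕ.≤ N → φ.⟦ g ⟧ R.∣ x
          step zero    n≤0 = ⊥-elim (ℕ.n≮0 (ℕ.<-≤-trans (proj₂ (proj₂ dh)) n≤0))
          step (suc N) n≤N = combine (all P irr P∣g)
            (squareFree-∣′ N (ℕ.≤-pred (ℕ.≤-trans (proj₂ (proj₂ dh)) n≤N)) (proj₁ (proj₂ dh))
              (λ u u²∣h → sf u (∣ʳ-trans u²∣h h∣g)) (λ P′ irr′ P′∣h → all P′ irr′ (∣ʳ-trans P′∣h h∣g)))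

    squareFree-∣ : ∀ {g n} → HasDegree g n → IsSquareFree g →
      (∀ P → Irreducible P → P ∣ g → φ.⟦ P ⟧ R.∣ x) → φ.⟦ g ⟧ R.∣ x
    squareFree-∣ {n = n} = squareFree-∣′ n ℕ.≤-refl

-- Polynomials over a finite field as a Euclidean domain

private
  module Differences (R : CommutativeRing c ℓ) where

    open Ring R
    open IntegerSolver R

    multiple : ∀ g q {p r r′} → r′ ≈ r → p ≈ q * g + r → g ∣ (r′ - p)
    multiple g q {p} {r} e eq = - q , trans (move q g r) (sym (+-cong e (-‿cong eq)))
      where
      move : ∀ q g r → - q * g ≈ r - (q * g + r)
      move = solve 3 (λ q g r → (:- q) :* g := r :- (q :* g :+ r)) refl

    small-difference : ∀ g q {p r s} → p ≈ q * g + r → g ∣ (p - s) → g ∣ (r - s)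
    small-difference g q {p} {r} {s} eq div =
      ∣ʳ-respʳ-≈ (trans (+-congʳ (+-congʳ eq)) (move (q * g) r s)) (∣-+ div (∣-neg (q , refl)))
      where
      move : ∀ q r s → (q + r - s) - q ≈ r - s
      move = solve 3 (λ q r s → (q :+ r :- s) :- q := r :- s) refl

module PolynomialArithmetic (𝔽 : FiniteField c ℓ) where

  open FunctionField 𝔽 using (𝔽[t]; module 𝔽X; module Dom)
  private
    module 𝔽 = FiniteField 𝔽
    module k = Ring 𝔽.ring
    module k* = FiniteFieldProperties 𝔽.ring 𝔽.isField 𝔽.hasCardinality
  open IsField 𝔽.isField using () renaming (inverse to k-inverse)
  open FieldLinearAlgebra 𝔽.ring 𝔽.isField (finite⇒decidable 𝔽.ring 𝔽.hasCardinality) using () renaming (*-nonZero to k-*-nonZero)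
  open 𝔽X using (coeff; at; mk≋; HasDegree; DegreeBelow; coeff-⊕; coeff-⊖; coeff-·; _·_; _⊗_; const)
  open Ring 𝔽[t]

  open Differences 𝔽[t]

  infix 4 _≟A_
  _≟A_ : Decidable _≈_
  x ≟A y = decide (Dom.zeroOrDegree (x - y))
    where
    decide : (x - y) ≈ 0# ⊎ ∃ (HasDegree (x - y)) → Dec (x ≈ y)
    decide (inj₁ e)           = yes (x∙y⁻¹≈ε⇒x≈y x y e)
    decide (inj₂ (n , l , _)) = no λ e → l (at (x≈y⇒x∙y⁻¹≈ε e) n)

  degree : ∀ {p} → ¬ p ≈ 0# → ∃ (HasDegree p)
  degree {p} p≉0 = split (Dom.zeroOrDegree p)
    where
    split : p ≈ 0# ⊎ ∃ (HasDegree p) → ∃ (HasDegree p)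
    split (inj₁ e) = ⊥-elim (p≉0 e)
    split (inj₂ d) = d

  degree⇒≉0 : ∀ {p n} → HasDegree p n → ¬ p ≈ 0#
  degree⇒≉0 {n = n} (l , _) e = l (at e n)

  degree-unique : ∀ {p q m n} → p ≈ q → HasDegree p m → HasDegree q n → m ≡ n
  degree-unique {p} {q} {m} {n} e (l , a) (l′ , a′) with ℕ.<-cmp m n
  ... | tri< m<n _ _ = ⊥-elim (l′ (k.trans (k.sym (at e n)) (a n m<n)))
  ... | tri≈ _ m≡n _ = m≡n
  ... | tri> _ _ n<m = ⊥-elim (l (k.trans (at e m) (a′ m n<m)))

  degree-* : ∀ {p q m n} → HasDegree p m → HasDegree q n → HasDegree (p * q) (m ℕ.+ n)
  degree-* {p} {q} {m} {n} (l , a) (l′ , a′) =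
    (λ e → l′ (k-*-nonZero l (k.trans (k.sym (𝔽X.coeff-⊗-top m n p q a a′)) e))) , 𝔽X.below-⊗ (suc m) p q a a′

  below⇒degree< : ∀ {p m n} → DegreeBelow n p → HasDegree p m → m ℕ.< n
  below⇒degree< {m = m} {n} b (l , _) with m ℕ.<? n
  ... | yes m<n = m<n
  ... | no  m≮n = ⊥-elim (l (b m (ℕ.≮⇒≥ m≮n)))

  below-- : ∀ {p q n} → DegreeBelow n p → DegreeBelow n q → DegreeBelow n (p - q)
  below-- {p} {q} b b′ i n≤i = k.trans (coeff-⊕ p (- q) i) (k.trans (k.+-cong (b i n≤i)
    (k.trans (coeff-⊖ q i) (k.-‿cong (b′ i n≤i)))) (k.-‿inverseʳ k.0#))

  record Division (n : ℕ) (g p : Carrier) : Set (c Level.⊔ ℓ) where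
    field
      quot rem : Carrier
      equation : p ≈ quot * g + rem
      below    : DegreeBelow n rem

  -- Recursion from the constant term: after division of p by g, the polynomial a + X p leaves a + X
  -- `rem`, whose degree is at most n, and subtracting the multiple `s` of g removes its coefficient
  -- at n.
  divide : ∀ {g n} → HasDegree g n → ∀ p → Division n g p
  divide dg [] = record { quot = 0# ; rem = 0# ; equation = mk≋ λ _ → k.refl ; below = λ _ _ → k.refl }
  divide {g} {n} (l , above) (a ∷ p) = record { quot = s ∷ quot ; rem = r ; equation = eq ; below = low }
    where
    open Division (divide {g} {n} (l , above) p)
    u = proj₁ (k-inverse _ l)
    s = coeff (a ∷ rem) n k.* u
    r = (a ∷ rem) - s · g
    shift : (a ∷ p) ≈ (k.0# ∷ quot * g) + (a ∷ rem)
    shift = mk≋ λ { zero → k.sym (k.+-identityˡ a) ; (suc i) → at equation i }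
    move : ∀ x y z → y + z ≈ (x + y) + (z - x)
    move = solve 3 (λ x y z → y :+ z := (x :+ y) :+ (z :- x)) refl
      where open IntegerSolver 𝔽[t]
    eq : (a ∷ p) ≈ (s ∷ quot) * g + r
    eq = trans shift (move (s · g) (k.0# ∷ quot * g) (a ∷ rem))
    coeff-r : ∀ i → coeff r i k.≈ coeff (a ∷ rem) i k.- s k.* coeff g i
    coeff-r i = k.trans (coeff-⊕ (a ∷ rem) (- (s · g)) i) (k.+-congˡ (k.trans (coeff-⊖ (s · g) i) (k.-‿cong (coeff-· s g i))))
    below-a : ∀ i → n ℕ.< i → coeff (a ∷ rem) i k.≈ k.0#
    below-a (suc i) (s≤s n≤i) = below i n≤i
    low : DegreeBelow n r
    low i n≤i with ℕ.m≤n⇒m<n∨m≡n n≤i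
    ... | inj₁ n<i = k.trans (coeff-r i) (k.trans (k.+-cong (below-a i n<i)
            (k.trans (k.-‿cong (k.trans (k.*-congˡ (above i n<i)) (k.zeroʳ s))) k.-0#≈0#)) (k.+-identityʳ k.0#))
    ... | inj₂ ≡.refl = k.trans (coeff-r n) (k.x≈y⇒x∙y⁻¹≈ε (k.sym (k.trans (k.*-assoc _ u _)
            (k.trans (k.*-congˡ (k.trans (k.*-comm u _) (proj₂ (k-inverse _ l)))) (k.*-identityʳ _)))))

  fromCoefficients : ∀ {n} → (Fin n → k.Carrier) → Carrier
  fromCoefficients {zero}  f = []
  fromCoefficients {suc n} f = f zero ∷ fromCoefficients (λ i → f (suc i))

  coeff-fromCoefficients : ∀ {n} (f : Fin n → k.Carrier) i → coeff (fromCoefficients f) (toℕ i) ≡ f i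
  coeff-fromCoefficients f zero    = ≡.refl
  coeff-fromCoefficients f (suc i) = coeff-fromCoefficients (λ j → f (suc j)) i

  fromCoefficients-below : ∀ {n} (f : Fin n → k.Carrier) → DegreeBelow n (fromCoefficients f)
  fromCoefficients-below {zero}  f i       _         = k.refl
  fromCoefficients-below {suc n} f (suc i) (s≤s n≤i) = fromCoefficients-below (λ j → f (suc j)) i n≤i

  below-≈ : ∀ {n p q} → DegreeBelow n p → DegreeBelow n q → (∀ (i : Fin n) → coeff p (toℕ i) k.≈ coeff q (toℕ i)) → p ≈ q
  below-≈ {n} {p} {q} b b′ e = mk≋ λ i → split i (i ℕ.<? n)
    where
    split : ∀ i → Dec (i ℕ.< n) → coeff p i k.≈ coeff q i
    split i (yes i<n) = ≡.subst (λ j → coeff p j k.≈ coeff q j) (Fin.toℕ-fromℕ< i<n) (e (Fin.fromℕ< i<n))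
    split i (no i≮n)  = k.trans (b i (ℕ.≮⇒≥ i≮n)) (k.sym (b′ i (ℕ.≮⇒≥ i≮n)))

  Small : ℕ → Carrier → Set ℓ
  Small n p = p ≈ 0# ⊎ (∃[ m ] HasDegree p m × m ℕ.< n)

  small⇒below : ∀ {n p} → Small n p → DegreeBelow n p
  small⇒below (inj₁ e) i _ = at e i
  small⇒below (inj₂ (m , (_ , above) , m<n)) i n≤i = above i (ℕ.<-≤-trans m<n n≤i)

  below⇒small : ∀ {n p} → DegreeBelow n p → Small n p
  below⇒small {n} {p} b = split (Dom.zeroOrDegree p)
    where
    split : p ≈ 0# ⊎ ∃ (HasDegree p) → Small n p
    split (inj₁ e) = inj₁ e
    split (inj₂ (m , dp)) = inj₂ (m , dp , below⇒degree< {p} b dp)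

  module Residues {g n} (dg : HasDegree g n) where

    -- The index is read as n digits in base q, each naming an element of the field.
    coefficients : Fin (𝔽.q ℕ.^ n) → Fin n → k.Carrier
    coefficients i j = Inverse.to 𝔽.hasCardinality (Fin.finToFun {𝔽.q} {n} i j)

    residue : Fin (𝔽.q ℕ.^ n) → Carrier
    residue i = fromCoefficients (coefficients i)

    remainder : Carrier → Carrier
    remainder p = Division.rem (divide {g} dg p)

    index : Carrier → Fin (𝔽.q ℕ.^ n)
    index p = Fin.funToFin {n} (λ j → Inverse.from 𝔽.hasCardinality (coeff (remainder p) (toℕ j)))

    residue-index≈ : ∀ p → residue (index p) ≈ remainder p
    residue-index≈ p = below-≈ {n} {residue (index p)} {remainder p} (fromCoefficients-below (coefficients (index p)))
      (Division.below (divide {g} dg p)) λ j →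
        k.trans (k.reflexive (≡.trans (coeff-fromCoefficients (coefficients (index p)) j)
          (≡.cong (Inverse.to 𝔽.hasCardinality) (Fin.finToFun-funToFin {n}
              (λ j → Inverse.from 𝔽.hasCardinality (coeff (remainder p) (toℕ j))) j))))
          (k*.to∘from (coeff (remainder p) (toℕ j)))

    index-unique≈ : ∀ i p → remainder p ≈ residue i → index p ≡ i
    index-unique≈ i p e = ≡.trans (funToFin-cong λ j → ≡.trans (Inverse.from-cong 𝔽.hasCardinality
        (k.trans (at e (toℕ j)) (k.reflexive (coeff-fromCoefficients (coefficients i) j))))
            (k*.from∘to (Fin.finToFun {𝔽.q} {n} i j)))
      (Fin.funToFin-finToFin {n} {𝔽.q} i)

    hasCardinality : HasCardinality (quotient 𝔽[t] (principal 𝔽[t] g)) (𝔽.q ℕ.^ n)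
    hasCardinality = quotient-hasCardinality 𝔽[t] g residue index
      (λ p → multiple g (quot p) (residue-index≈ p) (equation p))
      (λ i p div → index-unique≈ i p (small≈ (remainder p) (residue i)
        (small-difference g (quot p) (equation p) div)
        (below-- {remainder p} {residue i} (below p) (fromCoefficients-below (coefficients i)))))
      where
      quot : Carrier → Carrier
      quot p = Division.quot (divide {g} dg p)
      equation : ∀ p → p ≈ quot p * g + remainder p
      equation p = Division.equation (divide {g} dg p)
      below : ∀ p → DegreeBelow n (remainder p)
      below p = Division.below (divide {g} dg p)
      small≈ : ∀ x y → g ∣ (x - y) → DegreeBelow n (x - y) → x ≈ y
      small≈ x y (h , e) b = x∙y⁻¹≈ε⇒x≈y x y (split (Dom.zeroOrDegree (x - y)) (Dom.zeroOrDegree h))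
        where
        split : (x - y) ≈ 0# ⊎ ∃ (HasDegree (x - y)) → h ≈ 0# ⊎ ∃ (HasDegree h) → (x - y) ≈ 0#
        split (inj₁ z) _ = z
        split _ (inj₁ z) = trans (sym e) (x≈0⇒xy≈0 {h} g z)
        split (inj₂ (i , d)) (inj₂ (j , dh)) = ⊥-elim (ℕ.<⇒≱ (below⇒degree< {x - y} b d)
          (≡.subst (n ℕ.≤_) (degree-unique e (degree-* {h} {g} dh dg) d) (ℕ.m≤n+m n j)))

  degree-zero⇒unit : ∀ {p} → HasDegree p 0 → p ∣ 1#
  degree-zero⇒unit {p} (l , above) = let (u , e) = k-inverse _ l in const u , mk≋ λ
    { zero    → k.trans (coeff-⊕ (u · p) _ 0) (k.trans (k.+-identityʳ _) (k.trans (coeff-· u p 0) (k.trans (k.*-comm _ _) e)))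
    ; (suc i) → k.trans (coeff-⊕ (u · p) (k.0# ∷ []) (suc i)) (k.trans (k.+-identityʳ _) (k.trans (coeff-· u p (suc i))
                  (k.trans (k.*-congˡ (above (suc i) (s≤s z≤n))) (k.zeroʳ u)))) }


  euclideanDomain : EuclideanDomain 𝔽[t]
  euclideanDomain = record
    { 1≉0 = Dom.1≉0
    ; cancel = Dom.⊗-cancelˡ-nonZero
    ; _≟_ = _≟A_
    ; HasDegree = HasDegree
    ; degree = degree
    ; degree⇒≉0 = degree⇒≉0
    ; degree-unique = degree-unique
    ; degree-* = λ {p} {q} → degree-* {p} {q}
    ; degree-zero⇒unit = degree-zero⇒unit
    ; below-- = λ {p} {q} b b′ → below⇒small {p = p - q} (below-- {p} {q} (small⇒below {p = p} b) (small⇒below {p = q} b′))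
    ; divide = λ {g} dg p → let open Division (divide {g} dg p) in quot , rem , equation , below⇒small {p = rem} below
    ; q = 𝔽.q
    ; hasCardinality = λ {g} dg → Residues.hasCardinality {g} dg
    ; representative-below = λ {g} dg i → below⇒small {p = Residues.residue {g} dg i}
        (fromCoefficients-below (Residues.coefficients {g} dg i))
    }

-- Inserting the change of basis turns both traces into the same double sum, summed in the two
-- orders; this is tr(XY) = tr(YX).
trace-basisIndependent : (A : CommutativeRing c ℓ) (R : CommutativeRing c′ ℓ′) (φ : Hom A R) {d : ℕ} (fb fb′ : Basis A R φ d) →
  ∀ x → CommutativeRing._≈_ A (FreeAlgebra.trace A R φ fb x) (FreeAlgebra.trace A R φ fb′ x)
trace-basisIndependent A R φ {d} fb fb′ x = begin
  sum (λ i → B.coordinate (x * B.basis i) i)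
    ≈⟨ sum-cong (λ i → coordinates-product i i) ⟩
  sum (λ i → sum (λ j → B′.coordinate (B.basis i) j A.* B.coordinate (x * B′.basis j) i))
    ≈⟨ ∑-comm (λ i j → B′.coordinate (B.basis i) j A.* B.coordinate (x * B′.basis j) i) ⟩
  sum (λ j → sum (λ i → B′.coordinate (B.basis i) j A.* B.coordinate (x * B′.basis j) i))
    ≈⟨ sum-cong (λ j → back j) ⟩
  sum (λ j → B′.coordinate (x * B′.basis j) j) ∎
  where
  open Ring A using (sum; sum-cong; ∑-comm; begin_; step-≈-⟩; _∎)
  module A = Ring A
  module R = Ring R
  open R using (_*_)
  open RingHom A R φ using (⟦_⟧)
  module B  = FreeAlgebra A R φ fb
  module B′ = FreeAlgebra A R φ fb′
  coordinates-product : ∀ i l → B.coordinate (x * B.basis i) l A.≈ sum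
      (λ j → B′.coordinate (B.basis i) j A.* B.coordinate (x * B′.basis j) l)
  coordinates-product i l = A.trans (B.coordinate-cong (R.trans (R.*-congˡ (B′.expansion (B.basis i)))
      (R.trans (R.*-distribˡ-sum x (λ j → ⟦ B′.coordinate (B.basis i) j ⟧ * B′.basis j))
        (R.sum-cong λ j → swap x ⟦ B′.coordinate (B.basis i) j ⟧ (B′.basis j)))) l)
    (A.trans (B.coordinate-sum (λ j → ⟦ B′.coordinate (B.basis i) j ⟧ * (x * B′.basis j)) l)
      (sum-cong λ j → B.coordinate-scale (B′.coordinate (B.basis i) j) (x * B′.basis j) l))
    where
    swap : ∀ x y z → x * (y * z) R.≈ y * (x * z)
    swap x y z = R.trans (R.sym (R.*-assoc x y z)) (R.trans (R.*-congʳ (R.*-comm x y)) (R.*-assoc y x z))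
  back : ∀ j → sum (λ i → B′.coordinate (B.basis i) j A.* B.coordinate (x * B′.basis j) i) A.≈ B′.coordinate (x * B′.basis j) j
  back j = A.sym (A.trans (B′.coordinate-cong (B.expansion (x * B′.basis j)) j)
    (A.trans (B′.coordinate-sum (λ i → ⟦ B.coordinate (x * B′.basis j) i ⟧ * B.basis i) j)
      (sum-cong λ i → A.trans (B′.coordinate-scale (B.coordinate (x * B′.basis j) i) (B.basis i) j) (A.*-comm _ _))))

-- Lattices over a Euclidean domain

record Submodule (A : CommutativeRing c ℓ) (d : ℕ) p : Set (c Level.⊔ ℓ Level.⊔ Level.suc p) where
  open Ring A
  field
    Member  : (Fin d → Carrier) → Set p
    ∈-resp    : ∀ {v w} → (∀ i → v i ≈ w i) → Member v → Member w
    ∈-zero   : Member (λ _ → 0#)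
    ∈-+     : ∀ {v w} → Member v → Member w → Member (λ i → v i + w i)
    ∈-scale   : ∀ a {v} → Member v → Member (λ i → a * v i)

record LatticeBasis {A : CommutativeRing c ℓ} {d : ℕ} (L : Submodule A d p) : Set (c Level.⊔ ℓ Level.⊔ p) where
  open Ring A
  open Submodule L
  field
    vector      : Fin d → Fin d → Carrier
    member      : ∀ j → Member (vector j)
    spans       : ∀ {v} → Member v → Σ[ a ∈ (Fin d → Carrier) ] ∀ i → v i ≈ sum (λ j → a j * vector j i)
    independent : ∀ (a : Fin d → Carrier) → (∀ i → sum (λ j → a j * vector j i) ≈ 0#) → ∀ j → a j ≈ 0#

module Lattices (A : CommutativeRing c ℓ) (domain : EuclideanDomain A) where

  open Ring A
  open EuclideanArithmetic A domain
  open IntegerSolver A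

  private
    headZero : ∀ {d} → Submodule A (suc d) p → Submodule A d p
    headZero L = record
      { Member = λ w → Member (0# ◂ w)
      ; ∈-resp = λ e → ∈-resp λ { zero → refl ; (suc i) → e i }
      ; ∈-zero = ∈-resp (λ { zero → refl ; (suc i) → refl }) ∈-zero
      ; ∈-+ = λ v∈ w∈ → ∈-resp (λ { zero → +-identityˡ 0# ; (suc i) → refl }) (∈-+ v∈ w∈)
      ; ∈-scale = λ a v∈ → ∈-resp (λ { zero → zeroʳ a ; (suc i) → refl }) (∈-scale a v∈) }
      where open Submodule L

    -- Because the head of `u` divides the head of every member, subtracting a multiple of `u` leads
    -- into the members with head zero. The basis becomes triangular, and independence is read off
    -- from the head, which is not a zero divisor.
    fromPivot : ∀ {d} (L : Submodule A (suc d) p) (u : Fin (suc d) → Carrier) → Submodule.Member L u → ¬ u zero ≈ 0# →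
                (∀ v → Submodule.Member L v → u zero ∣ v zero) → LatticeBasis (headZero L) → LatticeBasis L
    fromPivot {d = d} L u u∈ u₀≉0 head-divides rest = record
      { vector = basis
      ; member = λ { zero → u∈ ; (suc j) → Rest.member j }
      ; spans = λ {v} v∈ → spans v v∈ (head-divides v v∈)
      ; independent = independent }
      where
      open Submodule L
      module Rest = LatticeBasis rest
      basis : Fin (suc d) → Fin (suc d) → Carrier
      basis zero    = u
      basis (suc j) = 0# ◂ Rest.vector j
      sum-zeros : ∀ (a : Fin d → Carrier) → sum (λ j → a j * 0#) ≈ 0#
      sum-zeros a = sum-zero λ j → zeroʳ (a j)
      spans : ∀ v → Member v → u zero ∣ v zero → Σ[ a ∈ (Fin (suc d) → Carrier) ] ∀ i → v i ≈ sum (λ j → a j * basis j i)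
      spans v v∈ (s , e) = s ◂ a , λ
          { zero → trans (sym e) (sym (trans (+-congˡ (sum-zeros a)) (+-identityʳ _)))
          ; (suc i) → trans (move (v (suc i)) (s * u (suc i))) (+-congˡ (a-spans i)) }
        where
        move : ∀ v w → v ≈ w + (v + - 1# * w)
        move = solve 2 (λ v w → v := w :+ (v :+ (:- :1) :* w)) refl
        tail-spans = Rest.spans {λ i → v (suc i) + - 1# * (s * u (suc i))} (∈-resp
          (λ { zero → trans (+-congˡ (trans (-1*x≈-x _) (-‿cong e))) (-‿inverseʳ (v zero)) ; (suc i) → refl })
          (∈-+ v∈ (∈-scale (- 1#) (∈-scale s u∈))))
        a = proj₁ tail-spans
        a-spans = proj₂ tail-spans
      independent : ∀ (a : Fin (suc d) → Carrier) → (∀ i → sum (λ j → a j * basis j i) ≈ 0#) → ∀ j → a j ≈ 0#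
      independent a rel = λ { zero → a₀≈0 ; (suc j) → Rest.independent (λ j → a (suc j))
        (λ i → trans (sym (trans (+-congʳ (x≈0⇒xy≈0 (u (suc i)) a₀≈0)) (+-identityˡ _))) (rel (suc i))) j }
        where
        a₀≈0 : a zero ≈ 0#
        a₀≈0 = *-nonZero u₀≉0 (trans (*-comm _ _)
          (trans (sym (trans (+-congˡ (sum-zeros (λ j → a (suc j)))) (+-identityʳ _))) (rel zero)))

  module _ {D : Carrier} (D≉0 : ¬ D ≈ 0#) where

    private
      dD = proj₂ (degree D≉0)
      N = q ℕ.^ proj₁ (degree D≉0)

      representative : ∀ d → Fin (N ℕ.^ d) → Fin d → Carrier
      representative d i j = Inverse.to (hasCardinality dD) (Fin.finToFun i j)

      index : ∀ {d} → (Fin d → Carrier) → Fin (N ℕ.^ d)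
      index v = Fin.funToFin (λ j → Inverse.from (hasCardinality dD) (v j))

      representative-index : ∀ {d} (v : Fin d → Carrier) j → D ∣ (representative d (index v) j - v j)
      representative-index v j = _∼_.difference (Inverse.inverseˡ (hasCardinality dD) {v j} (Fin.finToFun-funToFin _ j))

      -- L ⊇ D A^d, so membership depends only on residues modulo D.
      Contains : ∀ {d} → Submodule A d p → Set _
      Contains L = ∀ {v} → (∀ i → D ∣ v i) → Submodule.Member L v

      member-mod : ∀ {d} (L : Submodule A d p) → Contains L → ∀ {v w} →
          (∀ i → D ∣ (w i - v i)) → Submodule.Member L v → Submodule.Member L w
      member-mod L D∈ {v} {w} div v∈ = ∈-resp (λ i → move (v i) (w i)) (∈-+ v∈ (D∈ div))
        where
        open Submodule L
        move : ∀ v w → v + (w - v) ≈ w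
        move = solve 2 (λ v w → v :+ (w :- v) := w) refl

      ∣-flip : ∀ {x y z} → x ∣ (y - z) → x ∣ (z - y)
      ∣-flip {x} {y} {z} d = ∣ʳ-respʳ-≈ (move y z) (∣-neg d)
        where
        move : ∀ y z → - (y - z) ≈ z - y
        move = solve 2 (λ y z → :- (y :- z) := z :- y) refl

      record Pivot {d} (L : Submodule A (suc d) p) {n} (f : Fin n → Fin (suc d) → Carrier) : Set (c Level.⊔ ℓ Level.⊔ p) where
        open Submodule L
        field
          vector  : Fin (suc d) → Carrier
          member  : Member vector
          ∣D      : vector zero ∣ D
          ∣heads  : ∀ i → Member (f i) → vector zero ∣ f i zero

      pivot : ∀ {d} (L : Submodule A (suc d) p) → Contains L → (∀ v → Dec (Submodule.Member L v)) →
              ∀ {n} (f : Fin n → Fin (suc d) → Carrier) → Pivot L f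
      -- The search starts with D times the first unit vector, a member of L. Every later head
      -- divides D, so it cannot become zero.
      pivot L D∈ member? {zero} f = record
        { vector = D ◂ λ _ → 0# ; member = D∈ λ { zero → ∣ʳ-refl ; (suc i) → D ∣0 } ; ∣D = ∣ʳ-refl ; ∣heads = λ () }
      pivot L D∈ member? {suc n} f = extend (member? (f zero))
        where
        open Submodule L
        open Pivot (pivot L D∈ member? (λ i → f (suc i)))
        open Bezout (bezout (vector zero) (f zero zero)) renaming (u to s; v to t)
        extend : Dec (Member (f zero)) → Pivot L f
        extend (no ∉) = record
          { vector = vector ; member = member ; ∣D = ∣D
          ; ∣heads = λ { zero ∈ → ⊥-elim (∉ ∈) ; (suc i) ∈ → ∣heads i ∈ } }
        extend (yes f∈) = record
          { vector = λ i → s * vector i + t * f zero i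
          ; member = ∈-+ (∈-scale s member) (∈-scale t f∈)
          ; ∣D = ∣ʳ-trans (∣ʳ-respˡ-≈ gcd≈ gcd∣a) ∣D
          ; ∣heads = λ { zero _ → ∣ʳ-respˡ-≈ gcd≈ gcd∣b ; (suc i) ∈ → ∣ʳ-trans (∣ʳ-respˡ-≈ gcd≈ gcd∣a) (∣heads i ∈) } }

    decidable⇒basis : ∀ {d} (L : Submodule A d p) → Contains L → (∀ v → Dec (Submodule.Member L v)) → LatticeBasis L
    decidable⇒basis {d = zero} L D∈ member? = record
      { vector = λ () ; member = λ () ; spans = λ _ → (λ ()) , λ () ; independent = λ _ _ () }
    decidable⇒basis {d = suc d} L D∈ member? =
      fromPivot L vector member head≉0 head-divides
        (decidable⇒basis (headZero L) (λ div → D∈ λ { zero → D ∣0 ; (suc i) → div i }) (λ w → member? (0# ◂ w)))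
      where
      open Submodule L using (Member)
      open Pivot (pivot L D∈ member? (representative (suc d)))
      -- A member is congruent modulo D to one of the residues, which is then a member too; the
      -- pivot divides the head of that residue, and it divides D.
      head-divides : ∀ v → Member v → vector zero ∣ v zero
      head-divides v v∈ = ∣ʳ-respʳ-≈ (move _ (v zero))
        (∣-+ (∣heads (index v) (member-mod L D∈ (representative-index v) v∈))
             (∣ʳ-trans ∣D (∣-flip (representative-index v zero))))
        where
        move : ∀ r v → r + (v - r) ≈ v
        move = solve 2 (λ r v → r :+ (v :- r) := v) refl
      head≉0 : ¬ vector zero ≈ 0#
      head≉0 z = D≉0 (trans (sym (RawMagmaDefinitions._∣ʳ_.equality ∣D)) (y≈0⇒xy≈0 _ z))

    private
      ¬¬-finite : ∀ {n} {P : Fin n → Set p} → (∀ i → ¬ ¬ P i) → ¬ ¬ (∀ i → P i)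
      ¬¬-finite {n = zero}  nn k = k λ ()
      ¬¬-finite {n = suc n} nn k = nn zero λ p₀ → ¬¬-finite (λ i → nn (suc i)) λ ps → k λ { zero → p₀ ; (suc i) → ps i }

    -- Under a double negation membership may be assumed decided for the finitely many residues
    -- modulo D, and they decide it for all vectors.
    ¬¬basis : ∀ {d} (L : Submodule A d p) → Contains L → ¬ ¬ LatticeBasis L
    ¬¬basis {d = d} L D∈ k = ¬¬-finite (λ i → excluded (Member (representative d i))) λ dec →
      k (decidable⇒basis L D∈ λ v → decide v (dec (index v)))
      where
      open Submodule L
      excluded : ∀ {q} (P : Set q) → ¬ ¬ Dec P
      excluded P k = k (no λ p → k (yes p))
      decide : ∀ v → Dec (Member (representative d (index v))) → Dec (Member v)
      decide v (yes r∈) = yes (member-mod L D∈ (λ i → ∣-flip (representative-index v i)) r∈)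
      decide v (no r∉)  = no λ v∈ → r∉ (member-mod L D∈ (representative-index v) v∈)

-- Fraction fields and Gauss's lemma

module PolynomialCoefficients (A : CommutativeRing c ℓ) where

  open Ring A
  open Polynomial A

  all-coeff : ∀ {p} {P : Carrier → Set p} → P 0# → ∀ {U} → All P U → ∀ i → P (coeff U i)
  all-coeff P0 []       i       = P0
  all-coeff P0 (x ∷ xs) zero    = x
  all-coeff P0 (x ∷ xs) (suc i) = all-coeff P0 xs i

  coeff-all : ∀ {p} {P : Carrier → Set p} U → (∀ i → P (coeff U i)) → All P U
  coeff-all []      f = []
  coeff-all (a ∷ U) f = f 0 ∷ coeff-all U (λ i → f (suc i))

-- The field `base?` carries the constructive weight: it yields the decision of integrality from a
-- minimal polynomial and allows a double negation in front of a membership in A to be removed.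
record IsFractionField (A : CommutativeRing c ℓ) (k : CommutativeRing c′ ℓ′) (ι : Hom A k) : Set (c Level.⊔ ℓ Level.⊔ c′ Level.⊔ ℓ′) where
  private
    module A = Ring A
    module k = Ring k
  open RingHomomorphism ι using (⟦_⟧)
  IsBase : k.Carrier → Set _
  IsBase x = ∃[ a ] ⟦ a ⟧ k.≈ x
  field
    isField   : IsField k
    _≟k_      : Decidable k._≈_
    injective : ∀ {x y} → ⟦ x ⟧ k.≈ ⟦ y ⟧ → x A.≈ y
    base?     : ∀ x → Dec (IsBase x)
    cleared   : ∀ x → ∃[ s ] (¬ s A.≈ A.0#) × IsBase (⟦ s ⟧ k.* x)

fractions-isFractionField : (A : CommutativeRing c ℓ) (domain : EuclideanDomain A) → let open CommutativeRing A in
  (1≉0 : ¬ 1# ≈ 0#) (cancel : AlmostLeftCancellative _≈_ 0# _*_) →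
  IsFractionField A (Fractions.commutativeRing A 1≉0 cancel) (Fractions.fromBaseHom A 1≉0 cancel)
fractions-isFractionField A domain 1≉0 cancel = record
  { isField = Frac.isField
  ; _≟k_ = eq?
  ; injective = λ e → trans (sym (*-identityʳ _)) (trans (Frac.cross e) (*-identityʳ _))
  ; base? = base?
  ; cleared = λ x → Frac.den x , Frac.den≉0 x , (Frac.num x , Frac.mk≃ (move (Frac.num x) (Frac.den x)))
  }
  where
  open Ring A
  open EuclideanArithmetic A domain using (_≟_; _∣?_)
  open IntegerSolver A
  module Frac = Fractions A 1≉0 cancel
  eq? : Decidable Frac._≃_
  eq? x y with (Frac.num x * Frac.den y) ≟ (Frac.num y * Frac.den x)
  ... | yes e = yes (Frac.mk≃ e)
  ... | no ne = no λ e → ne (Frac.cross e)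
  base? : ∀ x → Dec (∃[ a ] Frac.fromBase a Frac.≃ x)
  base? x with Frac.den x ∣? Frac.num x
  ... | yes (q , e) = yes (q , Frac.mk≃ (trans e (sym (*-identityʳ _))))
  ... | no ∤ = no λ { (q , Frac.mk≃ e) → ∤ (q , trans e (*-identityʳ _)) }
  move : ∀ n d → n * (1# * d) ≈ (d * n) * 1#
  move = solve 2 (λ n d → n :* (:1 :* d) := (d :* n) :* :1) refl

module FractionField (A : CommutativeRing c ℓ) (domain : EuclideanDomain A)
                     (k : CommutativeRing c′ ℓ′) (φ : Hom A k) (fractionField : IsFractionField A k φ) where

  private module A where
    open Ring A public
    open EuclideanArithmetic A domain public

  open Ring k
  open IsFractionField fractionField public
  private module ι = RingHom A k φ
  open ι using () renaming (⟦_⟧ to frac)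

  base-resp : ∀ {x y} → x ≈ y → IsBase x → IsBase y
  base-resp e (a , f) = a , trans f e

  base-0 : IsBase 0#
  base-0 = A.0# , ι.0#-homo

  base-+ : ∀ {x y} → IsBase x → IsBase y → IsBase (x + y)
  base-+ (a , e) (b , f) = a A.+ b , trans (ι.+-homo a b) (+-cong e f)

  base-* : ∀ {x y} → IsBase x → IsBase y → IsBase (x * y)
  base-* (a , e) (b , f) = a A.* b , trans (ι.*-homo a b) (*-cong e f)

  base-frac : ∀ a → IsBase (frac a)
  base-frac a = a , refl

  base-sum : ∀ {n} {f : Fin n → Carrier} → (∀ i → IsBase (f i)) → IsBase (sum f)
  base-sum {zero}  b = base-0
  base-sum {suc n} b = base-+ (b zero) (base-sum (λ i → b (suc i)))

  frac≉0 : ∀ {s} → ¬ s A.≈ A.0# → ¬ frac s ≈ 0#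
  frac≉0 s≉0 e = s≉0 (injective (trans e (sym ι.0#-homo)))

  *≉0 : ∀ {x y} → ¬ x A.≈ A.0# → ¬ y A.≈ A.0# → ¬ x A.* y A.≈ A.0#
  *≉0 x≉0 y≉0 e = y≉0 (A.*-nonZero x≉0 e)

  private
    multiple-base : ∀ s t x → IsBase (frac s * x) → IsBase (frac (t A.* s) * x)
    multiple-base s t x b = base-resp (trans (sym (*-assoc _ _ x)) (*-congʳ (sym (ι.*-homo t s)))) (base-* (base-frac t) b)

    swap : ∀ s t x → frac (t A.* s) * x ≈ frac (s A.* t) * x
    swap s t x = *-congʳ (ι.⟦⟧-cong (A.*-comm t s))

  commonDenominator : ∀ {n} (f : Fin n → Carrier) → ∃[ s ] (¬ s A.≈ A.0#) × (∀ i → IsBase (frac s * f i))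
  commonDenominator {zero}  f = A.1# , A.1≉0 , λ ()
  commonDenominator {suc n} f with cleared (f zero) | commonDenominator (λ i → f (suc i))
  ... | t , t≉0 , b₀ | s , s≉0 , b = t A.* s , *≉0 t≉0 s≉0 , λ
    { zero    → base-resp (swap t s (f zero)) (multiple-base t s (f zero) b₀)
    ; (suc i) → multiple-base s t (f (suc i)) (b i) }

  private
    module AX = Polynomial A
    module kX = Polynomial k
    module AX′ = Ring AX.commutativeRing
    module kX′ = Ring kX.commutativeRing

  clearList : ∀ (U : List Carrier) → ∃[ s ] (¬ s A.≈ A.0#) × All (λ x → IsBase (frac s * x)) U
  clearList []      = A.1# , A.1≉0 , []
  clearList (x ∷ U) with cleared x | clearList U
  ... | t , t≉0 , b₀ | s , s≉0 , b = t A.* s , *≉0 t≉0 s≉0 ,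
    base-resp (swap t s x) (multiple-base t s x b₀) ∷ All.map (λ {y} → multiple-base s t y) b

  coeff-map : ∀ U i → kX.coeff (map frac U) i ≈ frac (AX.coeff U i)
  coeff-map []      i       = sym ι.0#-homo
  coeff-map (a ∷ U) zero    = refl
  coeff-map (a ∷ U) (suc i) = coeff-map U i

  map-⊕ : ∀ U V → map frac (U AX.⊕ V) kX.≋ map frac U kX.⊕ map frac V
  map-⊕ U V = kX.mk≋ λ i → begin
    kX.coeff (map frac (U AX.⊕ V)) i                        ≈⟨ coeff-map (U AX.⊕ V) i ⟩
    frac (AX.coeff (U AX.⊕ V) i)                            ≈⟨ ι.⟦⟧-cong (AX.coeff-⊕ U V i) ⟩
    frac (AX.coeff U i A.+ AX.coeff V i)                    ≈⟨ ι.+-homo _ _ ⟩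
    frac (AX.coeff U i) + frac (AX.coeff V i)               ≈⟨ sym (+-cong (coeff-map U i) (coeff-map V i)) ⟩
    kX.coeff (map frac U) i + kX.coeff (map frac V) i       ≈⟨ sym (kX.coeff-⊕ (map frac U) (map frac V) i) ⟩
    kX.coeff (map frac U kX.⊕ map frac V) i                 ∎

  map-· : ∀ a U → map frac (a AX.· U) kX.≋ frac a kX.· map frac U
  map-· a U = kX.mk≋ λ i → begin
    kX.coeff (map frac (a AX.· U)) i       ≈⟨ coeff-map (a AX.· U) i ⟩
    frac (AX.coeff (a AX.· U) i)           ≈⟨ ι.⟦⟧-cong (AX.coeff-· a U i) ⟩
    frac (a A.* AX.coeff U i)              ≈⟨ ι.*-homo _ _ ⟩
    frac a * frac (AX.coeff U i)           ≈⟨ *-congˡ (sym (coeff-map U i)) ⟩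
    frac a * kX.coeff (map frac U) i       ≈⟨ sym (kX.coeff-· (frac a) (map frac U) i) ⟩
    kX.coeff (frac a kX.· map frac U) i    ∎

  map-⊗ : ∀ U V → map frac (U AX.⊗ V) kX.≋ map frac U kX.⊗ map frac V
  map-⊗ []      V = kX′.refl
  map-⊗ (a ∷ U) V = kX′.trans (map-⊕ (a AX.· V) (A.0# ∷ U AX.⊗ V))
    (kX′.+-cong {map frac (a AX.· V)} {frac a kX.· map frac V} {map frac (A.0# ∷ U AX.⊗ V)} {0# ∷ map frac U kX.⊗ map frac V}
      (map-· a V) (kX.∷-cong ι.0#-homo (map-⊗ U V)))

  private
    ∣-cancel-+ : ∀ {x y z} → x A.∣ y A.+ z → x A.∣ y → x A.∣ z
    ∣-cancel-+ {x} {y} {z} d e = A.∣ʳ-respʳ-≈ (move y z) (A.∣-+ d (A.∣-neg e))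
      where
      open IntegerSolver A
      move : ∀ y z → (y A.+ z) A.- y A.≈ z
      move = solve 2 (λ y z → (y :+ z) :- y := z) A.refl

    module Content {π : A.Carrier} (irr : A.Irreducible π) where

      Divides : List A.Carrier → Set _
      Divides = All (π A.∣_)

      coeff-step : ∀ a U V i → π A.∣ AX.coeff ((a ∷ U) AX.⊗ V) i → π A.∣ a A.* AX.coeff V i → π A.∣ AX.coeff (A.0# ∷ U AX.⊗ V) i
      coeff-step a U V i d e = ∣-cancel-+ (A.∣ʳ-respʳ-≈ (AX.coeff-⊕ (a AX.· V) (A.0# ∷ U AX.⊗ V) i) d)
        (A.∣ʳ-respʳ-≈ (A.sym (AX.coeff-· a V i)) e)

      -- The constant coefficient of the product is b a, so the prime π divides b; the contribution
      -- of b is then divisible in all degrees and can be removed.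
      by-constantTerm : ∀ V a U → ¬ π A.∣ a → (∀ i → π A.∣ AX.coeff (V AX.⊗ (a ∷ U)) i) → Divides V
      by-constantTerm []      a U π∤a d = []
      by-constantTerm (b ∷ V) a U π∤a d = π∣b ∷ by-constantTerm V a U π∤a
          (λ i → coeff-step b V (a ∷ U) (suc i) (d (suc i)) (times (suc i)))
        where
        π∣b : π A.∣ b
        π∣b = A.euclid irr (A.∣ʳ-respʳ-≈ (A.trans (A.+-identityʳ _) (A.*-comm b a)) (d 0)) π∤a
        times : ∀ i → π A.∣ b A.* AX.coeff (a ∷ U) i
        times i = A.∣ʳ-respʳ-≈ (A.*-comm _ _) (A.x∣ʳy⇒x∣ʳzy (AX.coeff (a ∷ U) i) π∣b)

      -- A prime of A stays prime in A[X]. Low coefficients of `U` divisible by π are stripped off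
      -- until one is not; from there `by-constantTerm` shows that π divides `V`.
      product-divides : ∀ U V → (∀ i → π A.∣ AX.coeff (U AX.⊗ V) i) → Divides U ⊎ Divides V
      product-divides []      V d = inj₁ []
      product-divides (a ∷ U) V d = split (π A.∣? a)
        where
        split : Dec (π A.∣ a) → Divides (a ∷ U) ⊎ Divides V
        split (no π∤a) = inj₂ (by-constantTerm V a U π∤a λ i → A.∣ʳ-respʳ-≈ (AX.at (AX′.*-comm (a ∷ U) V) i) (d i))
        split (yes π∣a) = add-head (product-divides U V λ i → coeff-step a U V (suc i) (d (suc i))
            (A.∣ʳ-respʳ-≈ (A.*-comm _ _) (A.x∣ʳy⇒x∣ʳzy (AX.coeff V (suc i)) π∣a)))
          where
          add-head : Divides U ⊎ Divides V → Divides (a ∷ U) ⊎ Divides V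
          add-head (inj₁ dU) = inj₁ (π∣a ∷ dU)
          add-head (inj₂ dV) = inj₂ dV

      divideList : ∀ {U} → Divides U → List A.Carrier
      divideList []                = []
      divideList ((q A., _) ∷ ds) = q ∷ divideList ds

      divideList-coeff : ∀ {U} (ds : Divides U) i → π A.* AX.coeff (divideList ds) i A.≈ AX.coeff U i
      divideList-coeff []               i       = A.zeroʳ π
      divideList-coeff ((q A., e) ∷ ds) zero    = A.trans (A.*-comm π q) e
      divideList-coeff (_ ∷ ds)         (suc i) = divideList-coeff ds i

      divideList-≋ : ∀ {U} (ds : Divides U) → U AX.≋ (π ∷ []) AX.⊗ divideList ds
      divideList-≋ {U} ds = AX.mk≋ λ i → A.sym (A.trans (AX.coeff-⊕ (π AX.· W) (A.0# ∷ []) i)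
        (A.trans (A.+-congˡ (zeros i)) (A.trans (A.+-identityʳ _) (A.trans (AX.coeff-· π W i) (divideList-coeff ds i)))))
        where
        W = divideList ds
        zeros : ∀ i → AX.coeff (A.0# ∷ []) i A.≈ A.0#
        zeros zero    = A.refl
        zeros (suc i) = A.refl

    π⊗-coeff : ∀ π W i → AX.coeff ((π ∷ []) AX.⊗ W) i A.≈ π A.* AX.coeff W i
    π⊗-coeff π W i = A.trans (AX.coeff-⊕ (π AX.· W) (A.0# ∷ []) i)
      (A.trans (A.+-congˡ (zeros i)) (A.trans (A.+-identityʳ _) (AX.coeff-· π W i)))
      where
      zeros : ∀ i → AX.coeff (A.0# ∷ []) i A.≈ A.0#
      zeros zero    = A.refl
      zeros (suc i) = A.refl

  -- Induction on the degree of u v: a prime factor of u v divides all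
  -- coefficients of U V, hence all those of U or of V, and cancels.
  gauss : ∀ N {n} → n ℕ.≤ N → ∀ u v (U V R : List A.Carrier) e f → A.HasDegree (u A.* v) n →
          AX.coeff U e A.≈ u → AX.coeff V f A.≈ v →
          (∀ i → AX.coeff (U AX.⊗ V) i A.≈ (u A.* v) A.* AX.coeff R i) → ∀ i → u A.∣ AX.coeff U i
  gauss N {n} n≤N u v U V R e f duv Ue≈u Vf≈v UV≈ = unitOrNot ((u A.* v) A.∣? A.1#)
    where
    Goal = ∀ i → u A.∣ AX.coeff U i
    unitOrNot : Dec ((u A.* v) A.∣ A.1#) → Goal
    unitOrNot (yes uv∣1) i = A.∣ʳ-trans u∣1 (AX.coeff U i A., A.*-identityʳ _)
      where
      u∣1 : u A.∣ A.1#
      u∣1 = A.∣ʳ-trans (v A., A.*-comm v u) uv∣1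
    unitOrNot (no uv∤1) = withPrime (A.irreducibleFactor (A.degree⇒≉0 duv) uv∤1)
      where
      withPrime : (∃[ π ] A.Irreducible π × π A.∣ (u A.* v)) → Goal
      withPrime (π , irr , (h A., hπ≈uv)) = cases N n≤N (product-divides U V λ i →
          A.∣ʳ-respʳ-≈ (A.sym (UV≈ i)) (A.∣ʳ-respʳ-≈ (A.*-comm _ _) (A.x∣ʳy⇒x∣ʳzy (AX.coeff R i) (h A., hπ≈uv))))
        where
        open Content irr
        π≉0 = A.irreducible≉0 irr
        π∤1 = RingNotions.Irreducible.p∤1 {R = A} irr
        cases : ∀ N → n ℕ.≤ N → Divides U ⊎ Divides V → Goal
        cases zero n≤0 _ = ⊥-elim (ℕ.n≮0 (ℕ.<-≤-trans (proj₂
            (proj₂ (A.cofactor-degree duv (A.trans (A.sym hπ≈uv) (A.*-comm h π)) π∤1))) n≤0))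
        cases (suc N) n≤N (inj₁ dU) i = A.∣ʳ-respˡ-≈ πu₁≈u (A.∣ʳ-respʳ-≈ (divideList-coeff dU i)
            (scaled (gauss N (ℕ.≤-pred (ℕ.≤-trans (proj₂ (proj₂ deg)) n≤N)) u₁ v U₁ V R e f
                (proj₁ (proj₂ deg)) A.refl Vf≈v (λ j → A.trans (A.*-cancelˡ π≉0 (eq′ j)) (AX.coeff-· (u₁ A.* v) R j)) i)))
          where
          U₁ = divideList dU
          u₁ = AX.coeff U₁ e
          πu₁≈u : π A.* u₁ A.≈ u
          πu₁≈u = A.trans (divideList-coeff dU e) Ue≈u
          deg = A.cofactor-degree duv (A.trans (A.*-congʳ (A.sym πu₁≈u)) (A.*-assoc π u₁ v)) π∤1
          scaledR = (u₁ A.* v) AX.· R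
          scaled : ∀ {x} → u₁ A.∣ x → (π A.* u₁) A.∣ (π A.* x)
          scaled d = A.∙-cong-∣ A.∣ʳ-refl d
          eq′ : ∀ i → π A.* AX.coeff (U₁ AX.⊗ V) i A.≈ π A.* AX.coeff scaledR i
          eq′ i = A.trans (A.sym (π⊗-coeff π (U₁ AX.⊗ V) i)) (A.trans (AX.at assoc i) (A.trans (UV≈ i)
            (A.trans (A.*-congʳ (A.trans (A.*-congʳ (A.sym πu₁≈u)) (A.*-assoc π u₁ v)))
                (A.trans (A.*-assoc π _ _) (A.*-congˡ (A.sym (AX.coeff-· (u₁ A.* v) R i)))))))
            where
            assoc : (π ∷ []) AX.⊗ (U₁ AX.⊗ V) AX.≋ U AX.⊗ V
            assoc = AX′.trans (AX′.sym (AX′.*-assoc (π ∷ []) U₁ V))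
                (AX′.*-cong {_} {U} {V} {V} (AX′.sym (divideList-≋ dU)) AX′.refl)
        cases (suc N) n≤N (inj₂ dV) = gauss N (ℕ.≤-pred (ℕ.≤-trans (proj₂ (proj₂ deg)) n≤N)) u v₁ U V₁ R e f
            (proj₁ (proj₂ deg)) Ue≈u A.refl
            (λ i → A.trans (A.*-cancelˡ π≉0 (eq′ i)) (AX.coeff-· (u A.* v₁) R i))
          where
          V₁ = divideList dV
          v₁ = AX.coeff V₁ f
          πv₁≈v : π A.* v₁ A.≈ v
          πv₁≈v = A.trans (divideList-coeff dV f) Vf≈v
          uv≈ : u A.* v A.≈ π A.* (u A.* v₁)
          uv≈ = A.trans (A.*-congˡ (A.sym πv₁≈v)) (move u π v₁)
            where
            open IntegerSolver A
            move : ∀ u π v → u A.* (π A.* v) A.≈ π A.* (u A.* v)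
            move = solve 3 (λ u π v → u :* (π :* v) := π :* (u :* v)) A.refl
          deg = A.cofactor-degree duv uv≈ π∤1
          scaledR = (u A.* v₁) AX.· R
          eq′ : ∀ i → π A.* AX.coeff (U AX.⊗ V₁) i A.≈ π A.* AX.coeff scaledR i
          eq′ i = A.trans (A.sym (π⊗-coeff π (U AX.⊗ V₁) i)) (A.trans (AX.at assoc i) (A.trans (UV≈ i)
            (A.trans (A.*-congʳ uv≈) (A.trans (A.*-assoc π _ _) (A.*-congˡ (A.sym (AX.coeff-· (u A.* v₁) R i)))))))
            where
            assoc : (π ∷ []) AX.⊗ (U AX.⊗ V₁) AX.≋ U AX.⊗ V
            assoc = AX′.trans (AX′.sym (AX′.*-assoc (π ∷ []) U V₁))
                (AX′.trans (AX′.*-cong {(π ∷ []) AX.⊗ U} {U AX.⊗ (π ∷ [])} {V₁} {V₁} (AX′.*-comm (π ∷ []) U) AX′.refl)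
              (AX′.trans (AX′.*-assoc U (π ∷ []) V₁) (AX′.*-cong {U} {U} {_} {V} AX′.refl (AX′.sym (divideList-≋ dV)))))

-- Integral elements and minimal polynomials

private
  module Rearrangements (R : CommutativeRing c ℓ) where

    open Ring R
    open IntegerSolver R

    interchange : ∀ a m b h → (a * m) * (b * h) ≈ (a * b) * (h * m)
    interchange = solve 4 (λ a m b h → (a :* m) :* (b :* h) := (a :* b) :* (h :* m)) refl

    scaled-step : ∀ t s a x e → t * (s * a) + (s * x) * (t * e) ≈ (s * t) * (a + x * e)
    scaled-step = solve 5 (λ t s a x e → t :* (s :* a) :+ (s :* x) :* (t :* e) := (s :* t) :* (a :+ x :* e)) refl

module Integrality (A : CommutativeRing c ℓ) (domain : EuclideanDomain A)
  (k : CommutativeRing c₁ ℓ₁) (φ : Hom A k) (fractionField : IsFractionField A k φ)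
  {d : ℕ} (E : FiniteExtension k d c₂ ℓ₂)
  (ψ : Hom A (FiniteExtension.K E))
  (coherent : ∀ a → FiniteExtension._≈_ E (RingHomomorphism.⟦_⟧ ψ a) (FiniteExtension.⟦_⟧ E (RingHomomorphism.⟦_⟧ φ a))) where

  open FiniteExtension E using (K; ι)
  private module A where
    open Ring A public
    open EuclideanArithmetic A domain public
  private
    module k = Ring k
    module φ = RingHom A k φ
    module ι = RingHom k K ι
    module ψ = RingHom A K ψ
    module AX = Polynomial A
    module kX = Polynomial k
    module kX′ = Ring kX.commutativeRing
    module EA = Evaluation A K ψ
    module Ek = Evaluation k K ι
  open FractionField A domain k φ fractionField
  open Ring K
  open IntegralClosure A K ψ using (IsIntegral)
  open IsField isField using (0≉1)

  private
    module Dom = kX.Domain isField _≟k_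

    eval-map : ∀ U x → Ek.eval (map φ.⟦_⟧ U) x ≈ EA.eval U x
    eval-map []      x = refl
    eval-map (a ∷ U) x = +-cong (sym (coherent a)) (*-congˡ (eval-map U x))

    unmap : ∀ {m} → All IsBase m → ∃[ U ] map φ.⟦_⟧ U kX.≋ m
    unmap []             = [] , kX′.refl
    unmap ((a , e) ∷ bs) = a ∷ proj₁ (unmap bs) , kX.∷-cong e (proj₂ (unmap bs))

    clearPolynomial : ∀ m → ∃[ s ] ∃[ U ] (¬ s A.≈ A.0#) × (∀ i → φ.⟦ AX.coeff U i ⟧ k.≈ φ.⟦ s ⟧ k.* kX.coeff m i)
                                          × map φ.⟦_⟧ U kX.≋ φ.⟦ s ⟧ kX.· m
    clearPolynomial m with clearList m
    ... | s , s≉0 , bs with unmap (All.map⁺ {f = φ.⟦ s ⟧ k.*_} bs)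
    ... | U , e = s , U , s≉0 , (λ i → k.trans (k.sym (coeff-map U i)) (k.trans (kX.at e i) (kX.coeff-· φ.⟦ s ⟧ m i))) , e

    ·≋const : ∀ s m → s kX.· m kX.≋ kX.const s kX.⊗ m
    ·≋const s m = kX.mk≋ λ i → k.sym (k.trans (kX.coeff-⊕ (s kX.· m) (k.0# ∷ []) i)
        (k.trans (k.+-congˡ (zeros i)) (k.+-identityʳ _)))
      where
      zeros : ∀ i → kX.coeff (k.0# ∷ []) i k.≈ k.0#
      zeros zero    = k.refl
      zeros (suc i) = k.refl

    map-monic : ∀ {p n} → AX.MonicOfDegree p n → kX.MonicOfDegree (map φ.⟦_⟧ p) n
    map-monic {p} {n} (lead , above) = k.trans (coeff-map p n) (k.trans (φ.⟦⟧-cong lead) φ.1#-homo) ,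
      λ i n<i → k.trans (coeff-map p i) (k.trans (φ.⟦⟧-cong (above i n<i)) φ.0#-homo)

    -- To apply `gauss`, the cleared multiple of `h` must have a coefficient equal to the clearing
    -- factor. The leading one qualifies: leading coefficients multiply, and those of `m` and `p`
    -- are 1.
    monicCofactor : ∀ h m p {e n} → kX.MonicOfDegree m e → kX.MonicOfDegree p n → h kX.⊗ m kX.≋ p → ∃[ f ] kX.coeff h f k.≈ k.1#
    monicCofactor h m p {e} {n} (lead-m , above-m) (lead-p , above-p) hm≋p = split (Dom.zeroOrDegree h)
      where
      split : h kX.≋ [] ⊎ ∃ (kX.HasDegree h) → ∃[ f ] kX.coeff h f k.≈ k.1#
      split (inj₁ h≋0) = ⊥-elim (0≉1 (k.sym (k.trans (k.sym lead-p)
          (kX.at (kX′.trans (kX′.sym hm≋p) (kX′.x≈0⇒xy≈0 {h} m h≋0)) n))))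
      split (inj₂ (f , hf≉0 , above-h)) = f , (compare (ℕ.<-cmp (f ℕ.+ e) n))
        where
        top : kX.coeff h f k.≈ kX.coeff p (f ℕ.+ e)
        top = k.trans (k.sym (k.*-identityʳ _)) (k.trans (k.*-congˡ (k.sym lead-m))
          (k.trans (k.sym (kX.coeff-⊗-top f e h m above-h above-m)) (kX.at hm≋p (f ℕ.+ e))))
        compare : _ → kX.coeff h f k.≈ k.1#
        compare (tri< lt _ _) = ⊥-elim (0≉1 (k.sym (k.trans (k.sym lead-p)
            (k.trans (k.sym (kX.at hm≋p n)) (kX.below-⊗ (suc f) h m above-h above-m n lt)))))
        compare (tri≈ _ eq _) = k.trans top (k.trans (k.reflexive (≡.cong (kX.coeff p) eq)) lead-p)
        compare (tri> _ _ gt) = ⊥-elim (hf≉0 (k.trans top (above-p (f ℕ.+ e) gt)))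

    scaled-product : ∀ s t m h → (s kX.· m) kX.⊗ (t kX.· h) kX.≋ (s k.* t) kX.· (h kX.⊗ m)
    scaled-product s t m h = kX′.trans (kX′.*-cong {s kX.· m} {kX.const s kX.⊗ m} {t kX.· h} {kX.const t kX.⊗ h}
        (·≋const s m) (·≋const t h))
      (kX′.trans (interchange (kX.const s) m (kX.const t) h)
        (kX′.trans (kX′.*-cong {kX.const s kX.⊗ kX.const t} {kX.const (s k.* t)} {h kX.⊗ m} {h kX.⊗ m}
            (kX.∷-cong (k.+-identityʳ _) kX′.refl) kX′.refl)
          (kX′.sym (·≋const (s k.* t) (h kX.⊗ m)))))
      where open Rearrangements kX.commutativeRing

  -- With s m and t h over A, their product is s t p with p over A, while s and t occur among their
  -- coefficients because m and h are monic. By `gauss`, s divides every coefficient of s m, and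
  -- cancelling s leaves m over A.
  monicDivisor-base : ∀ {h m p e n} → kX.MonicOfDegree m e → AX.MonicOfDegree p n → h kX.⊗ m kX.≋ map φ.⟦_⟧ p → ∀ i → IsBase (kX.coeff m i)
  monicDivisor-base {h} {m} {p} {e} {n} monic-m monic-p hm≋p = conclude (clearPolynomial m) (clearPolynomial h)
      (monicCofactor h m (map φ.⟦_⟧ p) monic-m (map-monic {p} monic-p) hm≋p)
    where
    conclude : (∃[ s ] ∃[ U ] (¬ s A.≈ A.0#) × (∀ i → φ.⟦ AX.coeff U i ⟧ k.≈ φ.⟦ s ⟧ k.* kX.coeff m i) × map φ.⟦_⟧ U kX.≋ φ.⟦ s ⟧ kX.· m) →
               (∃[ t ] ∃[ V ] (¬ t A.≈ A.0#) × (∀ i → φ.⟦ AX.coeff V i ⟧ k.≈ φ.⟦ t ⟧ k.* kX.coeff h i) × map φ.⟦_⟧ V kX.≋ φ.⟦ t ⟧ kX.· h) →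
               (∃[ f ] kX.coeff h f k.≈ k.1#) → ∀ i → IsBase (kX.coeff m i)
    conclude (s , U , s≉0 , U≈ , U≋) (t , V , t≉0 , V≈ , V≋) (f , hf≈1) i = finish
        (gauss _ ℕ.≤-refl s t U V p e f (proj₂ (A.degree (*≉0 s≉0 t≉0)))
        (injective (k.trans (U≈ e) (k.trans (k.*-congˡ (proj₁ monic-m)) (k.*-identityʳ _))))
        (injective (k.trans (V≈ f) (k.trans (k.*-congˡ hf≈1) (k.*-identityʳ _))))
        (λ j → injective (product j)) i)
      where
      product : ∀ j → φ.⟦ AX.coeff (U AX.⊗ V) j ⟧ k.≈ φ.⟦ (s A.* t) A.* AX.coeff p j ⟧
      product j = k.begin
        φ.⟦ AX.coeff (U AX.⊗ V) j ⟧                              k.≈⟨ k.sym (coeff-map (U AX.⊗ V) j) ⟩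
        kX.coeff (map φ.⟦_⟧ (U AX.⊗ V)) j                        k.≈⟨ kX.at (map-⊗ U V) j ⟩
        kX.coeff (map φ.⟦_⟧ U kX.⊗ map φ.⟦_⟧ V) j                k.≈⟨ kX.at
            (kX′.*-cong {map φ.⟦_⟧ U} {φ.⟦ s ⟧ kX.· m} {map φ.⟦_⟧ V} {φ.⟦ t ⟧ kX.· h} U≋ V≋) j ⟩
        kX.coeff ((φ.⟦ s ⟧ kX.· m) kX.⊗ (φ.⟦ t ⟧ kX.· h)) j      k.≈⟨ kX.at (scaled-product φ.⟦ s ⟧ φ.⟦ t ⟧ m h) j ⟩
        kX.coeff ((φ.⟦ s ⟧ k.* φ.⟦ t ⟧) kX.· (h kX.⊗ m)) j       k.≈⟨ kX.coeff-· (φ.⟦ s ⟧ k.* φ.⟦ t ⟧) (h kX.⊗ m) j ⟩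
        (φ.⟦ s ⟧ k.* φ.⟦ t ⟧) k.* kX.coeff (h kX.⊗ m) j          k.≈⟨ k.*-cong (k.sym (φ.*-homo s t))
            (k.trans (kX.at hm≋p j) (coeff-map p j)) ⟩
        φ.⟦ s A.* t ⟧ k.* φ.⟦ AX.coeff p j ⟧                     k.≈⟨ k.sym (φ.*-homo _ _) ⟩
        φ.⟦ (s A.* t) A.* AX.coeff p j ⟧                         k.∎
      finish : s A.∣ AX.coeff U i → IsBase (kX.coeff m i)
      finish (q A., qs≈U) = q , k.x∙y⁻¹≈ε⇒x≈y _ _ (FieldLinearAlgebra.*-nonZero k isField _≟k_ (frac≉0 s≉0)
          (k.trans (k.x[y-z]≈xy-xz _ _ _)
        (k.x≈y⇒x∙y⁻¹≈ε (k.trans (k.*-comm _ _) (k.trans (k.sym (φ.*-homo q s)) (k.trans (φ.⟦⟧-cong qs≈U) (U≈ i)))))))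

  module _ {x m} (minimal : IsMinimalPolynomial E x m) where

    open IsMinimalPolynomial minimal

    integral⇒base : IsIntegral x → ∀ i → IsBase (kX.coeff m i)
    integral⇒base (p , n , monic-p , root-p) = let (h RawMagmaDefinitions., e) = divides (map φ.⟦_⟧ p) (trans (eval-map p x) root-p) in
      monicDivisor-base {h} {m} {p} monic monic-p e

    base⇒integral : All IsBase m → IsIntegral x
    base⇒integral bs with unmap bs
    ... | U , e = U , degree , (injective (k.trans (coeff≈ degree) (k.trans (proj₁ monic) (k.sym φ.1#-homo))) ,
                                λ i n<i → injective (k.trans (coeff≈ i) (k.trans (proj₂ monic i n<i) (k.sym φ.0#-homo)))) ,
                  trans (sym (eval-map U x)) (trans (Ek.eval-cong (map φ.⟦_⟧ U) m e) root)
      where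
      coeff≈ : ∀ i → φ.⟦ AX.coeff U i ⟧ k.≈ kX.coeff m i
      coeff≈ i = k.trans (k.sym (coeff-map U i)) (kX.at e i)

    integral? : Dec (IsIntegral x)
    integral? with All.all? base? m
    ... | yes bs = yes (base⇒integral bs)
    ... | no ¬bs = no λ int → ¬bs (PolynomialCoefficients.coeff-all k m (integral⇒base int))

    private
      -- From ∑ m_i x^i = 0 with s m_i ∈ A follows ∑ s^(n-i) m_i (s x)^i = 0.
      rescale : ∀ s n m → kX.MonicOfDegree m n → All (λ y → IsBase (φ.⟦ s ⟧ k.* y)) m →
                ∃[ p ] AX.MonicOfDegree p n × EA.eval p (ψ.⟦ s ⟧ * x) ≈ ψ.⟦ s ⟧ ^ n * Ek.eval m x
      rescale s n       []      (lead , _)     bs = ⊥-elim (0≉1 lead)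
      rescale s zero    (a ∷ m) (lead , above) bs = A.1# ∷ [] , (A.refl , λ { (suc i) _ → A.refl }) , (begin
        ψ.⟦ A.1# ⟧ + (ψ.⟦ s ⟧ * x) * 0#     ≈⟨ +-cong (trans ψ.1#-homo (sym (trans (ι.⟦⟧-cong lead) ι.1#-homo)))
                                                 (trans (zeroʳ _)
                                                     (sym (trans
                                                         (*-congˡ (Ek.eval-zero m
                                                             (kX.mk≋ λ i → above (suc i) (s≤s z≤n)))) (zeroʳ x)))) ⟩
        ι.⟦ a ⟧ + x * Ek.eval m x           ≈⟨ sym (*-identityˡ _) ⟩
        1# * (ι.⟦ a ⟧ + x * Ek.eval m x)    ∎)
      rescale s (suc n) (a ∷ m) (lead , above) ((b , e) ∷ bs) with rescale s n m (lead , λ i n<i → above (suc i) (s≤s n<i)) bs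
      -- The new constant term is s^(n+1) a. It is taken as s^n b, because b in A represents s a
      -- whereas a itself lies only in k.
      ... | p , (lead-p , above-p) , eq = s A.^ n A.* b ∷ p , (lead-p , λ { (suc i) (s≤s n<i) → above-p i n<i }) , (begin
        ψ.⟦ s A.^ n A.* b ⟧ + (ψ.⟦ s ⟧ * x) * EA.eval p (ψ.⟦ s ⟧ * x)
          ≈⟨ +-cong (trans (ψ.*-homo _ b) (*-cong (ψ.^-homo s n)
              (trans (coherent b) (trans (ι.⟦⟧-cong e) (trans (ι.*-homo _ _) (*-congʳ (sym (coherent s)))))))) (*-congˡ eq) ⟩
        ψ.⟦ s ⟧ ^ n * (ψ.⟦ s ⟧ * ι.⟦ a ⟧) + (ψ.⟦ s ⟧ * x) * (ψ.⟦ s ⟧ ^ n * Ek.eval m x)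
          ≈⟨ scaled-step (ψ.⟦ s ⟧ ^ n) ψ.⟦ s ⟧ ι.⟦ a ⟧ x (Ek.eval m x) ⟩
        ψ.⟦ s ⟧ ^ suc n * (ι.⟦ a ⟧ + x * Ek.eval m x) ∎)
        where open Rearrangements K

    integralMultiple : ∃[ s ] (¬ s A.≈ A.0#) × IsIntegral (ψ.⟦ s ⟧ * x)
    integralMultiple with clearList m
    ... | s , s≉0 , bs with rescale s degree m monic bs
    ... | p , monic-p , eq = s , s≉0 , (p , degree , monic-p , trans eq (trans (*-congˡ root) (zeroʳ _)))

-- Lattices in the extension and traces of integers

module TripleProducts (R : CommutativeRing c ℓ) where

  open Ring R
  open IntegerSolver R

  xy·zw≈zx·wy : ∀ x y z w → (x * y) * (z * w) ≈ (z * x) * (w * y)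
  xy·zw≈zx·wy = solve 4 (λ x y z w → (x :* y) :* (z :* w) := (z :* x) :* (w :* y)) refl

  x·yz≈y·xz : ∀ x y z → x * (y * z) ≈ y * (x * z)
  x·yz≈y·xz = solve 3 (λ x y z → x :* (y :* z) := y :* (x :* z)) refl

  horner : ∀ a x e z y → (a + x * e) * z - (x * y) * z ≈ a * (1# * z) + (e * (x * z) - y * (x * z))
  horner = solve 5 (λ a x e z y → (a :+ x :* e) :* z :- (x :* y) :* z := a :* (:1 :* z) :+ (e :* (x :* z) :- y :* (x :* z))) refl

  negate-difference : ∀ y z → z ≈ y - (y - z)
  negate-difference = solve 2 (λ y z → z := y :- (y :- z)) refl

-- Independence of `w` says that its coordinate matrix in the given basis is nondegenerate, and in
-- finite dimension this makes every coordinate vector attainable.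
independent⇒basis : (k : CommutativeRing c ℓ) → IsField k → Decidable (CommutativeRing._≈_ k) →
  (K : CommutativeRing c₁ ℓ₁) (ι : Hom k K) {d : ℕ} → Basis k K ι d → (w : Fin d → CommutativeRing.Carrier K) →
  (∀ (a : Fin d → CommutativeRing.Carrier k) →
     CommutativeRing._≈_ K (Ring.sum K (λ i → CommutativeRing._*_ K (RingHomomorphism.⟦_⟧ ι (a i)) (w i)))
         (CommutativeRing.0# K) →
     ∀ i → CommutativeRing._≈_ k (a i) (CommutativeRing.0# k)) →
  Basis k K ι d
independent⇒basis k isField _≟_ K ι {d} fb w independent = record
  { basis = w
  ; coordinate = λ x → proj₁ (solution x)
  ; expansion = λ x → trans (B.expansion x) (trans (B.combination-cong λ j → k.sym
      (k.trans (coordinates (proj₁ (solution x)) j) (proj₂ (solution x) j)))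
      (sym (B.expansion _)))
  ; independent = independent
  }
  where
  open Ring K
  module k = Ring k
  module B = FreeAlgebra k K ι fb
  open RingHom k K ι using (⟦_⟧)
  coordinates : ∀ (a : Fin d → k.Carrier) j → B.coordinate (sum (λ i → ⟦ a i ⟧ * w i)) j k.≈ k.sum
      (λ i → a i k.* B.coordinate (w i) j)
  coordinates a j = k.trans (B.coordinate-sum (λ i → ⟦ a i ⟧ * w i) j) (k.sum-cong λ i → B.coordinate-scale (a i) (w i) j)
  solution : ∀ x → Σ[ v ∈ (Fin d → k.Carrier) ] ∀ j → k.sum (λ i → v i k.* B.coordinate (w i) j) k.≈ B.coordinate x j
  solution x = FieldLinearAlgebra.nondegenerate⇒surjective k isField _≟_ d (λ i j → B.coordinate (w i) j)
    (λ v ker → independent v (B.zeroCoordinates⇒≈0 λ j → k.trans (coordinates v j) (ker j))) (B.coordinate x)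

-- Dividing the basis by `t` multiplies coordinates by `t`, so a common bound for denominators
-- becomes a basis in which no denominators occur.
scaleBasis : (k : CommutativeRing c ℓ) (K : CommutativeRing c₁ ℓ₁) (ι : Hom k K) {d : ℕ} → let open CommutativeRing k in
  ∀ t t⁻¹ → t * t⁻¹ ≈ 1# → Basis k K ι d → Basis k K ι d
scaleBasis k K ι t t⁻¹ inv fb = record
  { basis = λ i → ⟦ t⁻¹ ⟧ * B.basis i
  ; coordinate = λ x i → t k.* B.coordinate x i
  ; expansion = λ x → trans (B.expansion x) (sum-cong λ i → sym (trans (*-congʳ (*-homo t (B.coordinate x i)))
      (trans (xy·zw≈zx·wy ⟦ t ⟧ _ ⟦ t⁻¹ ⟧ (B.basis i)) (trans (*-cong unit (*-comm _ _)) (*-identityˡ _)))))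
  ; independent = λ a e i → k.trans (k.sym (k.trans (k.*-congʳ inv) (k.*-identityˡ (a i))))
      (k.trans (k.*-assoc t t⁻¹ (a i)) (k.y≈0⇒xy≈0 t (B.independent (λ i → t⁻¹ k.* a i)
        (trans (sum-cong λ i → trans (*-congʳ (trans (*-homo t⁻¹ (a i)) (*-comm _ _))) (*-assoc _ _ _)) e) i)))
  }
  where
  open Ring K
  module k = Ring k
  module B = Basis fb
  open RingHom k K ι using (⟦_⟧; *-homo; ⟦⟧-cong; 1#-homo)
  open TripleProducts K
  unit : ⟦ t⁻¹ ⟧ * ⟦ t ⟧ ≈ 1#
  unit = trans (sym (*-homo t⁻¹ t)) (trans (⟦⟧-cong (k.trans (k.*-comm t⁻¹ t) inv)) 1#-homo)

module IntegerLattices (A : CommutativeRing c ℓ) (domain : EuclideanDomain A)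
  (k : CommutativeRing c₁ ℓ₁) (φ : Hom A k) (fractionField : IsFractionField A k φ)
  {d : ℕ} (E : FiniteExtension k d c₂ ℓ₂)
  (ψ : Hom A (FiniteExtension.K E))
  (coherent : ∀ a → FiniteExtension._≈_ E (RingHomomorphism.⟦_⟧ ψ a) (FiniteExtension.⟦_⟧ E (RingHomomorphism.⟦_⟧ φ a))) where

  open FiniteExtension E using (K; ι)
  private module A where
    open Ring A public
    open EuclideanArithmetic A domain public
  private
    module k = Ring k
    module φ = RingHom A k φ
    module ι = RingHom k K ι
    module ψ = RingHom A K ψ
    module AX = Polynomial A
    module EA = Evaluation A K ψ
  open FractionField A domain k φ fractionField
  open Ring K
  module 𝒪 = IntegralClosure A K ψ
  open 𝒪 using (IsIntegral)
  open TripleProducts K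
  open Lattices A domain

  extensionBasis : Basis k K ι d
  extensionBasis = record
    { basis = FiniteExtension.basis E ; coordinate = FiniteExtension.coordinate E
    ; expansion = FiniteExtension.expansion E ; independent = FiniteExtension.independent E }

  module Embedding (fb : Basis k K ι d) where

    open FreeAlgebra k K ι fb

    embed : (Fin d → A.Carrier) → Carrier
    embed v = combination (λ j → φ.⟦ v j ⟧)

    embed-cong : ∀ {v w} → (∀ j → v j A.≈ w j) → embed v ≈ embed w
    embed-cong e = combination-cong λ j → φ.⟦⟧-cong (e j)

    embed-+ : ∀ v w → embed (λ j → v j A.+ w j) ≈ embed v + embed w
    embed-+ v w = trans (combination-cong λ j → φ.+-homo (v j) (w j)) (combination-+ (λ j → φ.⟦ v j ⟧) (λ j → φ.⟦ w j ⟧))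

    embed-scale : ∀ a v → embed (λ j → a A.* v j) ≈ ψ.⟦ a ⟧ * embed v
    embed-scale a v = trans (combination-cong λ j → φ.*-homo a (v j))
      (trans (combination-scale φ.⟦ a ⟧ (λ j → φ.⟦ v j ⟧)) (*-congʳ (sym (coherent a))))

    embed-zero : ∀ {v} → (∀ j → v j A.≈ A.0#) → embed v ≈ 0#
    embed-zero e = combination-zero λ j → k.trans (φ.⟦⟧-cong (e j)) φ.0#-homo

    embed-sum : ∀ {n} (a : Fin n → A.Carrier) (u : Fin n → Fin d → A.Carrier) →
                embed (λ i → A.sum (λ j → a j A.* u j i)) ≈ sum (λ j → ψ.⟦ a j ⟧ * embed (u j))
    embed-sum {zero}  a u = embed-zero λ _ → A.refl
    embed-sum {suc n} a u = trans (embed-+ (λ i → a zero A.* u zero i) _)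
      (+-cong (embed-scale (a zero) (u zero)) (embed-sum (λ j → a (suc j)) (λ j → u (suc j))))

    embed≈0⇒≈0 : ∀ {v} → embed v ≈ 0# → ∀ j → v j A.≈ A.0#
    embed≈0⇒≈0 e j = injective (k.trans (independent _ e j) (k.sym φ.0#-homo))

    coordinate-ψ : ∀ a x j → coordinate (ψ.⟦ a ⟧ * x) j k.≈ φ.⟦ a ⟧ k.* coordinate x j
    coordinate-ψ a x j = k.trans (coordinate-cong (*-congʳ (coherent a)) j) (coordinate-scale φ.⟦ a ⟧ x j)

    module _ {L : Submodule A d p} (lb : LatticeBasis L) where

      open LatticeBasis lb using (vector) renaming (independent to vector-independent)

      vectors : Fin d → Carrier
      vectors j = embed (vector j)

      vectors-independent : ∀ (a : Fin d → A.Carrier) → sum (λ j → ψ.⟦ a j ⟧ * vectors j) ≈ 0# → ∀ j → a j A.≈ A.0#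
      vectors-independent a e = vector-independent a (embed≈0⇒≈0 (trans (embed-sum a vector) e))

      -- A relation over k becomes one over A after multiplication by a common denominator of its
      -- coefficients.
      latticeBasis⇒basis : Basis k K ι d
      latticeBasis⇒basis = independent⇒basis k isField _≟k_ K ι fb vectors independent-k
        where
        independent-k : ∀ (a : Fin d → k.Carrier) → sum (λ j → ι.⟦ a j ⟧ * vectors j) ≈ 0# → ∀ j → a j k.≈ k.0#
        independent-k a e j with commonDenominator a
        ... | s , s≉0 , base = FieldLinearAlgebra.*-nonZero k isField _≟k_ (frac≉0 s≉0)
          (k.trans (k.sym (proj₂ (base j))) (k.trans (φ.⟦⟧-cong
              (vectors-independent (λ j → proj₁ (base j)) zero-sum j)) φ.0#-homo))
          where
          zero-sum : sum (λ j → ψ.⟦ proj₁ (base j) ⟧ * vectors j) ≈ 0#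
          zero-sum = begin
            sum (λ j → ψ.⟦ proj₁ (base j) ⟧ * vectors j)
              ≈⟨ sum-cong (λ j → *-congʳ {vectors j} (trans (coherent _) (trans (ι.⟦⟧-cong (proj₂ (base j))) (ι.*-homo _ _)))) ⟩
            sum (λ j → ι.⟦ φ.⟦ s ⟧ ⟧ * ι.⟦ a j ⟧ * vectors j)
              ≈⟨ sum-cong (λ j → *-assoc ι.⟦ φ.⟦ s ⟧ ⟧ ι.⟦ a j ⟧ (vectors j)) ⟩
            sum (λ j → ι.⟦ φ.⟦ s ⟧ ⟧ * (ι.⟦ a j ⟧ * vectors j))
              ≈⟨ sym (*-distribˡ-sum ι.⟦ φ.⟦ s ⟧ ⟧ (λ j → ι.⟦ a j ⟧ * vectors j)) ⟩
            ι.⟦ φ.⟦ s ⟧ ⟧ * sum (λ j → ι.⟦ a j ⟧ * vectors j)      ≈⟨ y≈0⇒xy≈0 _ e ⟩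
            0#                                                    ∎

      coordinate-vectors : ∀ {x} (a : Fin d → A.Carrier) → x ≈ sum (λ j → ψ.⟦ a j ⟧ * vectors j) →
                           ∀ j → Basis.coordinate latticeBasis⇒basis x j k.≈ φ.⟦ a j ⟧
      coordinate-vectors a e = FreeAlgebra.coordinate-unique k K ι latticeBasis⇒basis (λ j → φ.⟦ a j ⟧)
        (trans e (sum-cong λ j → *-congʳ {vectors j} (coherent (a j))))

  module MonicClosure (Q : Carrier → Set p) (Q-resp : ∀ {x y} → x ≈ y → Q x → Q y) (Q-0 : Q 0#)
                      (Q-+ : ∀ {x y} → Q x → Q y → Q (x + y)) (Q-ψ : ∀ a {x} → Q x → Q (ψ.⟦ a ⟧ * x)) (x : Carrier) where

    private
      -- In Horner form the monic leading term cancels, and what remains is a combination over A of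
      -- the elements x^l z with l < n.
      remainder : ∀ P n z → AX.MonicOfDegree P n → (∀ l → l ℕ.< n → Q (x ^ l * z)) → Q (EA.eval P x * z - x ^ n * z)
      remainder []      n       z (lead , _)     low = ⊥-elim (A.1≉0 (A.sym lead))
      remainder (a ∷ P) zero    z (lead , above) low = Q-resp (sym (x≈y⇒x∙y⁻¹≈ε (*-congʳ (trans
        (+-cong (trans (ψ.⟦⟧-cong lead) ψ.1#-homo) (y≈0⇒xy≈0 x (EA.eval-zero P (AX.mk≋ λ i → above (suc i) (s≤s z≤n)))))
        (+-identityʳ 1#))))) Q-0
      remainder (a ∷ P) (suc n) z (lead , above) low = Q-resp (sym (horner ψ.⟦ a ⟧ x (EA.eval P x) z (x ^ n)))
        (Q-+ (Q-ψ a (low 0 (s≤s z≤n)))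
          (remainder P n (x * z) (lead , λ i n<i → above (suc i) (s≤s n<i)) λ l l<n →
            Q-resp (trans (*-congʳ (*-comm x (x ^ l))) (*-assoc (x ^ l) x z)) (low (suc l) (s≤s l<n))))

      Q-neg : ∀ {y} → Q y → Q (- y)
      Q-neg {y} q = Q-resp (trans (*-congʳ (trans (ψ.-‿homo A.1#) (-‿cong ψ.1#-homo))) (-1*x≈-x y)) (Q-ψ (A.- A.1#) q)

    -- The monic equation expresses x^n (x^r z) through lower powers, so a property preserved by
    -- combinations over A spreads from the first n powers to all of them.
    powers-closed : ∀ {P n} → AX.MonicOfDegree P n → EA.eval P x ≈ 0# → ∀ z → (∀ l → l ℕ.< n → Q (x ^ l * z)) → ∀ i → Q (x ^ i * z)
    powers-closed {P} {n} monic root z low i = go (suc i) i ℕ.≤-refl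
      where
      go : ∀ m i → i ℕ.< m → Q (x ^ i * z)
      go (suc m) i (s≤s i≤m) = split (i ℕ.<? n)
        where
        split : Dec (i ℕ.< n) → Q (x ^ i * z)
        split (yes i<n) = low i i<n
        split (no i≮n) = Q-resp (trans (sym (*-assoc (x ^ n) (x ^ r) z))
            (*-congʳ (trans (sym (^-homo-* x n r)) (reflexive (≡.cong (x ^_) n+r≡i)))))
          (Q-resp (sym (negate-difference (EA.eval P x * (x ^ r * z)) (x ^ n * (x ^ r * z))))
            (Q-+ (Q-resp (sym (x≈0⇒xy≈0 (x ^ r * z) root)) Q-0) (Q-neg (remainder P n (x ^ r * z) monic λ l l<n →
              Q-resp (trans (*-congʳ (^-homo-* x l r)) (*-assoc (x ^ l) (x ^ r) z))
                  (go m (l ℕ.+ r) (ℕ.<-≤-trans (ℕ.+-monoˡ-< r l<n) (ℕ.≤-trans (ℕ.≤-reflexive n+r≡i) i≤m)))))))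
          where
          r = i ℕ.∸ n
          n+r≡i : n ℕ.+ r ≡ i
          n+r≡i = ℕ.m+[n∸m]≡n (ℕ.≮⇒≥ i≮n)

  module TraceIntegral (x : Carrier) (x-integral : IsIntegral x) where

    open FreeAlgebra k K ι extensionBasis
    open Embedding extensionBasis

    InLattice : Carrier → Set _
    InLattice y = ∀ j → IsBase (coordinate y j)

    private
      P = proj₁ x-integral
      n = proj₁ (proj₂ x-integral)
      monic = proj₁ (proj₂ (proj₂ x-integral))
      root = proj₂ (proj₂ (proj₂ x-integral))

      in-resp : ∀ {y z} → y ≈ z → InLattice y → InLattice z
      in-resp e b j = base-resp (coordinate-cong e j) (b j)

      in-0 : InLattice 0#
      in-0 j = base-resp (k.sym (coordinate-zero refl j)) base-0

      in-+ : ∀ {y z} → InLattice y → InLattice z → InLattice (y + z)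
      in-+ {y} {z} b b′ j = base-resp (k.sym (coordinate-+ y z j)) (base-+ (b j) (b′ j))

      in-ψ : ∀ a {y} → InLattice y → InLattice (ψ.⟦ a ⟧ * y)
      in-ψ a {y} b j = base-resp (k.sym (coordinate-ψ a y j)) (base-* (base-frac a) (b j))

      in-sum : ∀ {m} {f : Fin m → Carrier} → (∀ i → InLattice (f i)) → InLattice (sum f)
      in-sum {zero}  b = in-0
      in-sum {suc m} b = in-+ (b zero) (in-sum (λ i → b (suc i)))

      denominator : ∀ {m} (y : Fin m → Carrier) → ∃[ s ] (¬ s A.≈ A.0#) × (∀ i → InLattice (ψ.⟦ s ⟧ * y i))
      denominator {zero}  y = A.1# , A.1≉0 , λ ()
      denominator {suc m} y with commonDenominator (coordinate (y zero)) | denominator (λ i → y (suc i))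
      ... | t , t≉0 , b₀ | s , s≉0 , b = t A.* s , *≉0 t≉0 s≉0 , λ
        { zero    → in-resp (trans (sym (*-assoc _ _ _)) (*-congʳ (trans (sym (ψ.*-homo s t)) (ψ.⟦⟧-cong (A.*-comm s t)))))
                      (in-ψ s (λ j → base-resp (k.sym (coordinate-ψ t (y zero) j)) (b₀ j)))
        ; (suc i) → in-resp (trans (sym (*-assoc _ _ _)) (*-congʳ (sym (ψ.*-homo t s)))) (in-ψ t (b i)) }

      -- A common denominator exists for these finitely many products; by `powers-closed` it serves
      -- for all powers of `x`.
      low : Fin (n ℕ.* d) → Carrier
      low i = x ^ toℕ (proj₁ (Fin.remQuot {n} d i)) * basis (proj₂ (Fin.remQuot {n} d i))

      s = proj₁ (denominator low)
      s≉0 = proj₁ (proj₂ (denominator low))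

      low-in : ∀ (l : Fin n) j → InLattice (ψ.⟦ s ⟧ * (x ^ toℕ l * basis j))
      low-in l j = ≡.subst (λ lj → InLattice (ψ.⟦ s ⟧ * (x ^ toℕ (proj₁ lj) * basis (proj₂ lj))))
          (Fin.remQuot-combine {n} {d} l j)
        (proj₂ (proj₂ (denominator low)) (Fin.combine l j))

      powers-in : ∀ i j → InLattice (ψ.⟦ s ⟧ * (x ^ i * basis j))
      powers-in i j = powers-closed {P = P} monic root (basis j)
          (λ l l<n → ≡.subst (λ m → InLattice (ψ.⟦ s ⟧ * (x ^ m * basis j))) (Fin.toℕ-fromℕ< l<n) (low-in (Fin.fromℕ< l<n) j)) i
        where
        open MonicClosure (λ y → InLattice (ψ.⟦ s ⟧ * y)) (λ e → in-resp (*-congˡ e)) (in-resp (sym (zeroʳ _)) in-0)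
          (λ b b′ → in-resp (sym (distribˡ _ _ _)) (in-+ b b′)) (λ a {y} b → in-resp (x·yz≈y·xz ψ.⟦ a ⟧ ψ.⟦ s ⟧ y) (in-ψ a b)) x

    -- The largest x-stable submodule of the span of the basis over A.
    stable : Submodule A d _
    stable = record
      { Member = λ v → ∀ i → InLattice (x ^ i * embed v)
      ; ∈-resp = λ e b i → in-resp (*-congˡ (embed-cong e)) (b i)
      ; ∈-zero = λ i → in-resp (sym (y≈0⇒xy≈0 (x ^ i) (embed-zero λ _ → A.refl))) in-0
      ; ∈-+ = λ {v} {w} b b′ i → in-resp (sym (trans (*-congˡ (embed-+ v w)) (distribˡ _ _ _))) (in-+ (b i) (b′ i))
      ; ∈-scale = λ a {v} b i → in-resp (sym (trans (*-congˡ (embed-scale a v)) (x·yz≈y·xz _ _ _))) (in-ψ a (b i))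
      }

    private
      -- The factor `s` brings every x^i b_j into the span of the basis over A. Hence the stable
      -- submodule contains s A^d and has full rank.
      contains : ∀ {v} → (∀ j → s A.∣ v j) → Submodule.Member stable v
      contains {v} div i = in-resp (sym (*-distribˡ-sum (x ^ i) (λ j → ι.⟦ φ.⟦ v j ⟧ ⟧ * basis j))) (in-sum λ j → term j (div j))
        where
        term : ∀ j → s A.∣ v j → InLattice (x ^ i * (ι.⟦ φ.⟦ v j ⟧ ⟧ * basis j))
        term j (h A., e) = in-resp (trans (sym (*-assoc _ _ _))
            (trans (*-congʳ (trans (sym (ψ.*-homo h s)) (trans (ψ.⟦⟧-cong e) (coherent (v j)))))
          (x·yz≈y·xz _ (x ^ i) (basis j)))) (in-ψ h (powers-in i j))

      trace-base : LatticeBasis stable → IsBase (trace x)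
      trace-base lb = base-resp (trace-basisIndependent k K ι (latticeBasis⇒basis lb) extensionBasis x) (base-sum λ i → entry i)
        where
        open LatticeBasis lb
        entry : ∀ i → IsBase (Basis.coordinate (latticeBasis⇒basis lb) (x * vectors lb i) i)
        entry i = proj₁ spanned i , k.sym (coordinate-vectors lb (proj₁ spanned)
            (trans eq (trans (embed-cong (proj₂ spanned)) (embed-sum (proj₁ spanned) vector))) i)
          where
          in-x : InLattice (x * embed (vector i))
          in-x = in-resp (*-congʳ (*-identityʳ x)) (member i 1)
          v : Fin d → A.Carrier
          v j = proj₁ (in-x j)
          eq : x * embed (vector i) ≈ embed v
          eq = trans (expansion _) (combination-cong λ j → k.sym (proj₂ (in-x j)))
          -- The power x^m applied to x u is x^(m+1) applied to u, so x u belongs to the stable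
          -- submodule along with u.
          spanned = spans {v} λ m → in-resp (trans (trans (*-congʳ (*-comm x (x ^ m))) (*-assoc (x ^ m) x _))
              (*-congˡ eq)) (member i (suc m))

    -- Membership in `stable` concerns all powers of `x` at once and is not decided here, so its
    -- basis is available under a double negation. The conclusion is decidable, which permits using
    -- it.
    trace-integral : IsBase (trace x)
    trace-integral = decidable-stable (base? (trace x)) λ not-base → ¬¬basis s≉0 stable contains λ lb → not-base (trace-base lb)

-- A basis of the ring of integers

module Indicators (R : CommutativeRing c ℓ) where

  open Ring R

  indicator : ∀ {n} → Fin n → Fin n → Carrier
  indicator l j with j Fin.≟ l
  ... | yes _ = 1#
  ... | no _  = 0#

  indicator-at : ∀ {n} (l : Fin n) → indicator l l ≈ 1#
  indicator-at l with l Fin.≟ l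
  ... | yes _ = refl
  ... | no ne = ⊥-elim (ne ≡.refl)

  indicator-off : ∀ {n} (l j : Fin n) → j ≢ l → indicator l j ≈ 0#
  indicator-off l j ne with j Fin.≟ l
  ... | yes e = ⊥-elim (ne e)
  ... | no _  = refl

  sum-indicator : ∀ {n} l (y : Fin n → Carrier) → sum (λ j → indicator l j * y j) ≈ y l
  sum-indicator l y = trans (sum-single l λ j j≢l → x≈0⇒xy≈0 (y j) (indicator-off l j j≢l))
    (trans (*-congʳ (indicator-at l)) (*-identityˡ (y l)))

module IntegerBasis (A : CommutativeRing c ℓ) (domain : EuclideanDomain A)
  (k : CommutativeRing c₁ ℓ₁) (φ : Hom A k) (fractionField : IsFractionField A k φ)
  {d : ℕ} (E : FiniteExtension k d c₂ ℓ₂)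
  (ψ : Hom A (FiniteExtension.K E))
  (coherent : ∀ a → FiniteExtension._≈_ E (RingHomomorphism.⟦_⟧ ψ a) (FiniteExtension.⟦_⟧ E (RingHomomorphism.⟦_⟧ φ a)))
  (integral? : ∀ x → Dec (IntegralClosure.IsIntegral A (FiniteExtension.K E) ψ x))
  (integralMultiple : ∀ x → ∃[ s ] (¬ CommutativeRing._≈_ A s (CommutativeRing.0# A)) ×
    IntegralClosure.IsIntegral A (FiniteExtension.K E) ψ (FiniteExtension._*_ E (RingHomomorphism.⟦_⟧ ψ s) x))
  (O : CommutativeRing c₃ ℓ₃) (base : Hom A O) (val : Hom O (FiniteExtension.K E))
  (val-injective : ∀ {x y} → FiniteExtension._≈_ E (RingHomomorphism.⟦_⟧ val x)
      (RingHomomorphism.⟦_⟧ val y) → CommutativeRing._≈_ O x y)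
  (val-base : ∀ a → FiniteExtension._≈_ E (RingHomomorphism.⟦_⟧ val (RingHomomorphism.⟦_⟧ base a)) (RingHomomorphism.⟦_⟧ ψ a))
  (val-integral : ∀ y → IntegralClosure.IsIntegral A (FiniteExtension.K E) ψ (RingHomomorphism.⟦_⟧ val y))
  (lift : ∀ x → IntegralClosure.IsIntegral A (FiniteExtension.K E) ψ x → ∃[ y ] FiniteExtension._≈_ E
      (RingHomomorphism.⟦_⟧ val y) x)
  where

  open FiniteExtension E using (K; ι)
  private module A where
    open Ring A public
    open EuclideanArithmetic A domain public
  private
    module k = Ring k
    module φ = RingHom A k φ
    module ι = RingHom k K ι
    module ψ = RingHom A K ψ
  open FractionField A domain k φ fractionField
  open Ring K
  open IntegerLattices A domain k φ fractionField E ψ coherent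
  open 𝒪 using (IsIntegral; integral-resp; integral-+; integral-*; integral-base)
  open TripleProducts K
  open Lattices A domain
  private
    module O = Ring O
    module base = RingHom A O base
    module val = RingHom O K val

    integral-0 : IsIntegral 0#
    integral-0 = integral-resp ψ.0#-homo (integral-base A.0#)

    integral-ψ : ∀ a {x} → IsIntegral x → IsIntegral (ψ.⟦ a ⟧ * x)
    integral-ψ a i = integral-* (integral-base a) i

    integral-sum : ∀ {n} {f : Fin n → Carrier} → (∀ i → IsIntegral (f i)) → IsIntegral (sum f)
    integral-sum {zero}  i = integral-0
    integral-sum {suc n} i = integral-+ (i zero) (integral-sum (λ j → i (suc j)))

  open FreeAlgebra k K ι extensionBasis

  -- The hypothesis on the discriminant concerns tuples in K and values in k, the reduction modulo P
  -- concerns values in A; `disc≈` is the passage between the two.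
  record BasisWithDisc : Set (c Level.⊔ ℓ Level.⊔ ℓ₁ Level.⊔ c₃ Level.⊔ ℓ₃) where
    field
      fb    : Basis A O base d
      disc≈ : ∀ x → φ.⟦ FreeAlgebra.disc A O base fb x ⟧ k.≈ disc (λ i → val.⟦ x i ⟧)

  module FromLattice (fb : Basis k K ι d) {L : Submodule A d p} (lattice : LatticeBasis L)
    (w : Fin d → O.Carrier) (val-w : ∀ j → val.⟦ w j ⟧ ≈ Embedding.vectors fb lattice j)
    (spanned : ∀ y → Σ[ a ∈ (Fin d → A.Carrier) ] val.⟦ y ⟧ ≈ sum (λ j → ψ.⟦ a j ⟧ * Embedding.vectors fb lattice j)) where

    open Embedding fb
    private
      val-combination : ∀ (a : Fin d → A.Carrier) → val.⟦ O.sum (λ j → base.⟦ a j ⟧ O.* w j) ⟧ ≈ sum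
          (λ j → ψ.⟦ a j ⟧ * vectors lattice j)
      val-combination a = trans (val.sum-homo (λ j → base.⟦ a j ⟧ O.* w j))
        (sum-cong λ j → trans (val.*-homo _ _) (*-cong (val-base (a j)) (val-w j)))

    integerBasis : Basis A O base d
    integerBasis = record
      { basis = w
      ; coordinate = λ y → proj₁ (spanned y)
      ; expansion = λ y → val-injective (trans (proj₂ (spanned y)) (sym (val-combination (proj₁ (spanned y)))))
      ; independent = λ a e → vectors-independent lattice a (trans (sym (val-combination a)) (trans (val.⟦⟧-cong e) val.0#-homo))
      }

    private module I = FreeAlgebra A O base integerBasis

    -- A basis of O over A is also a basis of K over k, and the trace does not depend on the basis.
    trace-integers : ∀ x → φ.⟦ I.trace x ⟧ k.≈ trace val.⟦ x ⟧
    trace-integers x = k.trans (φ.sum-homo (λ i → I.coordinate (x O.* w i) i)) (k.trans (k.sum-cong entry)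
      (trace-basisIndependent k K ι (latticeBasis⇒basis lattice) extensionBasis val.⟦ x ⟧))
      where
      entry : ∀ i → φ.⟦ I.coordinate (x O.* w i) i ⟧ k.≈ Basis.coordinate (latticeBasis⇒basis lattice)
          (val.⟦ x ⟧ * vectors lattice i) i
      entry i = k.sym (coordinate-vectors lattice (I.coordinate (x O.* w i))
        (trans (sym (trans (val.*-homo x (w i)) (*-congˡ (val-w i)))) (proj₂ (spanned (x O.* w i)))) i)

    disc-integers : ∀ x → φ.⟦ I.disc x ⟧ k.≈ disc (λ i → val.⟦ x i ⟧)
    disc-integers x = k.trans (φ.det-homo (λ i j → I.trace (x i O.* x j)))
      (DeterminantProperties.det-cong k λ i j → k.trans (trace-integers (x i O.* x j)) (trace-cong (val.*-homo (x i) (x j))))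

    basisWithDisc : BasisWithDisc
    basisWithDisc = record { fb = integerBasis ; disc≈ = disc-integers }

  module _ (nondegenerate : ∀ (v : Fin d → k.Carrier) → (∀ j → k.sum (λ i → v i k.* trace (basis i * basis j)) k.≈ k.0#) → ∀ i → v i k.≈ k.0#) where

    private
      open Indicators k

      commonMultiple : ∀ {m} (y : Fin m → Carrier) → ∃[ s ] (¬ s A.≈ A.0#) × (∀ i → IsIntegral (ψ.⟦ s ⟧ * y i))
      commonMultiple {zero}  y = A.1# , A.1≉0 , λ ()
      commonMultiple {suc m} y with integralMultiple (y zero) | commonMultiple (λ i → y (suc i))
      ... | t , t≉0 , i₀ | s , s≉0 , i = t A.* s , *≉0 t≉0 s≉0 , λ
        { zero    → integral-resp (trans (sym (*-assoc _ _ _))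
            (*-congʳ (trans (sym (ψ.*-homo s t)) (ψ.⟦⟧-cong (A.*-comm s t))))) (integral-ψ s i₀)
        ; (suc j) → integral-resp (trans (sym (*-assoc _ _ _)) (*-congʳ (sym (ψ.*-homo t s)))) (integral-ψ t (i j)) }

      s : A.Carrier
      s = proj₁ (commonMultiple basis)
      s≉0 : ¬ s A.≈ A.0#
      s≉0 = proj₁ (proj₂ (commonMultiple basis))
      s-integral : ∀ j → IsIntegral (ψ.⟦ s ⟧ * basis j)
      s-integral = proj₂ (proj₂ (commonMultiple basis))

      dual : ∀ l → Σ[ v ∈ (Fin d → k.Carrier) ] ∀ j → k.sum (λ i → v i k.* trace (basis i * basis j)) k.≈ indicator l j
      dual l = FieldLinearAlgebra.nondegenerate⇒surjective k isField _≟k_ d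
          (λ i j → trace (basis i * basis j)) nondegenerate (indicator l)

      -- Pairing with the dual basis of the trace form recovers coordinates. This turns the
      -- integrality of traces into a bound on denominators.
      coordinate-trace : ∀ y l → coordinate y l k.≈ k.sum (λ i → proj₁ (dual l) i k.* trace (basis i * y))
      coordinate-trace y l = k.sym (k.begin
        k.sum (λ i → v i k.* trace (basis i * y))
          k.≈⟨ k.sum-cong (λ i → k.*-congˡ {v i} (k.trans (trace-cong (*-congˡ (expansion y)))
              (trace-combinationʳ (basis i) (coordinate y)))) ⟩
        k.sum (λ i → v i k.* k.sum (λ j → coordinate y j k.* trace (basis i * basis j)))
          k.≈⟨ k.sum-cong (λ i → k.trans (k.*-distribˡ-sum (v i) (λ j → coordinate y j k.* trace (basis i * basis j)))
                 (k.sum-cong λ j → swap (v i) (coordinate y j) (trace (basis i * basis j)))) ⟩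
        k.sum (λ i → k.sum (λ j → (v i k.* trace (basis i * basis j)) k.* coordinate y j))
          k.≈⟨ k.∑-comm (λ i j → (v i k.* trace (basis i * basis j)) k.* coordinate y j) ⟩
        k.sum (λ j → k.sum (λ i → (v i k.* trace (basis i * basis j)) k.* coordinate y j))
          k.≈⟨ k.sum-cong (λ j → k.trans (k.sym (k.*-distribʳ-sum (coordinate y j) (λ i → v i k.* trace (basis i * basis j))))
                 (k.*-congʳ {coordinate y j} (proj₂ (dual l) j))) ⟩
        k.sum (λ j → indicator l j k.* coordinate y j)
          k.≈⟨ sum-indicator l (coordinate y) ⟩
        coordinate y l k.∎)
        where
        v = proj₁ (dual l)
        swap : ∀ a b c → a k.* (b k.* c) k.≈ (a k.* c) k.* b
        swap a b c = k.trans (k.*-congˡ (k.*-comm b c)) (k.sym (k.*-assoc a c b))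

      dual-entries : Fin (d ℕ.* d) → k.Carrier
      dual-entries li = proj₁ (dual (proj₁ (Fin.remQuot {d} d li))) (proj₂ (Fin.remQuot {d} d li))

      t : A.Carrier
      t = proj₁ (commonDenominator dual-entries)
      t≉0 : ¬ t A.≈ A.0#
      t≉0 = proj₁ (proj₂ (commonDenominator dual-entries))
      t-base : ∀ l i → IsBase (φ.⟦ t ⟧ k.* proj₁ (dual l) i)
      t-base l i = ≡.subst (λ li → IsBase (φ.⟦ t ⟧ k.* proj₁ (dual (proj₁ li)) (proj₂ li))) (Fin.remQuot-combine {d} {d} l i)
        (proj₂ (proj₂ (commonDenominator dual-entries)) (Fin.combine l i))

      -- T times the l-th coordinate of an integer y is the sum of (t v_i) Tr(s b_i y): the factor t
      -- clears the dual basis, and s makes the b_i integral, so that the traces lie in A.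
      T : A.Carrier
      T = t A.* s
      T≉0 : ¬ T A.≈ A.0#
      T≉0 = *≉0 t≉0 s≉0

      bounded : ∀ y → IsIntegral y → ∀ l → IsBase (φ.⟦ T ⟧ k.* coordinate y l)
      bounded y y-integral l = base-resp (k.sym (k.trans (k.*-congˡ (coordinate-trace y l))
          (k.trans (k.*-distribˡ-sum φ.⟦ T ⟧ (λ i → v i k.* trace (basis i * y))) (k.sum-cong term))))
        (base-sum λ i → base-* (t-base l i) (TraceIntegral.trace-integral (ψ.⟦ s ⟧ * (basis i * y))
          (integral-resp (*-assoc ψ.⟦ s ⟧ (basis i) y) (integral-* (s-integral i) y-integral))))
        where
        v = proj₁ (dual l)
        term : ∀ i → φ.⟦ T ⟧ k.* (v i k.* trace (basis i * y)) k.≈ (φ.⟦ t ⟧ k.* v i) k.* trace (ψ.⟦ s ⟧ * (basis i * y))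
        term i = k.trans (k.*-congʳ (φ.*-homo t s)) (k.trans (xz·yw φ.⟦ t ⟧ φ.⟦ s ⟧ (v i) (trace (basis i * y)))
          (k.*-congˡ (k.sym (k.trans (trace-cong (*-congʳ (coherent s))) (trace-scale φ.⟦ s ⟧ (basis i * y))))))
          where
          open IntegerSolver k using (solve; _:=_; _:*_)
          xz·yw : ∀ a b c e → (a k.* b) k.* (c k.* e) k.≈ (a k.* c) k.* (b k.* e)
          xz·yw = solve 4 (λ a b c e → (a :* b) :* (c :* e) := (a :* c) :* (b :* e)) k.refl

      T⁻¹ : k.Carrier
      T⁻¹ = proj₁ (IsField.inverse isField φ.⟦ T ⟧ (frac≉0 T≉0))
      T*T⁻¹ : φ.⟦ T ⟧ k.* T⁻¹ k.≈ k.1#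
      T*T⁻¹ = proj₂ (IsField.inverse isField φ.⟦ T ⟧ (frac≉0 T≉0))

      scaled : Basis k K ι d
      scaled = scaleBasis k K ι φ.⟦ T ⟧ T⁻¹ T*T⁻¹ extensionBasis

      open Embedding scaled

      integers : Submodule A d _
      integers = record
        { Member = λ v → IsIntegral (embed v)
        ; ∈-resp = λ e → integral-resp (embed-cong e)
        ; ∈-zero = integral-resp (sym (embed-zero λ _ → A.refl)) integral-0
        ; ∈-+ = λ {v} {w} i j → integral-resp (sym (embed-+ v w)) (integral-+ i j)
        ; ∈-scale = λ a {v} i → integral-resp (sym (embed-scale a v)) (integral-ψ a i)
        }

      -- The scaled basis consists of the elements b_j / T, so a coordinate divisible by T s gives a
      -- multiple of the integral element s b_j.
      contains : ∀ {v} → (∀ j → (T A.* s) A.∣ v j) → Submodule.Member integers v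
      contains {v} div = integral-sum λ j → term j (div j)
        where
        term : ∀ j → (T A.* s) A.∣ v j → IsIntegral (ι.⟦ φ.⟦ v j ⟧ ⟧ * (ι.⟦ T⁻¹ ⟧ * basis j))
        term j (h A., e) = integral-resp (begin
          ψ.⟦ h ⟧ * (ψ.⟦ s ⟧ * basis j)
            ≈⟨ *-cong (coherent h) (*-congʳ (coherent s)) ⟩
          ι.⟦ φ.⟦ h ⟧ ⟧ * (ι.⟦ φ.⟦ s ⟧ ⟧ * basis j)
            ≈⟨ trans (sym (*-assoc _ _ _)) (*-congʳ (sym (ι.*-homo φ.⟦ h ⟧ φ.⟦ s ⟧))) ⟩
          ι.⟦ φ.⟦ h ⟧ k.* φ.⟦ s ⟧ ⟧ * basis j
            ≈⟨ *-congʳ (ι.⟦⟧-cong (k.sym unit)) ⟩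
          ι.⟦ φ.⟦ v j ⟧ k.* T⁻¹ ⟧ * basis j
            ≈⟨ trans (*-congʳ (ι.*-homo φ.⟦ v j ⟧ T⁻¹)) (*-assoc _ _ _) ⟩
          ι.⟦ φ.⟦ v j ⟧ ⟧ * (ι.⟦ T⁻¹ ⟧ * basis j) ∎) (integral-ψ h (s-integral j))
          where
          open IntegerSolver k using (solve; _:=_; _:*_)
          move : ∀ h T s T⁻¹ → (h k.* (T k.* s)) k.* T⁻¹ k.≈ (h k.* s) k.* (T k.* T⁻¹)
          move = solve 4 (λ h T s T⁻¹ → (h :* (T :* s)) :* T⁻¹ := (h :* s) :* (T :* T⁻¹)) k.refl
          unit : φ.⟦ v j ⟧ k.* T⁻¹ k.≈ φ.⟦ h ⟧ k.* φ.⟦ s ⟧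
          unit = k.trans (k.*-congʳ (k.trans (φ.⟦⟧-cong (A.sym e)) (k.trans (φ.*-homo h _) (k.*-congˡ (φ.*-homo T s)))))
            (k.trans (move φ.⟦ h ⟧ φ.⟦ T ⟧ φ.⟦ s ⟧ T⁻¹) (k.trans (k.*-congˡ T*T⁻¹) (k.*-identityʳ _)))

      lattice : LatticeBasis integers
      lattice = decidable⇒basis (*≉0 T≉0 s≉0) integers contains (λ v → integral? (embed v))

      module Λ = LatticeBasis lattice

      spanned : ∀ y → Σ[ a ∈ (Fin d → A.Carrier) ] val.⟦ y ⟧ ≈ sum (λ j → ψ.⟦ a j ⟧ * vectors lattice j)
      spanned y = proj₁ spans-v , trans y≈v (trans (embed-cong (proj₂ spans-v)) (embed-sum (proj₁ spans-v) Λ.vector))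
        where
        v : Fin d → A.Carrier
        v j = proj₁ (bounded val.⟦ y ⟧ (val-integral y) j)
        y≈v : val.⟦ y ⟧ ≈ embed v
        y≈v = trans (Basis.expansion scaled val.⟦ y ⟧) (FreeAlgebra.combination-cong k K ι scaled λ j → k.sym
            (proj₂ (bounded val.⟦ y ⟧ (val-integral y) j)))
        spans-v = Λ.spans {v} (integral-resp y≈v (val-integral y))

    integersBasis : BasisWithDisc
    integersBasis = FromLattice.basisWithDisc scaled lattice
      (λ j → proj₁ (lift (vectors lattice j) (Λ.member j))) (λ j → proj₂ (lift (vectors lattice j) (Λ.member j))) spanned

-- Reduction modulo g and the quotient ring

infixr 9 _∘ʰ_
_∘ʰ_ : {A : CommutativeRing c ℓ} {B : CommutativeRing c₁ ℓ₁} {C : CommutativeRing c₂ ℓ₂} → Hom B C → Hom A B → Hom A C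
_∘ʰ_ {A = A} {B} {C} ψ φ = ringHomomorphism {M₁ = CommutativeRing.ring A} {M₂ = CommutativeRing.ring B}
    {M₃ = CommutativeRing.ring C} φ ψ

module QuotientMap (R : CommutativeRing c ℓ) (g : CommutativeRing.Carrier R) where

  open Ring R

  R/g : CommutativeRing c (c Level.⊔ ℓ)
  R/g = quotient R (principal R g)

  ≈⇒∼ : ∀ {x y} → x ≈ y → CommutativeRing._≈_ R/g x y
  ≈⇒∼ e = mk∼ (0# , trans (zeroˡ g) (sym (x≈y⇒x∙y⁻¹≈ε e)))

  ∼⇒∣ : ∀ {x y} → CommutativeRing._≈_ R/g x y → g ∣ (x - y)
  ∼⇒∣ (mk∼ d) = d

  ∣⇒∼0 : ∀ {x} → g ∣ x → CommutativeRing._≈_ R/g x 0#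
  ∣⇒∼0 {x} d = mk∼ (∣ʳ-respʳ-≈ (sym (trans (+-congˡ -0#≈0#) (+-identityʳ x))) d)

  ∼0⇒∣ : ∀ {x} → CommutativeRing._≈_ R/g x 0# → g ∣ x
  ∼0⇒∣ {x} (mk∼ d) = ∣ʳ-respʳ-≈ (trans (+-congˡ -0#≈0#) (+-identityʳ x)) d

  π : Hom R R/g
  π = record
    { ⟦_⟧ = λ x → x
    ; isRingHomomorphism = record
      { isSemiringHomomorphism = record
        { isNearSemiringHomomorphism = record
          { +-isMonoidHomomorphism = record
            { isMagmaHomomorphism = record
              { isRelHomomorphism = record { cong = ≈⇒∼ }
              ; homo = λ _ _ → ≈⇒∼ refl
              }
            ; ε-homo = ≈⇒∼ refl
            }
          ; *-homo = λ _ _ → ≈⇒∼ refl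
          }
        ; 1#-homo = ≈⇒∼ refl
        }
      ; -‿homo = λ _ → ≈⇒∼ refl
      }
    }

module Reduction (A : CommutativeRing c ℓ) (O : CommutativeRing c₁ ℓ₁) (φ : Hom A O) {d : ℕ} (fb : Basis A O φ d)
                 (g : CommutativeRing.Carrier A) where

  private
    module A = Ring A
    module φ = RingHom A O φ
  open Ring O
  open FreeAlgebra A O φ fb
  module QA = QuotientMap A g
  module QO = QuotientMap O φ.⟦ g ⟧
  open QA using () renaming (R/g to Ā) public
  open QO using () renaming (R/g to Ō) public

  φ̄ : Hom Ā Ō
  φ̄ = record
    { ⟦_⟧ = φ.⟦_⟧
    ; isRingHomomorphism = record
      { isSemiringHomomorphism = record
        { isNearSemiringHomomorphism = record
          { +-isMonoidHomomorphism = record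
            { isMagmaHomomorphism = record
              { isRelHomomorphism = record
                { cong = λ { (mk∼ div) → mk∼ (∣ʳ-respʳ-≈ (trans (φ.+-homo _ _) (+-congˡ (φ.-‿homo _))) (φ.∣-homo div)) } }
              ; homo = λ x y → QO.≈⇒∼ (φ.+-homo x y)
              }
            ; ε-homo = QO.≈⇒∼ φ.0#-homo
            }
          ; *-homo = λ x y → QO.≈⇒∼ (φ.*-homo x y)
          }
        ; 1#-homo = QO.≈⇒∼ φ.1#-homo
        }
      ; -‿homo = λ x → QO.≈⇒∼ (φ.-‿homo x)
      }
    }

  -- Independence survives reduction because divisibility by an element of A can be tested on
  -- coordinates.
  reducedBasis : Basis Ā Ō φ̄ d
  reducedBasis = record
    { basis = basis
    ; coordinate = coordinate
    ; expansion = λ x → QO.≈⇒∼ (expansion x)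
    ; independent = λ a e i → QA.∣⇒∼0 (A.∣ʳ-respʳ-≈ (coordinate-unique a refl i) (∣-coordinate (QO.∼0⇒∣ e) i))
    }

  disc-reduced : ∀ x → CommutativeRing._≈_ Ā (FreeAlgebra.disc Ā Ō φ̄ reducedBasis x) A.0# → g A.∣ disc x
  disc-reduced x e = QA.∼0⇒∣ (CommutativeRing.trans Ā (RingHom.det-homo A Ā QA.π (λ i j → trace (x i * x j))) e)

module CarmichaelQuotient
  (𝔽 : CommutativeRing c₂ ℓ₂) (𝔽-isField : IsField 𝔽)
  (A : CommutativeRing c ℓ) (domain : EuclideanDomain A)
  (𝔽-card : HasCardinality 𝔽 (EuclideanDomain.q domain)) (const : Hom 𝔽 A)
  (O : CommutativeRing c₁ ℓ₁) (φ : Hom A O) {d : ℕ} (1≤d : 1 ℕ.≤ d) (fb : Basis A O φ d)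
  {g : CommutativeRing.Carrier A} {n : ℕ} (dg : EuclideanDomain.HasDegree domain g n)
  where

  private module A where
    open Ring A public
    open EuclideanArithmetic A domain public
  private
    module φ = RingHom A O φ
    module AI = Indicators A
  open Ring O
  open FreeAlgebra A O φ fb

  coordinate-basis : ∀ i → coordinate (basis i) i A.≈ A.1#
  coordinate-basis i = A.trans (coordinate-unique (AI.indicator i) (sym (trans (sum-single i λ j j≢i →
      x≈0⇒xy≈0 (basis j) (trans (φ.⟦⟧-cong (AI.indicator-off i j j≢i)) φ.0#-homo))
    (trans (*-congʳ (trans (φ.⟦⟧-cong (AI.indicator-at i)) φ.1#-homo)) (*-identityˡ (basis i))))) i) (AI.indicator-at i)

  -- Multiplying by a basis element and comparing its own coordinate returns the two elements of A.
  -- Such an index exists because d ≥ 1.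
  ∣-reflects : ∀ {x y} → φ.⟦ x ⟧ ∣ φ.⟦ y ⟧ → x A.∣ y
  ∣-reflects {x} {y} div = A.∣ʳ-respʳ-≈ (A.trans (coordinate-scale y (basis i) i)
      (A.trans (A.*-congˡ (coordinate-basis i)) (A.*-identityʳ y)))
    (∣-coordinate (∣ʳ-respʳ-≈ (*-comm (basis i) φ.⟦ y ⟧) (x∣ʳy⇒x∣ʳzy (basis i) div)) i)
    where
    i = Fin.fromℕ< 1≤d

  O/g : CommutativeRing c₁ (c₁ Level.⊔ ℓ₁)
  O/g = quotient O (principal O φ.⟦ g ⟧)

  -- The image of x is not zero, since g | x would make y a unit. It is not invertible either: x
  -- divides g, so an inverse modulo g would make x divide 1. Both divisibilities are brought back
  -- from O to A.
  notField : ∀ x y → g A.≈ x A.* y → x A.∤ A.1# → y A.∤ A.1# → ¬ IsField O/g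
  notField x y g≈xy x∤1 y∤1 isField = contradict (inverse φ.⟦ x ⟧ x≁0)
    where
    open IsField isField
    module Q = QuotientMap O φ.⟦ g ⟧
    x≉0 : ¬ x A.≈ A.0#
    x≉0 e = A.degree⇒≉0 dg (A.trans g≈xy (A.x≈0⇒xy≈0 y e))
    x≁0 : ¬ CommutativeRing._≈_ O/g φ.⟦ x ⟧ 0#
    x≁0 e = refute (∣-reflects (Q.∼0⇒∣ e))
      where
      refute : ¬ g A.∣ x
      refute (r A., rg≈x) = y∤1 (r A., A.sym (A.*-cancelˡ x≉0 (A.trans (A.*-identityʳ x) (A.trans (A.sym rg≈x)
        (A.trans (A.*-congˡ g≈xy) (swap r x y))))))
        where
        swap : ∀ r x y → r A.* (x A.* y) A.≈ x A.* (r A.* y)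
        swap = TripleProducts.x·yz≈y·xz A
    contradict : ∃[ z ] CommutativeRing._≈_ O/g (φ.⟦ x ⟧ * z) 1# → ⊥
    contradict (z , mk∼ g∣xz-1) = x∤1 (∣-reflects (∣ʳ-respʳ-≈ (sym φ.1#-homo) (∣ʳ-respʳ-≈ (cancel (φ.⟦ x ⟧ * z) 1#)
      (∣-+ (x∣xy φ.⟦ x ⟧ z) (∣-neg (∣ʳ-trans (φ.∣-homo x∣g) g∣xz-1))))))
      where
      x∣g : x A.∣ g
      x∣g = y A., A.trans (A.*-comm y x) (A.sym g≈xy)
      cancel : ∀ a b → a + - (a - b) ≈ b
      cancel = solve 2 (λ a b → a :+ (:- (a :- b)) := b) refl
        where open IntegerSolver O

  private
    N = A.q ℕ.^ n
    module A/g = Inverse (A.hasCardinality dg)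

    representative : Fin (N ℕ.^ d) → Carrier
    representative i = combination (λ j → A/g.to (Fin.finToFun {N} {d} i j))

    index : Carrier → Fin (N ℕ.^ d)
    index x = Fin.funToFin {d} (λ j → A/g.from (coordinate x j))

    coordinate-- : ∀ x y j → coordinate (x - y) j A.≈ coordinate x j A.- coordinate y j
    coordinate-- x y j = A.trans (A.trans (coordinate-+ x (- y) j)
        (A.+-congˡ (A.trans (coordinate-cong (sym (trans (*-congʳ (trans (φ.-‿homo A.1#) (-‿cong φ.1#-homo))) (-1*x≈-x y))) j)
      (coordinate-scale (A.- A.1#) y j)))) (A.+-congˡ (A.-1*x≈-x _))

    coordinate-representative : ∀ i j → coordinate (representative i) j A.≈ A/g.to (Fin.finToFun {N} {d} i j)
    coordinate-representative i = coordinate-unique (λ j → A/g.to (Fin.finToFun {N} {d} i j)) refl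

    representative-index : ∀ x → φ.⟦ g ⟧ ∣ (representative (index x) - x)
    representative-index x = coordinate-∣ λ j → A.∣ʳ-respʳ-≈ (A.sym (A.trans (coordinate-- (representative (index x)) x j)
        (A.+-congʳ (coordinate-representative (index x) j))))
      (_∼_.difference (A/g.inverseˡ {coordinate x j} (Fin.finToFun-funToFin {d} (λ j → A/g.from (coordinate x j)) j)))

    index-unique : ∀ i x → φ.⟦ g ⟧ ∣ (x - representative i) → index x ≡ i
    index-unique i x div = ≡.trans (funToFin-cong λ j → A/g.inverseʳ {Fin.finToFun {N} {d} i j} (mk∼ (A.∣ʳ-respʳ-≈
        (A.trans (coordinate-- x (representative i) j) (A.+-congˡ (A.-‿cong (coordinate-representative i j))))
            (∣-coordinate div j))))
      (Fin.funToFin-finToFin {d} {N} i)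

  hasCardinality : HasCardinality O/g (N ℕ.^ d)
  hasCardinality = quotient-hasCardinality O φ.⟦ g ⟧ representative index representative-index index-unique

  module _ (squareFree : A.IsSquareFree g)
           (rigid : ∀ P → A.Irreducible P → P A.∣ g → ∀ {m} → A.HasDegree P m → ∀ i → 1 ℕ.≤ i → i ℕ.≤ d → i ℕ.* m ℕ.∣ d ℕ.* n)
           (unramified : ∀ P → A.Irreducible P → P A.∣ g → ¬ (∀ x → P A.∣ disc x))
           (a : Carrier) where

    private
      fixed-mod-prime : ∀ P → A.Irreducible P → P A.∣ g → φ.⟦ P ⟧ ∣ (a ^ (A.q ℕ.^ (d ℕ.* n)) - a)
      fixed-mod-prime P irr P∣g = QO.∼⇒∣ (CommutativeRing.trans Ō (RingHom.^-homo O Ō QO.π a (A.q ℕ.^ (d ℕ.* n))) (frobenius-fixed a))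
        where
        open Reduction A O φ fb P
        dP = proj₂ (A.degree (A.irreducible≉0 irr))
        F-card = A.hasCardinality dP
        nondegenerate : ¬ (∀ x → CommutativeRing._≈_ Ā (FreeAlgebra.disc Ā Ō φ̄ reducedBasis x) (CommutativeRing.0# Ā))
        nondegenerate all = unramified P irr P∣g λ x → disc-reduced x (all x)
        -- Two fields act on O/P: the field with q elements makes q-th powers additive, and A/P with
        -- its q^m elements supplies the coefficients of the relation.
        open FrobeniusFixed 𝔽 𝔽-isField 𝔽-card Ā (A.residueField irr) F-card Ō
          (_∘ʰ_ {A = 𝔽} {A} {Ō} (_∘ʰ_ {A = A} {O} {Ō} QO.π φ) const) φ̄ reducedBasis
          (FieldAlgebra.square≈0⇒≈0 Ā (A.residueField irr) (finite⇒decidable Ā F-card) Ō φ̄ reducedBasis nondegenerate)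
          (d ℕ.* n) (rigid P irr P∣g dP)

    power-fixed : CommutativeRing._≈_ O/g (RingNotions._^_ O/g a (N ℕ.^ d)) a
    power-fixed = CommutativeRing.trans O/g (CommutativeRing.sym O/g (RingHom.^-homo O O/g (QuotientMap.π O φ.⟦ g ⟧) a (N ℕ.^ d)))
      (≡.subst (λ e → CommutativeRing._≈_ O/g (a ^ e) a)
        -- The cardinality arises as (q^n)^d, one residue for each coordinate, and is read as
        -- q^(dn).
        (≡.trans (≡.cong (A.q ℕ.^_) (ℕ.*-comm d n)) (≡.sym (ℕ.^-*-assoc A.q n d)))
        (mk∼ (A.squareFree-∣ O φ (a ^ (A.q ℕ.^ (d ℕ.* n)) - a) dg squareFree fixed-mod-prime)))

-- Assembly and specialization to function fields

open FunctionField


-- Reduces divisibility of the discriminant ideal to its generators, the discriminants of tuples of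
-- integers.
generated-∣ : (R : CommutativeRing c ℓ) → let open Ring R in
  ∀ {X : Carrier → Set p} g → (∀ x → X x → g ∣ x) → ∀ {x} → Generated R X x → g ∣ x
generated-∣ R g all (generator x∈) = all _ x∈
generated-∣ R g all (resp e x)     = Ring.∣ʳ-respʳ-≈ R e (generated-∣ R g all x)
generated-∣ R g all nil            = Ring._∣0 R g
generated-∣ R g all (add x y)      = Ring.∣-+ R (generated-∣ R g all x) (generated-∣ R g all y)
generated-∣ R g all (scale r x)    = Ring.x∣ʳy⇒x∣ʳzy R r (generated-∣ R g all x)

module IntegralClosureHoms (A : CommutativeRing c ℓ) (B : CommutativeRing c₁ ℓ₁) (φ : Hom A B) where

  private
    module φ = RingHomomorphism φ
    module B = CommutativeRing B
  open IntegralClosure A B φ using (fromBase; value; value≈; mk≈)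

  fromBaseHom : Hom A (IntegralClosure.commutativeRing A B φ)
  fromBaseHom = record
    { ⟦_⟧ = fromBase
    ; isRingHomomorphism = record
      { isSemiringHomomorphism = record
        { isNearSemiringHomomorphism = record
          { +-isMonoidHomomorphism = record
            { isMagmaHomomorphism = record
              { isRelHomomorphism = record { cong = λ e → mk≈ (φ.⟦⟧-cong e) }
              ; homo = λ a b → mk≈ (φ.+-homo a b)
              }
            ; ε-homo = mk≈ φ.0#-homo
            }
          ; *-homo = λ a b → mk≈ (φ.*-homo a b)
          }
        ; 1#-homo = mk≈ φ.1#-homo
        }
      ; -‿homo = λ a → mk≈ (φ.-‿homo a)
      }
    }

  valueHom : Hom (IntegralClosure.commutativeRing A B φ) B
  valueHom = record
    { ⟦_⟧ = value
    ; isRingHomomorphism = record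
      { isSemiringHomomorphism = record
        { isNearSemiringHomomorphism = record
          { +-isMonoidHomomorphism = record
            { isMagmaHomomorphism = record
              { isRelHomomorphism = record { cong = value≈ }
              ; homo = λ _ _ → B.refl
              }
            ; ε-homo = B.refl
            }
          ; *-homo = λ _ _ → B.refl
          }
        ; 1#-homo = B.refl
        }
      ; -‿homo = λ _ → B.refl
      }
    }

-- The maps `base` and `val` with `val-injective`, `val-integral` and `lift` describe O as the
-- integral closure of A in K without fixing its construction.
module CarmichaelInExtension
  (𝔽 : CommutativeRing c₃ ℓ₃) (𝔽-isField : IsField 𝔽)
  (A : CommutativeRing c ℓ) (domain : EuclideanDomain A)
  (𝔽-card : HasCardinality 𝔽 (EuclideanDomain.q domain)) (const : Hom 𝔽 A)
  (k : CommutativeRing c₁ ℓ₁) (φ : Hom A k) (fractionField : IsFractionField A k φ)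
  {d : ℕ} (1≤d : 1 ≤ d) (E : FiniteExtension k d c₂ ℓ₂)
  (ψ : Hom A (FiniteExtension.K E))
  (coherent : ∀ a → FiniteExtension._≈_ E (RingHomomorphism.⟦_⟧ ψ a) (FiniteExtension.⟦_⟧ E (RingHomomorphism.⟦_⟧ φ a)))
  (separable : IsSeparable E)
  (O : CommutativeRing c₄ ℓ₄) (base : Hom A O) (val : Hom O (FiniteExtension.K E))
  (val-injective : ∀ {x y} → FiniteExtension._≈_ E (RingHomomorphism.⟦_⟧ val x)
      (RingHomomorphism.⟦_⟧ val y) → CommutativeRing._≈_ O x y)
  (val-base : ∀ a → FiniteExtension._≈_ E (RingHomomorphism.⟦_⟧ val (RingHomomorphism.⟦_⟧ base a)) (RingHomomorphism.⟦_⟧ ψ a))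
  (val-integral : ∀ y → IntegralClosure.IsIntegral A (FiniteExtension.K E) ψ (RingHomomorphism.⟦_⟧ val y))
  (lift : ∀ x → IntegralClosure.IsIntegral A (FiniteExtension.K E) ψ x → ∃[ y ] FiniteExtension._≈_ E (RingHomomorphism.⟦_⟧ val y) x) where

  private module A where
    open Ring A public
    open EuclideanArithmetic A domain public
  private
    module k = Ring k
    module φ = RingHomomorphism φ
    module val = RingHomomorphism val
  open IsFractionField fractionField using (_≟k_; isField; injective)
  open Integrality A domain k φ fractionField E ψ coherent using (integral?; integralMultiple)
  open IntegerBasis A domain k φ fractionField E ψ coherent
    (λ x → integral? (proj₁ (proj₂ (separable x)))) (λ x → integralMultiple (proj₁ (proj₂ (separable x))))
    O base val val-injective val-base val-integral lift
  open IntegerLattices A domain k φ fractionField E ψ coherent using (extensionBasis)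
  open FiniteExtension E using (K; ι; trace; basis; disc; _*_; *-comm)

  module _ {g : A.Carrier} (squareFree : A.IsSquareFree g)
    {x y : A.Carrier} (g≈xy : g A.≈ x A.* y) (x∤1 : x A.∤ A.1#) (y∤1 : y A.∤ A.1#)
    (rigid : ∀ P → A.Irreducible P → P A.∣ g → ∀ {m n} → A.HasDegree P m → A.HasDegree g n →
             ∀ i → 1 ≤ i → i ≤ d → i ℕ.* m ℕ.∣ d ℕ.* n)
    (unramified : ∀ P → A.Irreducible P → P A.∣ g →
                  ¬ (∀ (x : Fin d → CommutativeRing.Carrier O) D → φ.⟦ D ⟧ k.≈ disc (λ i → val.⟦ x i ⟧) → P A.∣ D)) where

    private
      -- The square of zero divides zero, so a square-free zero would be a unit.
      g≉0 : ¬ g A.≈ A.0#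
      g≉0 e = A.1≉0 (A.trans (A.sym (RawMagmaDefinitions._∣ʳ_.equality 0∣1)) (A.zeroʳ _))
        where
        0∣1 : A.0# A.∣ A.1#
        0∣1 = squareFree A.0# (A.0# A., A.trans (A.zeroˡ _) (A.sym e))

      g∤1 : g A.∤ A.1#
      g∤1 g∣1 = x∤1 (A.∣ʳ-trans (y A., A.trans (A.*-comm y x) (A.sym g≈xy)) g∣1)

      -- Since g is neither zero nor a unit, it has a prime factor P. If all discriminants were
      -- zero, P would divide them, contrary to `unramified`.
      nondegenerate : ∀ v → (∀ j → k.sum (λ i → v i k.* trace (basis i * basis j)) k.≈ k.0#) → ∀ i → v i k.≈ k.0#
      nondegenerate v ker p = decidable-stable (v p ≟k k.0#) λ vp≉0 → contradict vp≉0 (A.irreducibleFactor g≉0 g∤1)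
        where
        contradict : ¬ v p k.≈ k.0# → (∃[ P ] A.Irreducible P × P A.∣ g) → ⊥
        contradict vp≉0 (P , irr , P∣g) = unramified P irr P∣g λ x D e →
          A.∣ʳ-respʳ-≈ (A.sym (injective (k.trans e (k.trans (disc≈0 (λ i → val.⟦ x i ⟧)) (k.sym φ.0#-homo))))) (P A.∣0)
          where
          disc≈0 : ∀ x → disc x k.≈ k.0#
          disc≈0 = FieldAlgebra.degenerate⇒disc≈0 k isField _≟k_ K ι extensionBasis v p vp≉0
            (λ i → k.trans (k.sum-cong λ j → k.*-congˡ {v j}
                (FreeAlgebra.trace-cong k K ι extensionBasis (*-comm (basis i) (basis j)))) (ker i))

      module _ (basisWithDisc : BasisWithDisc) where

        open BasisWithDisc basisWithDisc

        dg = proj₂ (A.degree g≉0)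

        basis-unramified : ∀ P → A.Irreducible P → P A.∣ g → ¬ (∀ x → P A.∣ FreeAlgebra.disc A O base fb x)
        basis-unramified P irr P∣g all = unramified P irr P∣g λ x D e →
          A.∣ʳ-respʳ-≈ (A.sym (injective (k.trans e (k.sym (disc≈ x))))) (all x)

        open CarmichaelQuotient 𝔽 𝔽-isField A domain 𝔽-card const O base 1≤d fb dg

        fromBasis : IsCarmichaelIdeal O (principal O (RingHomomorphism.⟦_⟧ base g))
        fromBasis = record
          { order = _
          ; hasCardinality = hasCardinality
          ; notField = notField x y g≈xy x∤1 y∤1
          ; power = power-fixed squareFree (λ P irr P∣g dP → rigid P irr P∣g dP dg) basis-unramified
          }

    isCarmichael : IsCarmichaelIdeal O (principal O (RingHomomorphism.⟦_⟧ base g))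
    isCarmichael = fromBasis (integersBasis nondegenerate)

module Instance {c ℓ c′ ℓ′ : Level} (𝔽 : FiniteField c ℓ) (d : ℕ) (1≤d : 1 ≤ d)
  (g : CommutativeRing.Carrier (𝔽[t] 𝔽)) (g-rigid : IsRigidCarmichael 𝔽 d g)
  (K : FiniteExtension (𝔽⟨t⟩ 𝔽) d c′ ℓ′) (separable : IsSeparable K) (unramified : DiscriminantPrimeTo 𝔽 K g) where

  private
    open FiniteField 𝔽
    open IsRigidCarmichael g-rigid
    open FiniteExtension K using (refl)
    open IntegralClosureHoms (𝔽[t] 𝔽) (FiniteExtension.K K) (𝔽[t]→K 𝔽 K)

    domain = PolynomialArithmetic.euclideanDomain 𝔽

    fractionField : IsFractionField (𝔽X.commutativeRing 𝔽) (𝔽⟨t⟩ 𝔽) (fraction 𝔽)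
    fractionField = fractions-isFractionField (𝔽X.commutativeRing 𝔽) domain (Dom.1≉0 𝔽) (Dom.⊗-cancelˡ-nonZero 𝔽)

    base : Hom (𝔽X.commutativeRing 𝔽) (𝒪K 𝔽 K)
    base = fromBaseHom

    val : Hom (𝒪K 𝔽 K) (FiniteExtension.K K)
    val = valueHom

    module Extension = CarmichaelInExtension ring isField (𝔽X.commutativeRing 𝔽) domain hasCardinality (Polynomial.constHom ring)
      (𝔽⟨t⟩ 𝔽) (fraction 𝔽) fractionField 1≤d K (𝔽[t]→K 𝔽 K) (λ _ → refl) separable
      (𝒪K 𝔽 K) base val IntegralClosure.mk≈ (λ _ → refl) IntegralClosure.integral (λ x i → (IntegralClosure._,_ x i) , refl)

    carmichael : IsCarmichaelIdeal (𝒪K 𝔽 K) (principal (𝒪K 𝔽 K) (RingHomomorphism.⟦_⟧ base g))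
    carmichael = Extension.isCarmichael squareFree
      (proj₁ (proj₂ (proj₂ reducible))) (proj₁ (proj₂ (proj₂ (proj₂ reducible)))) (proj₂ (proj₂ (proj₂ (proj₂ reducible))))
      rigid (λ P irr P∣g all → unramified P irr P∣g λ D → generated-∣ (𝔽[t] 𝔽) P λ { D (x , e) → all x D e })

  isCarmichaelIn : IsCarmichaelIn 𝔽 K g
  -- The two images of g in O are equal by definition; the substitution confines the comparison to
  -- these elements.
  isCarmichaelIn = ≡.subst (λ α → IsCarmichaelIdeal (𝒪K 𝔽 K) (principal (𝒪K 𝔽 K) α))
    {RingHomomorphism.⟦_⟧ base g} {𝒪.fromBase 𝔽 K g} ≡.refl carmichael

theorem5p3 : {c ℓ c′ ℓ′ : Level} (𝔽 : FiniteField c ℓ) (d : ℕ) → 1 ≤ d →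
    (g : CommutativeRing.Carrier (𝔽[t] 𝔽)) → IsRigidCarmichael 𝔽 d g →
    (K : FiniteExtension (𝔽⟨t⟩ 𝔽) d c′ ℓ′) → IsSeparable K →
    DiscriminantPrimeTo 𝔽 K g → IsCarmichaelIn 𝔽 K g
theorem5p3 = Instance.isCarmichaelIn
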